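{- Consider the following search problem. An unknown multiset $S$ of $k$ integers, each in $\{1,\dots,n\}$, is fixed. An algorithm repeatedly chooses a query $Y\in\{1,\dots,n\}$ (possibly adaptively and with randomness, depending on previous answers); each time, an element $X$ of $S$ is selected uniformly at random, independently of everything else, and the algorithm is told only whether $X\le Y$ or $X>Y$. At the end the algorithm outputs a multiset, and it is required that for every multiset $S$ the output equals $S$ with probability at least $1-\delta$. Then, for an error parameter $\delta$ with $n^{ -O(1)}<\delta<1/4$, the number of queries needed to determine $S$ is $\Theta(k^3\log n)$ when $k\le n$, and $\Theta(k^2 n\log n)$ when $k\ge n$. (The constants in $\Theta(\cdot)$ may depend on the constant $\beta$ for which $\delta\ge n^{ -\beta}$.)
   Context: Queries are the only cost measure. The lower bound is meant for algorithms achieving the success guarantee; the upper bound is achieved by an algorithm achieving error at most $\delta$.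
   Formalization: The error parameter δ is taken rational, and a randomized algorithm is a finite mixture, with rational probabilities, of deterministic adaptive algorithms. -}

module Defs where

open import Data.Nat as ℕ using (ℕ; zero; suc; NonZero)
open import Data.Fin using (Fin; zero; suc)
open import Data.Vec using (Vec; []; _∷_)
import Data.Vec.Properties as VecP
open import Data.Nat.Properties using () renaming (_≟_ to _≟ℕ_)
open import Data.Integer using (+_)
open import Data.Rational using (ℚ; _/_; 0ℚ; 1ℚ; _+_; _*_; _-_; _≤_)
open import Data.List using (List; []; _∷_)
open import Data.List.Relation.Unary.All using (All)
open import Data.Product using (_×_; _,_; proj₁)
open import Relation.Nullary using (yes; no)
open import Relation.Binary.PropositionalEquality using (_≡_)

-- A multiset of elements of {1,…,n} is represented by its count vector:
-- position i : Fin n (standing for the integer toℕ i + 1) holds the multiplicity.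
-- A multiset of size k is a count vector whose entries sum to k.
Multiset : ℕ → Set
Multiset n = Vec ℕ n

cntLe : ∀ {n} → Multiset n → Fin n → ℕ
cntLe (x ∷ xs) zero    = x
cntLe (x ∷ xs) (suc y) = x ℕ.+ cntLe xs y

ℕ→ℚ : ℕ → ℚ
ℕ→ℚ m = (+ m) / 1

-- Deterministic adaptive algorithm making at most q queries:
-- a binary decision tree of depth ≤ q.  At a node the query Y is asked;
-- the left subtree is followed on answer "X ≤ Y", the right one on "X > Y".
-- A leaf outputs a multiset (count vector).
data Tree (n : ℕ) : ℕ → Set where
  leaf : ∀ {q} → Multiset n → Tree n q
  node : ∀ {q} → Fin n → Tree n q → Tree n q → Tree n (suc q)

-- Probability that the deterministic algorithm outputs exactly S, when
-- S has k elements and each answer is about an independent uniformly random X ∈ S.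
succProb : ∀ {n q} (k : ℕ) .{{_ : NonZero k}} → Multiset n → Tree n q → ℚ
succProb k S (leaf m) with VecP.≡-dec _≟ℕ_ m S
... | yes _ = 1ℚ
... | no  _ = 0ℚ
succProb k S (node y l r) =
  let p = (+ cntLe S y) / k in
  p * succProb k S l + (1ℚ - p) * succProb k S r

-- Randomized algorithm with at most q queries: a finite probability
-- distribution (rational weights) over deterministic algorithms.
RandAlg : ℕ → ℕ → Set
RandAlg n q = List (ℚ × Tree n q)

weightSum : ∀ {n q} → RandAlg n q → ℚ
weightSum []            = 0ℚ
weightSum ((w , _) ∷ A) = w + weightSum A

IsDistribution : ∀ {n q} → RandAlg n q → Set
IsDistribution A = All (λ wt → 0ℚ ≤ proj₁ wt) A × weightSum A ≡ 1ℚ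

randSuccProb : ∀ {n q} (k : ℕ) .{{_ : NonZero k}} → Multiset n → RandAlg n q → ℚ
randSuccProb k S []            = 0ℚ
randSuccProb k S ((w , T) ∷ A) = w * succProb k S T + randSuccProb k S A

Solvable : (n k : ℕ) .{{_ : NonZero k}} → ℚ → ℕ → Set
Solvable n k δ q =
  Data.Product.Σ (RandAlg n q) λ A → IsDistribution A ×
    ((S : Multiset n) → Data.Vec.sum S ≡ k → (1ℚ - δ) ≤ randSuccProb k S A)

{-# OPTIONS --safe #-}

-- Upper bounds.  For k ≤ n the i-th smallest element is located by a noisy binary
-- search: multiplicative weights on the positions, queried on both sides of the weighted
-- median, shrink the expected weight of the wrong positions relative to the right one by
-- 1 - Θ(1/k²) per pair of queries.  For k ≥ n each count #{X ≤ y} is estimated by a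
-- likelihood ratio test of its two neighbouring thresholds.
--
-- Lower bound.  About k/3 elements each are fixed at the left and at the right, and each of
-- K ≈ min(k,n)/3 further elements moves freely within a block of M positions.  Changing
-- one of these elements gives A = K (M - 1) ≈ n alternatives, and a query separates at most M - 1
-- of them from the truth, each by O(1/k²) in χ²-divergence.  Hence the geometric mean of the
-- A likelihood ratios of a transcript decays only by 1 + O(1/(K k²)) per query.
-- As a mean over the truths the alternatives must produce the true output with total
-- probability O(1), so by AM-GM and Cauchy-Schwarz A ≤ (1 + O(1/(K k²)))^q.
module Submission where

open import Defs
open import Data.Bool using (Bool; true; false; if_then_else_; _xor_)
open import Data.Empty using (⊥-elim)
open import Data.Fin as Fin using (Fin; zero; suc; toℕ; punchIn; _↑ˡ_; _↑ʳ_)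
import Data.Fin.Properties as Fin
import Data.Integer as ℤ
import Data.Integer.Properties as ℤ
open import Data.List as List using (List; []; _∷_; length; cartesianProductWith)
import Data.List.Properties as List
open import Data.List.Relation.Binary.Pointwise as Pointwise using (Pointwise; []; _∷_)
open import Data.List.Relation.Unary.All using (All; []; _∷_)
open import Data.List.Relation.Unary.AllPairs using ([]; _∷_)
open import Data.List.Relation.Unary.Unique.Propositional using (Unique)
import Data.List.Relation.Unary.Unique.Propositional.Properties as Unique
open import Data.Nat as ℕ using (ℕ; zero; suc; NonZero)
import Data.Nat.Properties as ℕ
open import Data.Nat.Induction using (<-rec)
open import Data.Nat.Logarithm using (⌈log₂_⌉; ⌈log₂⌉-mono-≤; ⌈log₂2^n⌉≡n; ⌈log₂⌈n/2⌉⌉≡⌈log₂n⌉∸1)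
import Data.Nat.Tactic.RingSolver as ℕ-Solver
open import Data.Product using (∃; _×_; _,_; proj₁; proj₂)
open import Data.Rational as ℚ using (ℚ)
open import Data.Sum using (_⊎_; inj₁; inj₂)
open import Data.Vec as Vec using (Vec; []; _∷_; _++_)
import Data.Vec.Properties as Vec
open import Level using (0ℓ)
open import Relation.Binary.Definitions using (tri<; tri≈; tri>)
open import Relation.Binary.PropositionalEquality
open import Relation.Nullary using (yes; no; does; contradiction)
open import Relation.Nullary.Decidable using (dec-true; dec-false; dec⇒maybe)

-- The obstacle in the lower bound is adaptivity: an algorithm may spend all its queries on one
-- block, so no useful bound holds for each alternative separately. What loses little at every node,
-- whatever is asked there, is the average over the alternatives of the logarithm of the likelihood
-- ratio. The geometric mean is its exponential; with neither logarithms nor roots in ℚ, only its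
-- A-th powers appear. The bound obtained is quadratic in the success probability s, and s² ≥ s -
-- 1/4 makes it linear, so that it passes to mixtures of trees. The elements fixed on both sides
-- keep the answer probabilities away from 0 and 1; otherwise one moved element could cause a
-- divergence of order 1/k. With k ≤ 2 there are too few elements for this, and transcripts are
-- counted instead. The upper bounds set up no probability space: the success lost against a
-- correctly informed continuation is bounded by a potential, by induction on the tree. The search
-- error n^(-β-2) serves δ, the n starting weights and a union bound over the stages.

module Queries where

  open import Algebra.Bundles using (CommutativeRing)
  open import Data.Rational hiding (NonZero)
  open import Data.Rational.Properties
  open import Data.Rational.Unnormalised as ℚᵘ using (mkℚᵘ; *≡*)
  import Data.Rational.Unnormalised.Properties as ℚᵘ
  open import Algebra.Properties.CommutativeSemiring.Exp (CommutativeRing.commutativeSemiring +-*-commutativeRing)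
    using (_^_; ^-distrib-*; ^-assocʳ)
  open import Tactic.RingSolver using (solve-∀)
  open import Tactic.RingSolver.Core.AlmostCommutativeRing using (AlmostCommutativeRing; fromCommutativeRing)

  -- Rational arithmetic

  ℚ-ring : AlmostCommutativeRing 0ℓ 0ℓ
  ℚ-ring = fromCommutativeRing +-*-commutativeRing λ x → dec⇒maybe (0ℚ ≟ x)

  ¼ : ℚ
  ¼ = ½ * ½

  ≤-by : ∀ {a b} e → 0ℚ ≤ e → b ≡ a + e → a ≤ b
  ≤-by {a} e 0≤e refl = subst (_≤ a + e) (+-identityʳ a) (+-monoʳ-≤ a 0≤e)

  0≤-diff : ∀ {a b} → a ≤ b → 0ℚ ≤ b - a
  0≤-diff {a} {b} a≤b = subst (_≤ b - a) (+-inverseʳ a) (+-monoˡ-≤ (- a) a≤b)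

  0≤+ : ∀ {a b} → 0ℚ ≤ a → 0ℚ ≤ b → 0ℚ ≤ a + b
  0≤+ {a} {b} p q = subst (_≤ a + b) (+-identityʳ 0ℚ) (+-mono-≤ p q)

  *-monoʳ : ∀ {a b c} → 0ℚ ≤ c → a ≤ b → c * a ≤ c * b
  *-monoʳ {c = c} 0≤c = *-monoˡ-≤-nonNeg c {{nonNegative 0≤c}}

  *-monoˡ : ∀ {a b c} → 0ℚ ≤ c → a ≤ b → a * c ≤ b * c
  *-monoˡ {c = c} 0≤c = *-monoʳ-≤-nonNeg c {{nonNegative 0≤c}}

  0≤* : ∀ {a b} → 0ℚ ≤ a → 0ℚ ≤ b → 0ℚ ≤ a * b
  0≤* {a} {b} p q = subst (_≤ a * b) (*-zeroʳ a) (*-monoʳ p q)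

  *-mono : ∀ {a b c d} → 0ℚ ≤ b → 0ℚ ≤ c → a ≤ b → c ≤ d → a * c ≤ b * d
  *-mono 0≤b 0≤c a≤b c≤d = ≤-trans (*-monoˡ 0≤c a≤b) (*-monoʳ 0≤b c≤d)

  0<* : ∀ {a b} → 0ℚ < a → 0ℚ < b → 0ℚ < a * b
  0<* {a} {b} p q = subst (_< a * b) (*-zeroʳ a) (*-monoʳ-<-pos a {{positive p}} q)

  *-cancelˡ-≤ : ∀ {a b c} → 0ℚ < c → c * a ≤ c * b → a ≤ b
  *-cancelˡ-≤ {c = c} 0<c = *-cancelˡ-≤-pos c {{positive 0<c}}

  0≤sq : ∀ a → 0ℚ ≤ a * a
  0≤sq a with ≤-total 0ℚ a
  ... | inj₁ 0≤a = 0≤* 0≤a 0≤a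
  ... | inj₂ a≤0 = subst (0ℚ ≤_) (eq a) (0≤* (neg-antimono-≤ a≤0) (neg-antimono-≤ a≤0))
    where
    eq : ∀ a → (- a) * (- a) ≡ a * a
    eq = solve-∀ ℚ-ring

  inverse : ∀ {a} → 0ℚ < a → ∃ λ v → 0ℚ < v × a * v ≡ 1ℚ
  inverse {a} 0<a = 1/ a , positive⁻¹ (1/ a) {{1/pos⇒pos a}} , *-inverseʳ a
    where
    instance
      _ = positive 0<a
      _ = pos⇒nonZero a

  ^-nonNeg : ∀ {a} n → 0ℚ ≤ a → 0ℚ ≤ a ^ n
  ^-nonNeg zero    _   = nonNegative⁻¹ 1ℚ
  ^-nonNeg (suc n) 0≤a = 0≤* 0≤a (^-nonNeg n 0≤a)

  ^-pos : ∀ {a} n → 0ℚ < a → 0ℚ < a ^ n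
  ^-pos zero    _   = positive⁻¹ 1ℚ
  ^-pos (suc n) 0<a = 0<* 0<a (^-pos n 0<a)

  ^-monoˡ : ∀ {a b} n → 0ℚ ≤ a → a ≤ b → a ^ n ≤ b ^ n
  ^-monoˡ zero    _   _   = ≤-refl
  ^-monoˡ (suc n) 0≤a a≤b = *-mono (≤-trans 0≤a a≤b) (^-nonNeg n 0≤a) a≤b (^-monoˡ n 0≤a a≤b)

  1^ : ∀ n → 1ℚ ^ n ≡ 1ℚ
  1^ zero = refl
  1^ (suc n) = trans (*-identityˡ _) (1^ n)

  ^-≤1 : ∀ {a} n → 0ℚ ≤ a → a ≤ 1ℚ → a ^ n ≤ 1ℚ
  ^-≤1 {a} n 0≤a a≤1 = subst (a ^ n ≤_) (1^ n) (^-monoˡ n 0≤a a≤1)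

  1≤^ : ∀ {a} n → 1ℚ ≤ a → 1ℚ ≤ a ^ n
  1≤^ {a} n 1≤a = subst (_≤ a ^ n) (1^ n) (^-monoˡ n (nonNegative⁻¹ 1ℚ) 1≤a)

  ^-monoʳ : ∀ {a m n} → 1ℚ ≤ a → m ℕ.≤ n → a ^ m ≤ a ^ n
  ^-monoʳ {n = n} 1≤a ℕ.z≤n = 1≤^ n 1≤a
  ^-monoʳ {m = suc m} 1≤a (ℕ.s≤s m≤n) = *-monoʳ (≤-trans (nonNegative⁻¹ 1ℚ) 1≤a) (^-monoʳ 1≤a m≤n)

  -- Stands in for taking n-th roots of geometric means.
  ^-cancel-≤ : ∀ {a b} n .{{_ : ℕ.NonZero n}} → 0ℚ ≤ b → a ^ n ≤ b ^ n → a ≤ b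
  ^-cancel-≤ {a} {b} (suc n) 0≤b h with a ≤? b
  ... | yes a≤b = a≤b
  ... | no  a≰b = ⊥-elim (<-irrefl refl (<-≤-trans (strict n) h))
    where
    b<a : b < a
    b<a = ≰⇒> a≰b
    0<a : 0ℚ < a
    0<a = ≤-<-trans 0≤b b<a
    strict : ∀ n → b ^ suc n < a ^ suc n
    strict n = ≤-<-trans (*-monoʳ 0≤b (^-monoˡ n 0≤b (<⇒≤ b<a)))
                         (*-monoˡ-<-pos (a ^ n) {{positive (^-pos n 0<a)}} b<a)

  opaque

    -- Opaque, so that embedded numbers are handled through the laws below and not by normalising
    -- fractions.
    ι : ℕ → ℚ
    ι = ℕ→ℚ

    ι≡ : ∀ n → ℕ→ℚ n ≡ ι n
    ι≡ n = refl

    ι0 : ι 0 ≡ 0ℚ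
    ι0 = refl

    ι1 : ι 1 ≡ 1ℚ
    ι1 = refl

    ι-+ : ∀ m n → ι (m ℕ.+ n) ≡ ι m + ι n
    ι-+ m n = toℚᵘ-injective (begin
      toℚᵘ (ι (m ℕ.+ n))                ≈⟨ toℚᵘ-fromℚᵘ (mkℚᵘ (ℤ.+ (m ℕ.+ n)) 0) ⟩
      mkℚᵘ (ℤ.+ (m ℕ.+ n)) 0                ≈⟨ *≡* (cong (ℤ._* ℤ.+ 1) (sym (cong₂ ℤ._+_ (ℤ.*-identityʳ (ℤ.+ m)) (ℤ.*-identityʳ (ℤ.+ n))))) ⟩
      mkℚᵘ (ℤ.+ m) 0 ℚᵘ.+ mkℚᵘ (ℤ.+ n) 0      ≈⟨ ℚᵘ.+-cong (toℚᵘ-fromℚᵘ (mkℚᵘ (ℤ.+ m) 0)) (toℚᵘ-fromℚᵘ (mkℚᵘ (ℤ.+ n) 0)) ⟨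
      toℚᵘ (ι m) ℚᵘ.+ toℚᵘ (ι n)      ≈⟨ toℚᵘ-homo-+ (ι m) (ι n) ⟨
      toℚᵘ (ι m + ι n)                ∎)
      where open import Relation.Binary.Reasoning.Setoid ℚᵘ.≃-setoid

    /-* : ∀ c k .{{_ : ℕ.NonZero k}} → (ℤ.+ c / k) * ι k ≡ ι c
    /-* c (suc k) = toℚᵘ-injective (begin
      toℚᵘ ((ℤ.+ c / suc k) * ι (suc k))                   ≈⟨ toℚᵘ-homo-* (ℤ.+ c / suc k) (ι (suc k)) ⟩
      toℚᵘ (ℤ.+ c / suc k) ℚᵘ.* toℚᵘ (ι (suc k))           ≈⟨ ℚᵘ.*-cong (toℚᵘ-fromℚᵘ (mkℚᵘ (ℤ.+ c) k)) (toℚᵘ-fromℚᵘ (mkℚᵘ (ℤ.+ suc k) 0)) ⟩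
      mkℚᵘ (ℤ.+ c) k ℚᵘ.* mkℚᵘ (ℤ.+ suc k) 0                   ≈⟨ *≡* eq ⟩
      mkℚᵘ (ℤ.+ c) 0                                         ≈⟨ toℚᵘ-fromℚᵘ (mkℚᵘ (ℤ.+ c) 0) ⟨
      toℚᵘ (ι c)                                         ∎)
      where
      open import Relation.Binary.Reasoning.Setoid ℚᵘ.≃-setoid
      eq : (ℤ.+ c ℤ.* ℤ.+ suc k) ℤ.* ℤ.+ 1 ≡ ℤ.+ c ℤ.* (ℤ.+ (suc k ℕ.* 1))
      eq = trans (ℤ.*-identityʳ _) (cong (λ z → ℤ.+ c ℤ.* ℤ.+ z) (sym (ℕ.*-identityʳ (suc k))))

    0≤ι : ∀ n → 0ℚ ≤ ι n
    0≤ι n = nonNegative⁻¹ (ι n) {{normalize-nonNeg n 1}}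

    0<ι : ∀ n .{{_ : ℕ.NonZero n}} → 0ℚ < ι n
    0<ι n = positive⁻¹ (ι n) {{normalize-pos n 1}}

  ι-suc : ∀ n → ι (suc n) ≡ 1ℚ + ι n
  ι-suc n = trans (ι-+ 1 n) (cong (_+ ι n) ι1)

  ι-* : ∀ m n → ι (m ℕ.* n) ≡ ι m * ι n
  ι-* zero    n = trans ι0 (sym (trans (cong (_* ι n) ι0) (*-zeroˡ (ι n))))
  ι-* (suc m) n = begin
    ι (n ℕ.+ m ℕ.* n)            ≡⟨ ι-+ n (m ℕ.* n) ⟩
    ι n + ι (m ℕ.* n)          ≡⟨ cong (λ z → ι n + z) (ι-* m n) ⟩
    ι n + ι m * ι n          ≡⟨ eq (ι n) (ι m) ⟩
    (1ℚ + ι m) * ι n           ≡⟨ cong (_* ι n) (ι-suc m) ⟨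
    ι (suc m) * ι n            ∎
    where
    open ≡-Reasoning
    eq : ∀ x y → x + y * x ≡ (1ℚ + y) * x
    eq = solve-∀ ℚ-ring

  ι-^ : ∀ m n → ι (m ℕ.^ n) ≡ ι m ^ n
  ι-^ m zero    = ι1
  ι-^ m (suc n) = trans (ι-* m (m ℕ.^ n)) (cong (ι m *_) (ι-^ m n))

  ι-mono : ∀ {m n} → m ℕ.≤ n → ι m ≤ ι n
  ι-mono {m} {n} m≤n = ≤-by (ι (n ℕ.∸ m)) (0≤ι _)
    (trans (cong ι (sym (ℕ.m+[n∸m]≡n m≤n))) (ι-+ m (n ℕ.∸ m)))

  ι-cancel : ∀ {m n} → ι m ≤ ι n → m ℕ.≤ n
  ι-cancel {m} {n} h with m ℕ.≤? n
  ... | yes m≤n = m≤n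
  ... | no  m≰n = ⊥-elim (<-irrefl refl (<-≤-trans (lt (ι n)) (≤-trans (subst (_≤ ι m) (ι-suc n) (ι-mono (ℕ.≰⇒> m≰n))) h)))
    where
    lt : ∀ x → x < 1ℚ + x
    lt x = subst (_< 1ℚ + x) (+-identityˡ x) (+-monoˡ-< x (positive⁻¹ 1ℚ))

  bernoulli : ∀ x n → 0ℚ ≤ 1ℚ + x → 1ℚ + ι n * x ≤ (1ℚ + x) ^ n
  bernoulli x zero    _ = ≤-reflexive (trans (cong (λ z → 1ℚ + z * x) ι0) (eq x))
    where
    eq : ∀ x → 1ℚ + 0ℚ * x ≡ 1ℚ
    eq = solve-∀ ℚ-ring
  bernoulli x (suc n) h = ≤-trans
    (≤-by (ι n * (x * x)) (0≤* (0≤ι n) (0≤sq x))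
      (trans (eq (ι n) x) (cong (λ z → 1ℚ + z * x + ι n * (x * x)) (sym (ι-suc n)))))
    (*-monoʳ h (bernoulli x n h))
    where
    eq : ∀ y x → (1ℚ + x) * (1ℚ + y * x) ≡ 1ℚ + (1ℚ + y) * x + y * (x * x)
    eq = solve-∀ ℚ-ring

  -- Finite sums and products, and the inequality of arithmetic and geometric means

  Σ[_] Π[_] : {A : Set} → List A → (A → ℚ) → ℚ
  Σ[ [] ] f     = 0ℚ
  Σ[ x ∷ xs ] f = f x + Σ[ xs ] f
  Π[ [] ] f     = 1ℚ
  Π[ x ∷ xs ] f = f x * Π[ xs ] f

  module _ {A : Set} where

    Σ-cong : ∀ (xs : List A) {f g} → (∀ x → f x ≡ g x) → Σ[ xs ] f ≡ Σ[ xs ] g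
    Σ-cong []       h = refl
    Σ-cong (x ∷ xs) h = cong₂ _+_ (h x) (Σ-cong xs h)

    Σ-mono : ∀ (xs : List A) {f g} → (∀ x → f x ≤ g x) → Σ[ xs ] f ≤ Σ[ xs ] g
    Σ-mono []       h = ≤-refl
    Σ-mono (x ∷ xs) h = +-mono-≤ (h x) (Σ-mono xs h)

    Σ-+ : ∀ (xs : List A) f g → Σ[ xs ] (λ x → f x + g x) ≡ Σ[ xs ] f + Σ[ xs ] g
    Σ-+ []       f g = refl
    Σ-+ (x ∷ xs) f g = trans (cong (λ z → f x + g x + z) (Σ-+ xs f g)) (eq (f x) (g x) _ _)
      where
      eq : ∀ a b c d → a + b + (c + d) ≡ (a + c) + (b + d)
      eq = solve-∀ ℚ-ring

    Σ-*ˡ : ∀ (xs : List A) c f → Σ[ xs ] (λ x → c * f x) ≡ c * Σ[ xs ] f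
    Σ-*ˡ []       c f = sym (*-zeroʳ c)
    Σ-*ˡ (x ∷ xs) c f = trans (cong (λ z → c * f x + z) (Σ-*ˡ xs c f)) (sym (*-distribˡ-+ c (f x) _))

    Σ-const : ∀ (xs : List A) c → Σ[ xs ] (λ _ → c) ≡ ι (length xs) * c
    Σ-const []       c = sym (trans (cong (_* c) ι0) (*-zeroˡ c))
    Σ-const (x ∷ xs) c = trans (cong (λ z → c + z) (Σ-const xs c))
      (trans (eq c (ι (length xs))) (cong (_* c) (sym (ι-suc (length xs)))))
      where
      eq : ∀ c n → c + n * c ≡ (1ℚ + n) * c
      eq = solve-∀ ℚ-ring

    Σ-nonNeg : ∀ (xs : List A) {f} → (∀ x → 0ℚ ≤ f x) → 0ℚ ≤ Σ[ xs ] f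
    Σ-nonNeg []       h = ≤-refl
    Σ-nonNeg (x ∷ xs) h = 0≤+ (h x) (Σ-nonNeg xs h)

    Σ-++ : ∀ (xs ys : List A) f → Σ[ xs List.++ ys ] f ≡ Σ[ xs ] f + Σ[ ys ] f
    Σ-++ []       ys f = sym (+-identityˡ _)
    Σ-++ (x ∷ xs) ys f = trans (cong (λ z → f x + z) (Σ-++ xs ys f)) (sym (+-assoc (f x) _ _))

    Σ-map : ∀ {B : Set} (g : B → A) xs f → Σ[ List.map g xs ] f ≡ Σ[ xs ] (λ x → f (g x))
    Σ-map g []       f = refl
    Σ-map g (x ∷ xs) f = cong (λ z → f (g x) + z) (Σ-map g xs f)

    Σ-swap : ∀ {B : Set} (xs : List A) (ys : List B) (f : A → B → ℚ) →
             Σ[ xs ] (λ x → Σ[ ys ] (f x)) ≡ Σ[ ys ] (λ y → Σ[ xs ] (λ x → f x y))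
    Σ-swap []       ys f = sym (Σ-const′ ys)
      where
      Σ-const′ : ∀ {B : Set} (ys : List B) → Σ[ ys ] (λ _ → 0ℚ) ≡ 0ℚ
      Σ-const′ []       = refl
      Σ-const′ (_ ∷ ys) = trans (+-identityˡ _) (Σ-const′ ys)
    Σ-swap (x ∷ xs) ys f = trans (cong (λ z → Σ[ ys ] (f x) + z) (Σ-swap xs ys f)) (Σ-+′ ys (f x) _)
      where
      Σ-+′ : ∀ {B : Set} (ys : List B) f g → Σ[ ys ] f + Σ[ ys ] g ≡ Σ[ ys ] (λ y → f y + g y)
      Σ-+′ []       f g = refl
      Σ-+′ (y ∷ ys) f g = trans (eq (f y) (g y) _ _) (cong (λ z → f y + g y + z) (Σ-+′ ys f g))
        where
        eq : ∀ a b c d → (a + c) + (b + d) ≡ a + b + (c + d)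
        eq = solve-∀ ℚ-ring

    Π-* : ∀ (xs : List A) f g → Π[ xs ] (λ x → f x * g x) ≡ Π[ xs ] f * Π[ xs ] g
    Π-* []       f g = refl
    Π-* (x ∷ xs) f g = trans (cong (λ z → f x * g x * z) (Π-* xs f g)) (eq (f x) (g x) _ _)
      where
      eq : ∀ a b c d → a * b * (c * d) ≡ (a * c) * (b * d)
      eq = solve-∀ ℚ-ring

    Π-const : ∀ (xs : List A) c → Π[ xs ] (λ _ → c) ≡ c ^ length xs
    Π-const []       c = refl
    Π-const (x ∷ xs) c = cong (c *_) (Π-const xs c)

    Π-nonNeg : ∀ (xs : List A) {f} → (∀ x → 0ℚ ≤ f x) → 0ℚ ≤ Π[ xs ] f
    Π-nonNeg []       h = nonNegative⁻¹ 1ℚ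
    Π-nonNeg (x ∷ xs) h = 0≤* (h x) (Π-nonNeg xs h)

  -- The left side is the tangent at m of the convex function x ↦ x^(n+1), evaluated at c.
  ^-tangent : ∀ {c m} n → 0ℚ ≤ c → 0ℚ ≤ m →
              m ^ n * (ι (suc n) * c - ι n * m) ≤ c ^ suc n
  ^-tangent {c} {m} zero 0≤c 0≤m = ≤-reflexive (trans (cong₂ (λ x y → 1ℚ * (x * c - y * m)) ι1 ι0) (eq c m))
    where
    eq : ∀ c m → 1ℚ * (1ℚ * c - 0ℚ * m) ≡ c * 1ℚ
    eq = solve-∀ ℚ-ring
  ^-tangent {c} {m} (suc n) 0≤c 0≤m = ≤-trans
    (≤-by (ι (suc n) * m ^ n * ((c - m) * (c - m)))
          (0≤* (0≤* (0≤ι (suc n)) (^-nonNeg n 0≤m)) (0≤sq (c - m)))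
          step)
    (*-monoʳ 0≤c (^-tangent n 0≤c 0≤m))
    where
    eq : ∀ c m p n → c * (p * ((1ℚ + n) * c - n * m)) ≡
         m * p * ((1ℚ + (1ℚ + n)) * c - (1ℚ + n) * m) + (1ℚ + n) * p * ((c - m) * (c - m))
    eq = solve-∀ ℚ-ring
    step : c * (m ^ n * (ι (suc n) * c - ι n * m)) ≡
           m ^ suc n * (ι (suc (suc n)) * c - ι (suc n) * m) + ι (suc n) * m ^ n * ((c - m) * (c - m))
    step rewrite ι-suc (suc n) | ι-suc n = eq c m (m ^ n) (ι n)

  -- Induction on the list: if c is the mean of all n + 1 entries and m that of the last n, the
  -- first entry is (n + 1) c - n m, and its product with m^n is exactly what `^-tangent` bounds by
  -- c^(n+1). The mean is an argument and not a quotient, which also covers the empty list.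
  am-gm : ∀ {A : Set} (xs : List A) f {m} → (∀ x → 0ℚ ≤ f x) → 0ℚ ≤ m →
          Σ[ xs ] f ≡ ι (length xs) * m → Π[ xs ] f ≤ m ^ length xs
  am-gm []       f 0≤f 0≤m _ = ≤-refl
  am-gm (x ∷ []) f {m} 0≤f 0≤m h = ≤-reflexive (begin
    f x * 1ℚ   ≡⟨ cong (_* 1ℚ) (trans (trans (sym (+-identityʳ (f x))) h) (trans (cong (_* m) ι1) (*-identityˡ m))) ⟩
    m * 1ℚ     ∎)
    where open ≡-Reasoning
  am-gm (x ∷ xs@(y ∷ ys)) f {c} 0≤f 0≤c h = ≤-trans
    (*-monoʳ (0≤f x) (am-gm xs f 0≤f 0≤m Σ≡))
    (subst (_≤ c ^ suc (length xs)) (trans (*-comm (m ^ length xs) _) (cong (_* m ^ length xs) fx≡)) (^-tangent (length xs) 0≤c 0≤m))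
    where
    N = ι (length xs)
    inv = inverse (0<ι (length xs))
    v = proj₁ inv
    m = v * Σ[ xs ] f
    0≤m : 0ℚ ≤ m
    0≤m = 0≤* (<⇒≤ (proj₁ (proj₂ inv))) (Σ-nonNeg xs 0≤f)
    Σ≡ : Σ[ xs ] f ≡ N * m
    Σ≡ = begin
      Σ[ xs ] f              ≡⟨ *-identityˡ _ ⟨
      1ℚ * Σ[ xs ] f         ≡⟨ cong (_* Σ[ xs ] f) (proj₂ (proj₂ inv)) ⟨
      N * v * Σ[ xs ] f      ≡⟨ *-assoc N v _ ⟩
      N * m                  ∎
      where open ≡-Reasoning
    fx≡ : ι (suc (length xs)) * c - N * m ≡ f x
    fx≡ = begin
      ι (suc (length xs)) * c - N * m  ≡⟨ cong₂ _-_ h Σ≡ ⟨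
      f x + Σ[ xs ] f - Σ[ xs ] f        ≡⟨ eq (f x) (Σ[ xs ] f) ⟩
      f x                                ∎
      where
      open ≡-Reasoning
      eq : ∀ a b → a + b - b ≡ a
      eq = solve-∀ ℚ-ring

  -- Transcripts and the change of measure

  cntLe≤sum : ∀ {n} (S : Multiset n) y → cntLe S y ℕ.≤ Vec.sum S
  cntLe≤sum (x ∷ S) zero    = ℕ.m≤m+n x _
  cntLe≤sum (x ∷ S) (suc y) = ℕ.+-monoʳ-≤ x (cntLe≤sum S y)

  module Querying (k : ℕ) .{{_ : NonZero k}} where

    opaque

      prob : ∀ {n} → Multiset n → Fin n → ℚ
      prob S y = (ℤ.+ cntLe S y) / k

      prob-ι : ∀ {n} (S : Multiset n) y → prob S y * ι k ≡ ι (cntLe S y)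
      prob-ι S y = /-* (cntLe S y) k

    -- Truth and output are separate arguments, unlike in `succProb`: the lower bound needs the
    -- probability that an alternative is mistaken for the truth.
    hit : ∀ {n q} → Multiset n → Multiset n → Tree n q → ℚ
    hit S m (leaf m′) with Vec.≡-dec ℕ._≟_ m′ m
    ... | yes _ = 1ℚ
    ... | no  _ = 0ℚ
    hit S m (node y l r) = prob S y * hit S m l + (1ℚ - prob S y) * hit S m r

    opaque
      unfolding prob

      succProb≡hit : ∀ {n q} (S : Multiset n) (T : Tree n q) → succProb k S T ≡ hit S S T
      succProb≡hit S (leaf m) with Vec.≡-dec ℕ._≟_ m S
      ... | yes _ = refl
      ... | no  _ = refl
      succProb≡hit S (node y l r) =
        cong₂ (λ a b → prob S y * a + (1ℚ - prob S y) * b) (succProb≡hit S l) (succProb≡hit S r)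

    prob-cong : ∀ {n} {S S′ : Multiset n} {y} → cntLe S y ≡ cntLe S′ y → prob S y ≡ prob S′ y
    prob-cong {S = S} {S′} {y} h = ≤-antisym (le (≤-reflexive e)) (le (≤-reflexive (sym e)))
      where
      e : prob S y * ι k ≡ prob S′ y * ι k
      e = trans (prob-ι S y) (trans (cong ι h) (sym (prob-ι S′ y)))
      le : ∀ {a b} → a * ι k ≤ b * ι k → a ≤ b
      le = *-cancelʳ-≤-pos (ι k) {{positive (0<ι k)}}

    module _ {n} (S : Multiset n) (ΣS : Vec.sum S ≡ k) where

      0≤prob : ∀ y → 0ℚ ≤ prob S y
      0≤prob y = *-cancelʳ-≤-pos (ι k) {{positive (0<ι k)}}
        (subst₂ _≤_ (sym (*-zeroˡ (ι k))) (sym (prob-ι S y)) (0≤ι _))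

      prob≤1 : ∀ y → prob S y ≤ 1ℚ
      prob≤1 y = *-cancelʳ-≤-pos (ι k) {{positive (0<ι k)}}
        (subst₂ _≤_ (sym (prob-ι S y)) (sym (*-identityˡ (ι k)))
          (ι-mono (subst (cntLe S y ℕ.≤_) ΣS (cntLe≤sum S y))))

      0≤1-prob : ∀ y → 0ℚ ≤ 1ℚ - prob S y
      0≤1-prob y = 0≤-diff (prob≤1 y)

      0≤hit : ∀ {q} m (T : Tree n q) → 0ℚ ≤ hit S m T
      0≤hit m (leaf m′) with Vec.≡-dec ℕ._≟_ m′ m
      ... | yes _ = nonNegative⁻¹ 1ℚ
      ... | no  _ = ≤-refl
      0≤hit m (node y l r) = 0≤+ (0≤* (0≤prob y) (0≤hit m l)) (0≤* (0≤1-prob y) (0≤hit m r))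

    -- p and (ps a) are the probabilities of the same answer under the base
    -- hypothesis and under the alternatives.  U and V bound the geometric means of
    -- p / ps a and (1 - p) / (1 - ps a); products instead of quotients admit ps a = 1.
    record Separation {I : Set} (alts : List I) (B p : ℚ) (ps : I → ℚ) : Set where
      field
        U V   : ℚ
        0<U   : 0ℚ < U
        0<V   : 0ℚ < V
        gm-U  : p ^ length alts ≤ U ^ length alts * Π[ alts ] ps
        gm-V  : (1ℚ - p) ^ length alts ≤ V ^ length alts * Π[ alts ] (λ a → 1ℚ - ps a)
        mean≤ : p * U + (1ℚ - p) * V ≤ B

    -- The vectors have the entries √(pU), √((1-p)V) and l √(p/U), r √((1-p)/V). Their squared
    -- lengths are at most B and the bracket on the right.
    cauchy-schwarz : ∀ {p U V u v B} l r → 0ℚ ≤ p → 0ℚ ≤ 1ℚ - p → 0ℚ < U → 0ℚ < V → 0ℚ < u → 0ℚ < v →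
      U * u ≡ 1ℚ → V * v ≡ 1ℚ →
      p * U + (1ℚ - p) * V ≤ B → (p * l + (1ℚ - p) * r) * (p * l + (1ℚ - p) * r) ≤
      B * (l * l * (p * u) + r * r * ((1ℚ - p) * v))
    cauchy-schwarz {p} {U} {V} {u} {v} {B} l r 0≤p 0≤p′ 0<U 0<V 0<u 0<v Uu Vv W≤B = begin
      (p * l + (1ℚ - p) * r) * (p * l + (1ℚ - p) * r)
        ≡⟨ cong₂ (λ x y → (p * x + (1ℚ - p) * y) * (p * x + (1ℚ - p) * y)) l≡ r≡ ⟩
      (p * (U * l′) + (1ℚ - p) * (V * r′)) * (p * (U * l′) + (1ℚ - p) * (V * r′))
        ≤⟨ ≤-by _ (0≤* (0≤* (0≤* 0≤p (<⇒≤ 0<U)) (0≤* 0≤p′ (<⇒≤ 0<V))) (0≤sq (l′ - r′))) (eq p U V l′ r′) ⟩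
      (p * U + (1ℚ - p) * V) * (U * l′ * l′ * p + V * r′ * r′ * (1ℚ - p))
        ≡⟨ cong₂ (λ x y → (p * U + (1ℚ - p) * V) * (x * l′ * p + y * r′ * (1ℚ - p))) (sym l≡) (sym r≡) ⟩
      (p * U + (1ℚ - p) * V) * (l * l′ * p + r * r′ * (1ℚ - p))
        ≡⟨ cong ((p * U + (1ℚ - p) * V) *_) (eq₂ p l r u v) ⟩
      (p * U + (1ℚ - p) * V) * (l * l * (p * u) + r * r * ((1ℚ - p) * v))
        ≤⟨ *-monoˡ (0≤+ (0≤* (0≤sq l) (0≤* 0≤p (<⇒≤ 0<u))) (0≤* (0≤sq r) (0≤* 0≤p′ (<⇒≤ 0<v)))) W≤B ⟩
      B * (l * l * (p * u) + r * r * ((1ℚ - p) * v)) ∎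
      where
      open ≤-Reasoning
      l′ = u * l
      r′ = v * r
      l≡ : l ≡ U * l′
      l≡ = sym (trans (sym (*-assoc U u l)) (trans (cong (_* l) Uu) (*-identityˡ l)))
      r≡ : r ≡ V * r′
      r≡ = sym (trans (sym (*-assoc V v r)) (trans (cong (_* r) Vv) (*-identityˡ r)))
      eq : ∀ p U V l r → (p * U + (1ℚ - p) * V) * (U * l * l * p + V * r * r * (1ℚ - p)) ≡
           (p * (U * l) + (1ℚ - p) * (V * r)) * (p * (U * l) + (1ℚ - p) * (V * r)) +
           p * U * ((1ℚ - p) * V) * ((l - r) * (l - r))
      eq = solve-∀ ℚ-ring
      eq₂ : ∀ p l r u v → l * (u * l) * p + r * (v * r) * (1ℚ - p) ≡ l * l * (p * u) + r * r * ((1ℚ - p) * v)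
      eq₂ = solve-∀ ℚ-ring

    -- The geometric mean of the likelihood ratios along a transcript is multiplicative
    -- and below their arithmetic mean; g stands for it, up to its (length alts)-th power.
    module ChangeOfMeasure {n} {I : Set} (alts : List I) .{{_ : NonZero (length alts)}} (H : I → Multiset n)
      (S : Multiset n) (ΣS : Vec.sum S ≡ k) (ΣH : ∀ a → Vec.sum (H a) ≡ k) {B} (1≤B : 1ℚ ≤ B)
      (sep : ∀ y → Separation alts B (prob S y) (λ a → prob (H a) y)) where

      private
        A = length alts
        0≤B : 0ℚ ≤ B
        0≤B = ≤-trans (nonNegative⁻¹ 1ℚ) 1≤B

      gm≤am : ∀ {x g} → (∀ a → 0ℚ ≤ x a) → g ^ A ≤ Π[ alts ] x → g * ι A ≤ Σ[ alts ] x
      gm≤am {x} {g} 0≤x h = subst (g * ι A ≤_) (trans (*-comm m (ι A)) (sym Σ≡))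
        (*-monoˡ (0≤ι A) (^-cancel-≤ A 0≤m (≤-trans h (am-gm alts x 0≤x 0≤m Σ≡))))
        where
        v = proj₁ (inverse (0<ι A))
        m = v * Σ[ alts ] x
        0≤m : 0ℚ ≤ m
        0≤m = 0≤* (<⇒≤ (proj₁ (proj₂ (inverse (0<ι A))))) (Σ-nonNeg alts 0≤x)
        Σ≡ : Σ[ alts ] x ≡ ι A * m
        Σ≡ = trans (sym (*-identityˡ _))
          (trans (cong (_* Σ[ alts ] x) (sym (proj₂ (proj₂ (inverse (0<ι A)))))) (*-assoc (ι A) v _))

      -- Here `x a` is the likelihood of the answers so far under `H a`, and g is a lower bound for
      -- the geometric mean of these numbers. Both are generalised so that the induction can enter a
      -- subtree, where x is multiplied by the answer probabilities and g by p/U or (1-p)/V. Each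
      -- node costs one factor B by `cauchy-schwarz`; a leaf with output S is AM-GM.
      change : ∀ {q} (T : Tree n q) {x g} → (∀ a → 0ℚ ≤ x a) → 0ℚ ≤ g → g ^ A ≤ Π[ alts ] x →
               hit S S T * hit S S T * (g * ι A) ≤ B ^ q * Σ[ alts ] (λ a → x a * hit (H a) S T)
      change {q} (leaf m) {x} {g} 0≤x 0≤g h with Vec.≡-dec ℕ._≟_ m S
      ... | yes _ = begin
        1ℚ * 1ℚ * (g * ι A)                ≡⟨ *-identityˡ _ ⟩
        g * ι A                            ≤⟨ gm≤am 0≤x h ⟩
        Σ[ alts ] x                        ≡⟨ *-identityˡ _ ⟨
        1ℚ * Σ[ alts ] x                   ≤⟨ *-monoˡ (Σ-nonNeg alts 0≤x) (1≤^ q 1≤B) ⟩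
        B ^ q * Σ[ alts ] x                ≡⟨ cong (B ^ q *_) (Σ-cong alts (λ a → sym (*-identityʳ (x a)))) ⟩
        B ^ q * Σ[ alts ] (λ a → x a * 1ℚ) ∎
        where open ≤-Reasoning
      ... | no _ = begin
        0ℚ * 0ℚ * (g * ι A)                ≡⟨ *-zeroˡ (g * ι A) ⟩
        0ℚ                                 ≤⟨ 0≤* (^-nonNeg q 0≤B) (Σ-nonNeg alts (λ a → 0≤* (0≤x a) ≤-refl)) ⟩
        B ^ q * Σ[ alts ] (λ a → x a * 0ℚ) ∎
        where open ≤-Reasoning
      change {suc q} (node y L R) {x} {g} 0≤x 0≤g h = begin
        s * s * (g * ι A)
          ≤⟨ *-monoˡ (0≤* 0≤g (0≤ι A)) (cauchy-schwarz l r 0≤p 0≤p′ 0<U 0<V 0<u 0<v Uu Vv mean≤) ⟩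
        B * (l * l * (p * u) + r * r * ((1ℚ - p) * v)) * (g * ι A)
          ≡⟨ eq₁ B l r p u v g (ι A) ⟩
        B * (l * l * (g * (p * u) * ι A) + r * r * (g * ((1ℚ - p) * v) * ι A))
          ≤⟨ *-monoʳ 0≤B (+-mono-≤
               (change L (λ a → 0≤* (0≤x a) (0≤prob (H a) (ΣH a) y)) (0≤* 0≤g (0≤* 0≤p (<⇒≤ 0<u)))
                 (gm-step 0≤p (<⇒≤ 0<u) Uu (λ a → 0≤prob (H a) (ΣH a) y) gm-U))
               (change R (λ a → 0≤* (0≤x a) (0≤1-prob (H a) (ΣH a) y)) (0≤* 0≤g (0≤* 0≤p′ (<⇒≤ 0<v)))
                 (gm-step 0≤p′ (<⇒≤ 0<v) Vv (λ a → 0≤1-prob (H a) (ΣH a) y) gm-V))) ⟩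
        B * (B ^ q * Σ[ alts ] (λ a → x a * ps a * hit (H a) S L) + B ^ q * Σ[ alts ] (λ a → x a * (1ℚ - ps a) * hit (H a) S R))
          ≡⟨ eq₂ B (B ^ q) _ _ ⟩
        B * B ^ q * (Σ[ alts ] (λ a → x a * ps a * hit (H a) S L) + Σ[ alts ] (λ a → x a * (1ℚ - ps a) * hit (H a) S R))
          ≡⟨ cong (B * B ^ q *_) (sym (Σ-+ alts _ _)) ⟩
        B * B ^ q * Σ[ alts ] (λ a → x a * ps a * hit (H a) S L + x a * (1ℚ - ps a) * hit (H a) S R)
          ≡⟨ cong (B * B ^ q *_) (Σ-cong alts (λ a → eq₃ (x a) (ps a) _ _)) ⟩
        B * B ^ q * Σ[ alts ] (λ a → x a * hit (H a) S (node y L R)) ∎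
        where
        open ≤-Reasoning
        open Separation (sep y)
        p = prob S y
        ps = λ a → prob (H a) y
        l = hit S S L
        r = hit S S R
        s = hit S S (node y L R)
        0≤p = 0≤prob S ΣS y
        0≤p′ = 0≤1-prob S ΣS y
        u = proj₁ (inverse 0<U)
        v = proj₁ (inverse 0<V)
        0<u = proj₁ (proj₂ (inverse 0<U))
        0<v = proj₁ (proj₂ (inverse 0<V))
        Uu = proj₂ (proj₂ (inverse 0<U))
        Vv = proj₂ (proj₂ (inverse 0<V))
        gm-step : ∀ {p u U ps} → 0ℚ ≤ p → 0ℚ ≤ u → U * u ≡ 1ℚ → (∀ a → 0ℚ ≤ ps a) →
                  p ^ A ≤ U ^ A * Π[ alts ] ps → (g * (p * u)) ^ A ≤ Π[ alts ] (λ a → x a * ps a)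
        gm-step {p} {u} {U} {ps} 0≤p 0≤u Uu 0≤ps gm = begin
          (g * (p * u)) ^ A                       ≡⟨ ^-distrib-* g (p * u) A ⟩
          g ^ A * (p * u) ^ A                     ≡⟨ cong (g ^ A *_) (^-distrib-* p u A) ⟩
          g ^ A * (p ^ A * u ^ A)                 ≤⟨ *-mono (Π-nonNeg alts 0≤x) (0≤* (^-nonNeg A 0≤p) (^-nonNeg A 0≤u)) h
                                                       (*-monoˡ (^-nonNeg A 0≤u) gm) ⟩
          Π[ alts ] x * (U ^ A * Π[ alts ] ps * u ^ A) ≡⟨ cong (Π[ alts ] x *_) (eq (U ^ A) (Π[ alts ] ps) (u ^ A)) ⟩
          Π[ alts ] x * (U ^ A * u ^ A * Π[ alts ] ps) ≡⟨ cong (λ z → Π[ alts ] x * (z * Π[ alts ] ps))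
                                                         (trans (sym (^-distrib-* U u A)) (trans (cong (_^ A) Uu) (1^ A))) ⟩
          Π[ alts ] x * (1ℚ * Π[ alts ] ps)       ≡⟨ cong (Π[ alts ] x *_) (*-identityˡ _) ⟩
          Π[ alts ] x * Π[ alts ] ps              ≡⟨ Π-* alts x ps ⟨
          Π[ alts ] (λ a → x a * ps a)            ∎
          where
          eq : ∀ a b c → a * b * c ≡ a * c * b
          eq = solve-∀ ℚ-ring
        eq₁ : ∀ B l r p u v g A → B * (l * l * (p * u) + r * r * ((1ℚ - p) * v)) * (g * A) ≡
              B * (l * l * (g * (p * u) * A) + r * r * (g * ((1ℚ - p) * v) * A))
        eq₁ = solve-∀ ℚ-ring
        eq₂ : ∀ B C a b → B * (C * a + C * b) ≡ B * C * (a + b)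
        eq₂ = solve-∀ ℚ-ring
        eq₃ : ∀ x p l r → x * p * l + x * (1ℚ - p) * r ≡ x * (p * l + (1ℚ - p) * r)
        eq₃ = solve-∀ ℚ-ring

      -- At the root every likelihood is 1. The bound forces the alternatives together to output S
      -- with probability at least s² A / B^q, where s is the success probability under S.
      hit²≤ : ∀ {q} (T : Tree n q) → hit S S T * hit S S T * ι A ≤ B ^ q * Σ[ alts ] (λ a → hit (H a) S T)
      hit²≤ {q} T = subst₂ _≤_ (cong (hit S S T * hit S S T *_) (*-identityˡ (ι A)))
        (cong (B ^ q *_) (Σ-cong alts (λ a → *-identityˡ _)))
        (change T {x = λ _ → 1ℚ} {g = 1ℚ} (λ _ → nonNegative⁻¹ 1ℚ) (nonNegative⁻¹ 1ℚ)
          (≤-reflexive (sym (Π-const alts 1ℚ))))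

    module _ {I : Set} (alts : List I) .{{_ : NonZero (length alts)}} where

      private A = length alts

      -- U and V are taken to be the arithmetic means of p / `ps a` and (1-p) / (1 - `ps a`), which
      -- dominate the geometric ones. Then pU + (1-p)V is the average of p² / `ps a` + (1-p)² / (1 -
      -- `ps a`), that is, 1 plus the average χ²-divergence.
      mean-separation : ∀ {B p} {ps w w′ : I → ℚ} → 0ℚ < p → 0ℚ < 1ℚ - p → (∀ a → 0ℚ ≤ ps a) → (∀ a → 0ℚ ≤ 1ℚ - ps a) →
        (∀ a → 0ℚ < w a) → (∀ a → 0ℚ < w′ a) →
        (∀ a → ps a * w a ≡ 1ℚ) → (∀ a → (1ℚ - ps a) * w′ a ≡ 1ℚ) →
        Σ[ alts ] (λ a → p * p * w a + (1ℚ - p) * (1ℚ - p) * w′ a) ≤ ι A * B →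
        Separation alts B p ps
      mean-separation {B} {p} {ps} {w} {w′} 0<p 0<p′ 0≤ps 0≤ps′ 0<w 0<w′ psw psw′ Σ≤ = record
        { U = mean p w ; V = mean (1ℚ - p) w′
        ; 0<U = 0<mean 0<p 0<w ; 0<V = 0<mean 0<p′ 0<w′
        ; gm-U = gm 0<p 0<w 0≤ps psw
        ; gm-V = gm 0<p′ 0<w′ 0≤ps′ psw′
        ; mean≤ = *-cancelˡ-≤ (0<ι A) (subst (_≤ ι A * B) sum≡ Σ≤)
        }
        where
        v = proj₁ (inverse (0<ι A))
        0<v = proj₁ (proj₂ (inverse (0<ι A)))
        Av = proj₂ (proj₂ (inverse (0<ι A)))
        mean : ℚ → (I → ℚ) → ℚ
        mean p w = v * Σ[ alts ] (λ a → p * w a)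
        A-mean : ∀ p w → ι A * mean p w ≡ Σ[ alts ] (λ a → p * w a)
        A-mean p w = trans (sym (*-assoc (ι A) v _)) (trans (cong (_* Σ[ alts ] (λ a → p * w a)) Av) (*-identityˡ _))
        Σ-pos : ∀ (xs : List I) .{{_ : NonZero (length xs)}} {f} → (∀ a → 0ℚ < f a) → 0ℚ < Σ[ xs ] f
        Σ-pos (x ∷ xs) {f} h = subst (_< f x + Σ[ xs ] f) (+-identityʳ 0ℚ) (+-mono-<-≤ (h x) (Σ-nonNeg xs (λ a → <⇒≤ (h a))))
        0<mean : ∀ {p w} → 0ℚ < p → (∀ a → 0ℚ < w a) → 0ℚ < mean p w
        0<mean 0<p 0<w = 0<* 0<v (Σ-pos alts (λ a → 0<* 0<p (0<w a)))
        gm : ∀ {p ps w} → 0ℚ < p → (∀ a → 0ℚ < w a) → (∀ a → 0ℚ ≤ ps a) → (∀ a → ps a * w a ≡ 1ℚ) →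
             p ^ A ≤ mean p w ^ A * Π[ alts ] ps
        gm {p} {ps} {w} 0<p 0<w 0≤ps psw = begin
          p ^ A                                          ≡⟨ Π-const alts p ⟨
          Π[ alts ] (λ _ → p)                            ≡⟨ Π-cong alts (λ a → trans (sym (*-identityʳ p)) (trans (cong (p *_) (sym (psw a))) (eq p (ps a) (w a)))) ⟩
          Π[ alts ] (λ a → p * w a * ps a)               ≡⟨ Π-* alts _ ps ⟩
          Π[ alts ] (λ a → p * w a) * Π[ alts ] ps       ≤⟨ *-monoˡ (Π-nonNeg alts 0≤ps)
                                                              (am-gm alts _ (λ a → <⇒≤ (0<* 0<p (0<w a))) (<⇒≤ (0<mean 0<p 0<w)) (sym (A-mean p w))) ⟩
          mean p w ^ A * Π[ alts ] ps                    ∎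
          where
          open ≤-Reasoning
          eq : ∀ p q w → p * (q * w) ≡ p * w * q
          eq = solve-∀ ℚ-ring
          Π-cong : ∀ (xs : List I) {f g} → (∀ x → f x ≡ g x) → Π[ xs ] f ≡ Π[ xs ] g
          Π-cong []       h = refl
          Π-cong (x ∷ xs) h = cong₂ _*_ (h x) (Π-cong xs h)
        sum≡ : Σ[ alts ] (λ a → p * p * w a + (1ℚ - p) * (1ℚ - p) * w′ a) ≡ ι A * (p * mean p w + (1ℚ - p) * mean (1ℚ - p) w′)
        sum≡ = begin
          Σ[ alts ] (λ a → p * p * w a + (1ℚ - p) * (1ℚ - p) * w′ a)
            ≡⟨ Σ-cong alts (λ a → cong₂ _+_ (*-assoc p p (w a)) (*-assoc (1ℚ - p) (1ℚ - p) (w′ a))) ⟩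
          Σ[ alts ] (λ a → p * (p * w a) + (1ℚ - p) * ((1ℚ - p) * w′ a))
            ≡⟨ Σ-+ alts _ _ ⟩
          Σ[ alts ] (λ a → p * (p * w a)) + Σ[ alts ] (λ a → (1ℚ - p) * ((1ℚ - p) * w′ a))
            ≡⟨ cong₂ _+_ (Σ-*ˡ alts p _) (Σ-*ˡ alts (1ℚ - p) _) ⟩
          p * Σ[ alts ] (λ a → p * w a) + (1ℚ - p) * Σ[ alts ] (λ a → (1ℚ - p) * w′ a)
            ≡⟨ cong₂ (λ x y → p * x + (1ℚ - p) * y) (sym (A-mean p w)) (sym (A-mean (1ℚ - p) w′)) ⟩
          p * (ι A * mean p w) + (1ℚ - p) * (ι A * mean (1ℚ - p) w′)
            ≡⟨ eq p (ι A) _ _ ⟩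
          ι A * (p * mean p w + (1ℚ - p) * mean (1ℚ - p) w′) ∎
          where
          open ≡-Reasoning
          eq : ∀ p A x y → p * (A * x) + (1ℚ - p) * (A * y) ≡ A * (p * x + (1ℚ - p) * y)
          eq = solve-∀ ℚ-ring

      trivial-separation : ∀ {B p} {ps : I → ℚ} → 1ℚ ≤ B → (∀ a → ps a ≡ p) → Separation alts B p ps
      trivial-separation {B} {p} {ps} 1≤B h = record
        { U = 1ℚ ; V = 1ℚ ; 0<U = positive⁻¹ 1ℚ ; 0<V = positive⁻¹ 1ℚ
        ; gm-U = gm h
        ; gm-V = gm (λ a → cong (λ z → 1ℚ - z) (h a))
        ; mean≤ = subst (_≤ B) (eq p) 1≤B
        }
        where
        eq : ∀ p → 1ℚ ≡ p * 1ℚ + (1ℚ - p) * 1ℚ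
        eq = solve-∀ ℚ-ring
        gm : ∀ {p ps} → (∀ a → ps a ≡ p) → p ^ A ≤ 1ℚ ^ A * Π[ alts ] ps
        gm {p} {ps} h = ≤-reflexive (sym (trans (cong₂ _*_ (1^ A) (Π-≡ alts)) (*-identityˡ _)))
          where
          Π-≡ : ∀ (xs : List I) → Π[ xs ] ps ≡ p ^ length xs
          Π-≡ []       = refl
          Π-≡ (x ∷ xs) = cong₂ _*_ (h x) (Π-≡ xs)

  -- The hypotheses of the lower bound

  opaque

    fins : ∀ n → List (Fin n)
    fins = List.allFin

    length-fins : ∀ n → length (fins n) ≡ n
    length-fins n = List.length-tabulate {n = n} (λ i → i)

    fins-unique : ∀ n → Unique (fins n)
    fins-unique n = Unique.allFin⁺ n

    Σ-fins0 : ∀ f → Σ[ fins 0 ] f ≡ 0ℚ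
    Σ-fins0 f = refl

    Σ-tabulate : ∀ {n} (g : Fin n → Fin (suc n)) f → Σ[ List.tabulate g ] f ≡ Σ[ fins n ] (λ i → f (g i))
    Σ-tabulate {n} g f =
      trans (cong (λ xs → Σ[ xs ] f) (sym (List.map-tabulate {n = n} (λ i → i) g))) (Σ-map g (fins n) f)

    Σ-punchIn : ∀ {n} (m : Fin (suc n)) f → Σ[ fins (suc n) ] f ≡ f m + Σ[ fins n ] (λ i → f (punchIn m i))
    Σ-punchIn zero f = cong (λ z → f zero + z) (Σ-tabulate suc f)
    Σ-punchIn {suc n} (suc m) f = begin
      f zero + Σ[ List.tabulate suc ] f
        ≡⟨ cong (λ z → f zero + z) (Σ-tabulate suc f) ⟩
      f zero + Σ[ fins (suc n) ] (λ i → f (suc i))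
        ≡⟨ cong (λ z → f zero + z) (Σ-punchIn m (λ i → f (suc i))) ⟩
      f zero + (f (suc m) + Σ[ fins n ] (λ i → f (suc (punchIn m i))))
        ≡⟨ eq (f zero) (f (suc m)) _ ⟩
      f (suc m) + (f zero + Σ[ fins n ] (λ i → f (suc (punchIn m i))))
        ≡⟨ cong (λ z → f (suc m) + (f zero + z)) (Σ-tabulate suc (λ i → f (punchIn (suc m) i))) ⟨
      f (suc m) + Σ[ fins (suc n) ] (λ i → f (punchIn (suc m) i)) ∎
      where
      open ≡-Reasoning
      eq : ∀ a b c → a + (b + c) ≡ b + (a + c)
      eq = solve-∀ ℚ-ring

  Σ-unique : ∀ {A : Set} {xs : List A} (h : A → ℚ) → Unique xs → (∀ x → h x ≤ 1ℚ) →
             (∀ x y → h x ≡ 0ℚ ⊎ h y ≡ 0ℚ ⊎ x ≡ y) → Σ[ xs ] h ≤ 1ℚ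
  Σ-unique h [] _ _ = nonNegative⁻¹ 1ℚ
  Σ-unique {xs = x ∷ xs} h (x∉xs ∷ u) h≤1 disj with h x ≟ 0ℚ
  ... | yes hx≡0 = subst (_≤ 1ℚ) (trans (sym (+-identityˡ _)) (cong (_+ Σ[ xs ] h) (sym hx≡0))) (Σ-unique h u h≤1 disj)
  ... | no  hx≢0 = subst (_≤ 1ℚ) (trans (sym (+-identityʳ (h x))) (cong (h x +_) (sym (zeros x∉xs)))) (h≤1 x)
    where
    zeros : ∀ {ys} → All (x ≢_) ys → Σ[ ys ] h ≡ 0ℚ
    zeros [] = refl
    zeros {y ∷ _} (x≢y ∷ ps) with disj x y
    ... | inj₁ e        = contradiction e hx≢0
    ... | inj₂ (inj₁ e) = trans (cong₂ _+_ e (zeros ps)) (+-identityˡ 0ℚ)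
    ... | inj₂ (inj₂ e) = contradiction e x≢y

  Σ-cartesianProductWith : ∀ {A B C : Set} (g : A → B → C) xs ys f →
    Σ[ cartesianProductWith g xs ys ] f ≡ Σ[ xs ] (λ x → Σ[ ys ] (λ y → f (g x y)))
  Σ-cartesianProductWith g []       ys f = refl
  Σ-cartesianProductWith g (x ∷ xs) ys f =
    trans (Σ-++ (List.map (g x) ys) _ f) (cong₂ _+_ (Σ-map (g x) ys f) (Σ-cartesianProductWith g xs ys f))

  length-cartesianProductWith : ∀ {A B C : Set} (g : A → B → C) xs ys →
    length (cartesianProductWith g xs ys) ≡ length xs ℕ.* length ys
  length-cartesianProductWith g []       ys = refl
  length-cartesianProductWith g (x ∷ xs) ys = trans (List.length-++ (List.map (g x) ys))
    (cong₂ ℕ._+_ (List.length-map (g x) ys) (length-cartesianProductWith g xs ys))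

  cntLe-++ˡ : ∀ {m n} (xs : Multiset m) (ys : Multiset n) i → cntLe (xs ++ ys) (i ↑ˡ n) ≡ cntLe xs i
  cntLe-++ˡ (x ∷ xs) ys zero    = refl
  cntLe-++ˡ (x ∷ xs) ys (suc i) = cong (x ℕ.+_) (cntLe-++ˡ xs ys i)

  cntLe-++ʳ : ∀ {m n} (xs : Multiset m) (ys : Multiset n) i → cntLe (xs ++ ys) (m ↑ʳ i) ≡ Vec.sum xs ℕ.+ cntLe ys i
  cntLe-++ʳ []       ys i = refl
  cntLe-++ʳ (x ∷ xs) ys i = trans (cong (x ℕ.+_) (cntLe-++ʳ xs ys i)) (sym (ℕ.+-assoc x _ _))

  data Split {m n} : Fin (m ℕ.+ n) → Set where
    left  : ∀ i → Split (i ↑ˡ n)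
    right : ∀ j → Split (m ↑ʳ j)

  split : ∀ m {n} (i : Fin (m ℕ.+ n)) → Split {m} {n} i
  split zero    j       = right j
  split (suc m) zero    = left zero
  split (suc m) (suc i) with split m i
  ... | left j  = left (suc j)
  ... | right j = right j

  oneHot : ∀ {n} → Fin n → Multiset n
  oneHot {suc n} zero    = 1 ∷ Vec.replicate n 0
  oneHot         (suc i) = 0 ∷ oneHot i

  sum-zeros : ∀ n → Vec.sum (Vec.replicate n 0) ≡ 0
  sum-zeros zero    = refl
  sum-zeros (suc n) = sum-zeros n

  sum-oneHot : ∀ {n} (i : Fin n) → Vec.sum (oneHot i) ≡ 1
  sum-oneHot {suc n} zero    = cong suc (sum-zeros n)
  sum-oneHot         (suc i) = sum-oneHot i

  oneHot-injective : ∀ {n} (i j : Fin n) → oneHot i ≡ oneHot j → i ≡ j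
  oneHot-injective zero    zero    _ = refl
  oneHot-injective (suc i) (suc j) h = cong suc (oneHot-injective i j (Vec.∷-injectiveʳ h))

  sqDist : ℕ → ℕ → ℚ
  sqDist c d = (ι c - ι d) * (ι c - ι d)

  sqDist-refl : ∀ c → sqDist c c ≡ 0ℚ
  sqDist-refl c = eq (ι c)
    where
    eq : ∀ x → (x - x) * (x - x) ≡ 0ℚ
    eq = solve-∀ ℚ-ring

  sqDist-+ : ∀ b c d → sqDist (b ℕ.+ c) (b ℕ.+ d) ≡ sqDist c d
  sqDist-+ b c d rewrite ι-+ b c | ι-+ b d = eq (ι b) (ι c) (ι d)
    where
    eq : ∀ b x y → (b + x - (b + y)) * (b + x - (b + y)) ≡ (x - y) * (x - y)
    eq = solve-∀ ℚ-ring

  sqDist≤1 : ∀ {c d} → c ℕ.≤ 1 → d ℕ.≤ 1 → sqDist c d ≤ 1ℚ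
  sqDist≤1 {0} {0} _ _ = subst (_≤ 1ℚ) (sym (sqDist-refl 0)) (nonNegative⁻¹ 1ℚ)
  sqDist≤1 {1} {1} _ _ = subst (_≤ 1ℚ) (sym (sqDist-refl 1)) (nonNegative⁻¹ 1ℚ)
  sqDist≤1 {0} {1} _ _ rewrite ι0 | ι1 = ≤-refl
  sqDist≤1 {1} {0} _ _ rewrite ι0 | ι1 = ≤-refl
  sqDist≤1 {suc (suc c)} (ℕ.s≤s ()) _
  sqDist≤1 {0} {suc (suc d)} _ (ℕ.s≤s ())
  sqDist≤1 {1} {suc (suc d)} _ (ℕ.s≤s ())

  -- A hypothesis puts one element into each of K consecutive blocks of M = suc M′ positions.
  module Hypotheses (M′ : ℕ) {s : ℕ} (tail : Multiset s) where

    M : ℕ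
    M = suc M′

    size : ℕ → ℕ
    size zero    = s
    size (suc K) = M ℕ.+ size K

    size≡ : ∀ K → size K ≡ K ℕ.* M ℕ.+ s
    size≡ zero    = refl
    size≡ (suc K) = trans (cong (M ℕ.+_) (size≡ K)) (sym (ℕ.+-assoc M (K ℕ.* M) s))

    blocks : ∀ {K} → Vec (Fin M) K → Multiset (size K)
    blocks []      = tail
    blocks (m ∷ v) = oneHot m ++ blocks v

    sum-blocks : ∀ {K} (v : Vec (Fin M) K) → Vec.sum (blocks v) ≡ K ℕ.+ Vec.sum tail
    sum-blocks []      = refl
    sum-blocks (m ∷ v) = trans (Vec.sum-++ (oneHot m)) (cong₂ ℕ._+_ (sum-oneHot m) (sum-blocks v))

    blocks-injective : ∀ {K} (u v : Vec (Fin M) K) → blocks u ≡ blocks v → u ≡ v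
    blocks-injective []      []      _ = refl
    blocks-injective (i ∷ u) (j ∷ v) h = cong₂ _∷_
      (oneHot-injective i j (Vec.++-injectiveˡ (oneHot i) (oneHot j) h))
      (blocks-injective u v (Vec.++-injectiveʳ (oneHot i) (oneHot j) h))

    cntLe-left : ∀ {K} m (v : Vec (Fin M) K) i → cntLe (blocks (m ∷ v)) (i ↑ˡ size K) ℕ.≤ 1
    cntLe-left m v i = subst₂ ℕ._≤_ (sym (cntLe-++ˡ (oneHot m) (blocks v) i)) (sum-oneHot m) (cntLe≤sum (oneHot m) i)

    cntLe-right : ∀ {K} m (v : Vec (Fin M) K) j → cntLe (blocks (m ∷ v)) (M ↑ʳ j) ≡ suc (cntLe (blocks v) j)
    cntLe-right m v j = trans (cntLe-++ʳ (oneHot m) (blocks v) j) (cong (ℕ._+ cntLe (blocks v) j) (sum-oneHot m))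

    -- A query in the tail separates no two hypotheses. A query in a block counts nothing of the
    -- tail, so the elements fixed at the right keep the probability of X > Y large.
    block-or-tail : ∀ K (y : Fin (size K)) →
      (∀ (v : Vec (Fin M) K) → cntLe (blocks v) y ℕ.≤ K) ⊎ (∀ (u v : Vec (Fin M) K) → cntLe (blocks u) y ≡ cntLe (blocks v) y)
    block-or-tail zero    y = inj₂ λ { [] [] → refl }
    block-or-tail (suc K) y with split M y
    ... | left i  = inj₁ λ { (m ∷ v) → ℕ.≤-trans (cntLe-left m v i) (ℕ.s≤s ℕ.z≤n) }
    ... | right j with block-or-tail K j
    ...   | inj₁ h = inj₁ λ { (m ∷ v) → subst (ℕ._≤ suc K) (sym (cntLe-right m v j)) (ℕ.s≤s (h v)) }
    ...   | inj₂ h = inj₂ λ { (l ∷ u) (m ∷ v) → trans (cntLe-right l u j) (trans (cong suc (h u v)) (sym (cntLe-right m v j))) }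

    all : ∀ K → List (Vec (Fin M) K)
    all zero    = [] ∷ []
    all (suc K) = cartesianProductWith _∷_ (fins M) (all K)

    neighbours : ∀ {K} → Vec (Fin M) K → List (Vec (Fin M) K)
    neighbours []      = []
    neighbours (m ∷ v) = List.map (λ i → punchIn m i ∷ v) (fins M′) List.++ List.map (m ∷_) (neighbours v)

    length-neighbours : ∀ {K} (v : Vec (Fin M) K) → length (neighbours v) ≡ K ℕ.* M′
    length-neighbours []      = refl
    length-neighbours (m ∷ v) = trans (List.length-++ (List.map (λ i → punchIn m i ∷ v) (fins M′))) (cong₂ ℕ._+_
      (trans (List.length-map _ (fins M′)) (length-fins M′))
      (trans (List.length-map (m ∷_) (neighbours v)) (length-neighbours v)))

    Σ-all : ∀ K f → Σ[ all (suc K) ] f ≡ Σ[ fins M ] (λ m → Σ[ all K ] (λ v → f (m ∷ v)))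
    Σ-all K f = Σ-cartesianProductWith _∷_ (fins M) (all K) f

    Σ-neighbours : ∀ {K} m (v : Vec (Fin M) K) f →
      Σ[ neighbours (m ∷ v) ] f ≡ Σ[ fins M′ ] (λ i → f (punchIn m i ∷ v)) + Σ[ neighbours v ] (λ u → f (m ∷ u))
    Σ-neighbours m v f = trans (Σ-++ (List.map (λ i → punchIn m i ∷ v) (fins M′)) _ f)
      (cong₂ _+_ (Σ-map (λ i → punchIn m i ∷ v) (fins M′) f) (Σ-map (m ∷_) (neighbours v) f))

    -- Adding the diagonal turns either side into a full double sum, where the order of summation is
    -- free.
    Σ-punchIn-swap : ∀ (f : Fin M → Fin M → ℚ) →
      Σ[ fins M ] (λ m → Σ[ fins M′ ] (λ i → f m (punchIn m i))) ≡
      Σ[ fins M ] (λ m → Σ[ fins M′ ] (λ i → f (punchIn m i) m))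
    Σ-punchIn-swap f = begin
      off                                        ≡⟨ cancel off (Σ[ fins M ] diag) ⟩
      off + Σ[ fins M ] diag - Σ[ fins M ] diag  ≡⟨ cong (_- Σ[ fins M ] diag) total ⟩
      off′ + Σ[ fins M ] diag - Σ[ fins M ] diag ≡⟨ cancel off′ (Σ[ fins M ] diag) ⟨
      off′                                       ∎
      where
      open ≡-Reasoning
      off off′ : ℚ
      off = Σ[ fins M ] (λ m → Σ[ fins M′ ] (λ i → f m (punchIn m i)))
      off′ = Σ[ fins M ] (λ m → Σ[ fins M′ ] (λ i → f (punchIn m i) m))
      diag : Fin M → ℚ
      diag m = f m m
      cancel : ∀ a b → a ≡ a + b - b
      cancel = solve-∀ ℚ-ring
      remove : ∀ (f : Fin M → Fin M → ℚ) → Σ[ fins M ] (λ m → Σ[ fins M′ ] (λ i → f m (punchIn m i))) + Σ[ fins M ] (λ m → f m m)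
               ≡ Σ[ fins M ] (λ m → Σ[ fins M ] (f m))
      remove f = trans (sym (Σ-+ (fins M) _ _)) (Σ-cong (fins M) (λ m → trans (+-comm _ (f m m)) (sym (Σ-punchIn m (f m)))))
      total : off + Σ[ fins M ] diag ≡ off′ + Σ[ fins M ] diag
      total = trans (remove f) (trans (Σ-swap (fins M) (fins M) f) (sym (remove (λ x y → f y x))))

    -- Being a neighbour is a symmetric relation. This exchanges "the alternatives of v output v"
    -- for "v outputs one of its alternatives" in the sum over all truths.
    Σ-neighbours-swap : ∀ K (g : Vec (Fin M) K → Vec (Fin M) K → ℚ) →
      Σ[ all K ] (λ v → Σ[ neighbours v ] (g v)) ≡ Σ[ all K ] (λ v → Σ[ neighbours v ] (λ u → g u v))
    Σ-neighbours-swap zero    g = refl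
    Σ-neighbours-swap (suc K) g = trans (expand g) (trans
      (cong₂ _+_
        (Σ-cong (all K) (λ v → Σ-punchIn-swap (λ l m → g (l ∷ v) (m ∷ v))))
        (Σ-cong (fins M) (λ m → Σ-neighbours-swap K (λ v u → g (m ∷ v) (m ∷ u)))))
      (sym (expand (λ u v → g v u))))
      where
      expand : ∀ g → Σ[ all (suc K) ] (λ v → Σ[ neighbours v ] (g v)) ≡
        Σ[ all K ] (λ v → Σ[ fins M ] (λ m → Σ[ fins M′ ] (λ i → g (m ∷ v) (punchIn m i ∷ v)))) +
        Σ[ fins M ] (λ m → Σ[ all K ] (λ v → Σ[ neighbours v ] (λ u → g (m ∷ v) (m ∷ u))))
      expand g = trans (Σ-all K _) (trans
        (Σ-cong (fins M) (λ m → trans (Σ-cong (all K) (λ v → Σ-neighbours m v (g (m ∷ v)))) (Σ-+ (all K) _ _)))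
        (trans (Σ-+ (fins M) _ _) (cong (_+ Σ[ fins M ] (λ m → Σ[ all K ] (λ v → Σ[ neighbours v ] (λ u → g (m ∷ v) (m ∷ u)))))
          (Σ-swap (fins M) (all K) _))))

    -- The neighbours of v are distinct from v and from each other, as each changes exactly one
    -- coordinate.
    Σ-neighbours≤Σ-all : ∀ {K} (v : Vec (Fin M) K) f → (∀ u → 0ℚ ≤ f u) → f v + Σ[ neighbours v ] f ≤ Σ[ all K ] f
    Σ-neighbours≤Σ-all []      f 0≤f = ≤-refl
    Σ-neighbours≤Σ-all {suc K} (m ∷ v) f 0≤f = begin
      f (m ∷ v) + Σ[ neighbours (m ∷ v) ] f
        ≡⟨ cong (λ z → f (m ∷ v) + z) (Σ-neighbours m v f) ⟩
      f (m ∷ v) + (Σ[ fins M′ ] (λ i → f (punchIn m i ∷ v)) + Σ[ neighbours v ] (λ u → f (m ∷ u)))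
        ≡⟨ eq (f (m ∷ v)) _ _ ⟩
      f (m ∷ v) + Σ[ neighbours v ] (λ u → f (m ∷ u)) + Σ[ fins M′ ] (λ i → f (punchIn m i ∷ v))
        ≤⟨ +-mono-≤ (Σ-neighbours≤Σ-all v (λ u → f (m ∷ u)) (λ u → 0≤f (m ∷ u)))
                    (Σ-mono (fins M′) (λ i → single v (λ u → f (punchIn m i ∷ u)) (λ u → 0≤f (punchIn m i ∷ u)))) ⟩
      Σ[ all K ] (λ u → f (m ∷ u)) + Σ[ fins M′ ] (λ i → Σ[ all K ] (λ u → f (punchIn m i ∷ u)))
        ≡⟨ Σ-punchIn m (λ m → Σ[ all K ] (λ u → f (m ∷ u))) ⟨
      Σ[ fins M ] (λ m → Σ[ all K ] (λ u → f (m ∷ u)))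
        ≡⟨ Σ-all K f ⟨
      Σ[ all (suc K) ] f ∎
      where
      open ≤-Reasoning
      eq : ∀ a b c → a + (b + c) ≡ a + c + b
      eq = solve-∀ ℚ-ring
      single : ∀ {K} (v : Vec (Fin M) K) f → (∀ u → 0ℚ ≤ f u) → f v ≤ Σ[ all K ] f
      single v f 0≤f = ≤-trans (≤-by _ (Σ-nonNeg (neighbours v) 0≤f) refl) (Σ-neighbours≤Σ-all v f 0≤f)

    -- Every block contains exactly one element, so a change in another block leaves the count at y
    -- as it is. Only the `M′` changes in the block of y matter, each by at most 1. There are
    -- `K * M′` neighbours in all, whence the factor 1/K in the average.
    Σ-neighbours-sqDist≤ : ∀ {K} (v : Vec (Fin M) K) y →
      Σ[ neighbours v ] (λ u → sqDist (cntLe (blocks v) y) (cntLe (blocks u) y)) ≤ ι M′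
    Σ-neighbours-sqDist≤ []      y = 0≤ι M′
    Σ-neighbours-sqDist≤ {suc K} (m ∷ v) y with split M y
    ... | left i  = begin
      Σ[ neighbours (m ∷ v) ] d
        ≡⟨ Σ-neighbours m v d ⟩
      Σ[ fins M′ ] (λ i → d (punchIn m i ∷ v)) + Σ[ neighbours v ] (λ u → d (m ∷ u))
        ≤⟨ +-mono-≤ (Σ-mono (fins M′) (λ j → sqDist≤1 (cntLe-left m v i) (cntLe-left (punchIn m j) v i)))
                    (≤-reflexive (Σ-cong (neighbours v) same)) ⟩
      Σ[ fins M′ ] (λ _ → 1ℚ) + Σ[ neighbours v ] (λ _ → 0ℚ)
        ≡⟨ cong₂ _+_ (Σ-const (fins M′) 1ℚ) (Σ-const (neighbours v) 0ℚ) ⟩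
      ι (length (fins M′)) * 1ℚ + ι (length (neighbours v)) * 0ℚ
        ≡⟨ eq (ι (length (fins M′))) (ι (length (neighbours v))) ⟩
      ι (length (fins M′))
        ≡⟨ cong ι (length-fins M′) ⟩
      ι M′ ∎
      where
      open ≤-Reasoning
      d : Vec (Fin M) (suc K) → ℚ
      d u = sqDist (cntLe (blocks (m ∷ v)) (i ↑ˡ size K)) (cntLe (blocks u) (i ↑ˡ size K))
      same : ∀ u → d (m ∷ u) ≡ 0ℚ
      same u = trans (cong₂ sqDist (cntLe-++ˡ (oneHot m) (blocks v) i) (cntLe-++ˡ (oneHot m) (blocks u) i)) (sqDist-refl _)
      eq : ∀ a b → a * 1ℚ + b * 0ℚ ≡ a
      eq = solve-∀ ℚ-ring
    ... | right j = begin
      Σ[ neighbours (m ∷ v) ] d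
        ≡⟨ Σ-neighbours m v d ⟩
      Σ[ fins M′ ] (λ i → d (punchIn m i ∷ v)) + Σ[ neighbours v ] (λ u → d (m ∷ u))
        ≡⟨ cong₂ _+_ (trans (Σ-cong (fins M′) same) (trans (Σ-const (fins M′) 0ℚ) (*-zeroʳ (ι (length (fins M′)))))) (Σ-cong (neighbours v) shift) ⟩
      0ℚ + Σ[ neighbours v ] (λ u → sqDist (cntLe (blocks v) j) (cntLe (blocks u) j))
        ≡⟨ +-identityˡ _ ⟩
      Σ[ neighbours v ] (λ u → sqDist (cntLe (blocks v) j) (cntLe (blocks u) j))
        ≤⟨ Σ-neighbours-sqDist≤ v j ⟩
      ι M′ ∎
      where
      open ≤-Reasoning
      d : Vec (Fin M) (suc K) → ℚ
      d u = sqDist (cntLe (blocks (m ∷ v)) (M ↑ʳ j)) (cntLe (blocks u) (M ↑ʳ j))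
      same : ∀ i → d (punchIn m i ∷ v) ≡ 0ℚ
      same i = trans (cong₂ sqDist (cntLe-right m v j) (cntLe-right (punchIn m i) v j)) (sqDist-refl _)
      shift : ∀ u → d (m ∷ u) ≡ sqDist (cntLe (blocks v) j) (cntLe (blocks u) j)
      shift u = trans (cong₂ sqDist (cntLe-right m v j) (cntLe-right m u j)) (sqDist-+ 1 _ _)

    all-unique : ∀ K → Unique (all K)
    all-unique zero    = [] ∷ []
    all-unique (suc K) = Unique.cartesianProductWith⁺ _∷_ (λ e → Vec.∷-injective e) (fins-unique M) (all-unique K)

    length-all : ∀ K → length (all K) ≡ M ℕ.^ K
    length-all zero    = refl
    length-all (suc K) = trans (length-cartesianProductWith _∷_ (fins M) (all K)) (cong₂ ℕ._*_ (length-fins M) (length-all K))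

  -- The lower bound for the hypotheses

  ¾ : ℚ
  ¾ = 1ℚ - ¼

  module _ {n k q : ℕ} .{{_ : NonZero k}} {I : Set} (xs : List I) (H : I → Multiset n) where

    -- The easy direction of Yao's principle: an inequality linear in the success probabilities
    -- survives averaging over trees.
    randSuccProb-average : ∀ {a b} → 0ℚ ≤ a → (∀ (T : Tree n q) → a * Σ[ xs ] (λ x → succProb k (H x) T) ≤ b) →
      (𝒜 : RandAlg n q) → All (λ wT → 0ℚ ≤ proj₁ wT) 𝒜 → a * Σ[ xs ] (λ x → randSuccProb k (H x) 𝒜) ≤ weightSum 𝒜 * b
    randSuccProb-average {a} {b} 0≤a h [] [] =
      ≤-reflexive (trans (cong (a *_) (trans (Σ-const xs 0ℚ) (*-zeroʳ (ι (length xs))))) (trans (*-zeroʳ a) (sym (*-zeroˡ b))))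
    randSuccProb-average {a} {b} 0≤a h ((w , T) ∷ 𝒜) (0≤w ∷ 0≤ws) = begin
      a * Σ[ xs ] (λ x → w * succProb k (H x) T + randSuccProb k (H x) 𝒜)
        ≡⟨ cong (a *_) (trans (Σ-+ xs _ _) (cong (_+ Σ[ xs ] (λ x → randSuccProb k (H x) 𝒜)) (Σ-*ˡ xs w _))) ⟩
      a * (w * Σ[ xs ] (λ x → succProb k (H x) T) + Σ[ xs ] (λ x → randSuccProb k (H x) 𝒜))
        ≡⟨ eq a w _ _ ⟩
      w * (a * Σ[ xs ] (λ x → succProb k (H x) T)) + a * Σ[ xs ] (λ x → randSuccProb k (H x) 𝒜)
        ≤⟨ +-mono-≤ (*-monoʳ 0≤w (h T)) (randSuccProb-average 0≤a h 𝒜 0≤ws) ⟩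
      w * b + weightSum 𝒜 * b
        ≡⟨ *-distribʳ-+ b w (weightSum 𝒜) ⟨
      (w + weightSum 𝒜) * b ∎
      where
      open ≤-Reasoning
      eq : ∀ a w x y → a * (w * x + y) ≡ w * (a * x) + a * y
      eq = solve-∀ ℚ-ring

    solvable-average : ∀ {δ a b} → δ ≤ ¼ → (∀ x → Vec.sum (H x) ≡ k) → 0ℚ ≤ a →
      (∀ (T : Tree n q) → a * Σ[ xs ] (λ x → succProb k (H x) T) ≤ b) →
      Solvable n k δ q → a * (ι (length xs) * ¾) ≤ b
    solvable-average {δ} {a} {b} δ≤¼ ΣH 0≤a h (𝒜 , (0≤ws , Σws) , success) = begin
      a * (ι (length xs) * ¾)                              ≡⟨ cong (a *_) (Σ-const xs ¾) ⟨
      a * Σ[ xs ] (λ _ → ¾)                                ≤⟨ *-monoʳ 0≤a (Σ-mono xs (λ x →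
                                                                ≤-trans (+-monoʳ-≤ 1ℚ (neg-antimono-≤ δ≤¼)) (success (H x) (ΣH x)))) ⟩
      a * Σ[ xs ] (λ x → randSuccProb k (H x) 𝒜)           ≤⟨ randSuccProb-average 0≤a h 𝒜 0≤ws ⟩
      weightSum 𝒜 * b                                      ≡⟨ trans (cong (_* b) Σws) (*-identityˡ b) ⟩
      b                                                    ∎
      where open ≤-Reasoning

  -- A rational substitute for (1 + x)^m ≤ e. With z = 1 - x/2, Bernoulli gives z^m ≥ 1/2, while z²
  -- (1 + x) ≤ 1.
  [1+x]^m≤4 : ∀ {x} m → 0ℚ ≤ x → x ≤ 1ℚ → x * ι m ≤ 1ℚ → (1ℚ + x) ^ m ≤ ι 4
  [1+x]^m≤4 {x} m 0≤x x≤1 xm≤1 = *-cancelˡ-≤ {c = ¼} (positive⁻¹ ¼) (begin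
    ¼ * (1ℚ + x) ^ m
      ≤⟨ *-monoˡ (^-nonNeg m 0≤1+x) (*-mono {½} {z ^ m} {½} {z ^ m} (^-nonNeg m 0≤z) (nonNegative⁻¹ ½) ½≤z^m ½≤z^m) ⟩
    z ^ m * z ^ m * (1ℚ + x) ^ m
      ≡⟨ trans (cong (_* (1ℚ + x) ^ m) (sym (^-distrib-* z z m))) (sym (^-distrib-* (z * z) (1ℚ + x) m)) ⟩
    (z * z * (1ℚ + x)) ^ m
      ≤⟨ ^-≤1 m (0≤* (0≤sq z) 0≤1+x) (≤-by _ (0≤* (0≤* (0≤* (nonNegative⁻¹ ¼) 0≤x) 0≤x) (0≤+ (nonNegative⁻¹ (1ℚ + 1ℚ)) (0≤-diff x≤1))) (eq x)) ⟩
    1ℚ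
      ≡⟨ ¼4 ⟩
    ¼ * ι 4 ∎)
    where
    open ≤-Reasoning
    z = 1ℚ + - (½ * x)
    ¼4 : 1ℚ ≡ ¼ * ι 4
    ¼4 = cong (¼ *_) (ι≡ 4)
    0≤1+x : 0ℚ ≤ 1ℚ + x
    0≤1+x = 0≤+ (nonNegative⁻¹ 1ℚ) 0≤x
    eq : ∀ x → 1ℚ ≡ (1ℚ + - (½ * x)) * (1ℚ + - (½ * x)) * (1ℚ + x) + ½ * ½ * x * x * (1ℚ + 1ℚ + (1ℚ - x))
    eq = solve-∀ ℚ-ring
    eq₂ : ∀ x → 1ℚ + - (½ * x) ≡ ½ + ½ * (1ℚ - x)
    eq₂ = solve-∀ ℚ-ring
    eq₃ : ∀ x m → 1ℚ + m * (- (½ * x)) ≡ ½ + ½ * (1ℚ - x * m)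
    eq₃ = solve-∀ ℚ-ring
    0≤z : 0ℚ ≤ z
    0≤z = subst (0ℚ ≤_) (sym (eq₂ x)) (0≤+ (nonNegative⁻¹ ½) (0≤* (nonNegative⁻¹ ½) (0≤-diff x≤1)))
    ½≤z^m : ½ ≤ z ^ m
    ½≤z^m = ≤-trans (≤-by _ (0≤* (nonNegative⁻¹ ½) (0≤-diff xm≤1)) (eq₃ x (ι m))) (bernoulli (- (½ * x)) m 0≤z)

  module LowerBound (k : ℕ) .{{_ : NonZero k}} (M′ t K R r : ℕ) (k≡ : t ℕ.+ (K ℕ.+ R) ≡ k) where

    open Querying k
    open Hypotheses M′ (R ∷ Vec.replicate r 0)

    -- The t copies of the first position and the R copies of the position after the blocks are the
    -- fixed elements; the r empty positions at the end pad the range to the required n.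
    encode : Vec (Fin M) K → Multiset (suc (size K))
    encode v = t ∷ blocks v

    sum-encode : ∀ v → Vec.sum (encode v) ≡ k
    sum-encode v = trans (cong (t ℕ.+_) (trans (sum-blocks v)
      (cong (K ℕ.+_) (trans (cong (R ℕ.+_) (sum-zeros r)) (ℕ.+-identityʳ R))))) k≡

    Σ-leaf≤1 : ∀ {q} S m → Σ[ all K ] (λ v → hit S (encode v) (leaf {q = q} m)) ≤ 1ℚ
    Σ-leaf≤1 {q} S m = Σ-unique _ (all-unique K) h≤1 disjoint
      where
      h : Vec (Fin M) K → ℚ
      h v = hit S (encode v) (leaf {q = q} m)
      h≤1 : ∀ v → h v ≤ 1ℚ
      h≤1 v with Vec.≡-dec ℕ._≟_ m (encode v)
      ... | yes _ = ≤-refl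
      ... | no  _ = nonNegative⁻¹ 1ℚ
      disjoint : ∀ u v → h u ≡ 0ℚ ⊎ h v ≡ 0ℚ ⊎ u ≡ v
      disjoint u v with Vec.≡-dec ℕ._≟_ m (encode u) | Vec.≡-dec ℕ._≟_ m (encode v)
      ... | no  _  | _      = inj₁ refl
      ... | yes _  | no _   = inj₂ (inj₁ refl)
      ... | yes eu | yes ev = inj₂ (inj₂ (blocks-injective u v (Vec.∷-injectiveʳ (trans (sym eu) ev))))

    Σ-hit≤1 : ∀ {q} S → Vec.sum S ≡ k → (T : Tree (suc (size K)) q) → Σ[ all K ] (λ v → hit S (encode v) T) ≤ 1ℚ
    Σ-hit≤1 {q} S ΣS (leaf m) = Σ-leaf≤1 {q} S m
    Σ-hit≤1 S ΣS (node y l r) = begin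
      Σ[ all K ] (λ v → p * hit S (encode v) l + (1ℚ - p) * hit S (encode v) r)
        ≡⟨ trans (Σ-+ (all K) _ _) (cong₂ _+_ (Σ-*ˡ (all K) p _) (Σ-*ˡ (all K) (1ℚ - p) _)) ⟩
      p * Σ[ all K ] (λ v → hit S (encode v) l) + (1ℚ - p) * Σ[ all K ] (λ v → hit S (encode v) r)
        ≤⟨ +-mono-≤ (*-monoʳ (0≤prob S ΣS y) (Σ-hit≤1 S ΣS l)) (*-monoʳ (0≤1-prob S ΣS y) (Σ-hit≤1 S ΣS r)) ⟩
      p * 1ℚ + (1ℚ - p) * 1ℚ
        ≡⟨ eq p ⟩
      1ℚ ∎
      where
      open ≤-Reasoning
      p = prob S y
      eq : ∀ p → p * 1ℚ + (1ℚ - p) * 1ℚ ≡ 1ℚ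
      eq = solve-∀ ℚ-ring

    -- With all answer probabilities bounded by 1, each of the at most 2^q leaves serves at most one
    -- truth.
    Σ-hit≤2^q : ∀ {q} (T : Tree (suc (size K)) q) → Σ[ all K ] (λ v → hit (encode v) (encode v) T) ≤ (1ℚ + 1ℚ) ^ q
    Σ-hit≤2^q {q} (leaf m) = ≤-trans (Σ-leaf≤1 {q} (encode (Vec.replicate K zero)) m) (1≤^ q 1≤2)
      where
      1≤2 : 1ℚ ≤ 1ℚ + 1ℚ
      1≤2 = ≤-by 1ℚ (nonNegative⁻¹ 1ℚ) refl
    Σ-hit≤2^q {suc q} (node y l r) = begin
      Σ[ all K ] (λ v → hit (encode v) (encode v) (node y l r))
        ≤⟨ Σ-mono (all K) (λ v → ≤-by _
             (0≤+ (0≤* (0≤1-prob (encode v) (sum-encode v) y) (0≤hit (encode v) (sum-encode v) (encode v) l))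
                  (0≤* (0≤prob (encode v) (sum-encode v) y) (0≤hit (encode v) (sum-encode v) (encode v) r)))
             (eq (prob (encode v) y) _ _)) ⟩
      Σ[ all K ] (λ v → hit (encode v) (encode v) l + hit (encode v) (encode v) r)
        ≡⟨ Σ-+ (all K) _ _ ⟩
      Σ[ all K ] (λ v → hit (encode v) (encode v) l) + Σ[ all K ] (λ v → hit (encode v) (encode v) r)
        ≤⟨ +-mono-≤ (Σ-hit≤2^q l) (Σ-hit≤2^q r) ⟩
      (1ℚ + 1ℚ) ^ q + (1ℚ + 1ℚ) ^ q
        ≡⟨ eq₂ ((1ℚ + 1ℚ) ^ q) ⟩
      (1ℚ + 1ℚ) ^ suc q ∎
      where
      open ≤-Reasoning
      eq : ∀ p x y → x + y ≡ p * x + (1ℚ - p) * y + ((1ℚ - p) * x + p * y)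
      eq = solve-∀ ℚ-ring
      eq₂ : ∀ x → x + x ≡ (1ℚ + 1ℚ) * x
      eq₂ = solve-∀ ℚ-ring

    Σ-succProb≡ : ∀ {q} (T : Tree (suc (size K)) q) →
      Σ[ all K ] (λ v → succProb k (encode v) T) ≡ Σ[ all K ] (λ v → hit (encode v) (encode v) T)
    Σ-succProb≡ T = Σ-cong (all K) (λ v → succProb≡hit (encode v) T)

    counting : ∀ {δ q} → δ ≤ ¼ → Solvable (suc (size K)) k δ q → 3 ℕ.* length (all K) ℕ.≤ 4 ℕ.* 2 ℕ.^ q
    counting {δ} {q} δ≤¼ solvable = ι-cancel (begin
      ι (3 ℕ.* length (all K))              ≡⟨ trans (ι-* 3 _) (cong (_* ι (length (all K))) (sym (ι≡ 3))) ⟩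
      ℕ→ℚ 3 * ι (length (all K))            ≡⟨ eq (ι (length (all K))) ⟩
      ℕ→ℚ 4 * (1ℚ * (ι (length (all K)) * ¾)) ≤⟨ *-monoʳ (nonNegative⁻¹ (ℕ→ℚ 4)) (solvable-average (all K) encode {a = 1ℚ} δ≤¼ sum-encode (nonNegative⁻¹ 1ℚ)
                                                 (λ T → ≤-trans (≤-reflexive (trans (*-identityˡ _) (Σ-succProb≡ T))) (Σ-hit≤2^q T)) solvable) ⟩
      ℕ→ℚ 4 * (1ℚ + 1ℚ) ^ q                 ≡⟨ cong₂ (λ x y → x * y ^ q) (ι≡ 4) (ι≡ 2) ⟩
      ι 4 * ι 2 ^ q                         ≡⟨ trans (ι-* 4 _) (cong (ι 4 *_) (ι-^ 2 q)) ⟨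
      ι (4 ℕ.* 2 ℕ.^ q)                     ∎)
      where
      open ≤-Reasoning
      eq : ∀ x → ℕ→ℚ 3 * x ≡ ℕ→ℚ 4 * (1ℚ * (x * (1ℚ - ½ * ½)))
      eq = solve-∀ ℚ-ring

    module _ .{{_ : NonZero t}} .{{_ : NonZero K}} .{{_ : NonZero M′}} (K≤t : K ℕ.≤ t) (t≤R : t ℕ.≤ R) where

      private
        κ τ ν : ℚ
        κ = proj₁ (inverse (0<ι k))
        τ = proj₁ (inverse (0<ι t))
        ν = proj₁ (inverse (0<ι K))
        0<κ = proj₁ (proj₂ (inverse (0<ι k)))
        0<τ = proj₁ (proj₂ (inverse (0<ι t)))
        0<ν = proj₁ (proj₂ (inverse (0<ι K)))
        kκ = proj₂ (proj₂ (inverse (0<ι k)))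
        tτ = proj₂ (proj₂ (inverse (0<ι t)))
        Kν = proj₂ (proj₂ (inverse (0<ι K)))

        -- x = 1 / (t² K) bounds the χ²-divergence of a query, averaged over the alternatives.
        x B : ℚ
        x = τ * τ * ν
        B = 1ℚ + x

      0≤x : 0ℚ ≤ x
      0≤x = 0≤* (0≤sq τ) (<⇒≤ 0<ν)

      1≤B : 1ℚ ≤ B
      1≤B = ≤-by x 0≤x refl

      prob≡ : ∀ {n} (S : Multiset n) y → prob S y ≡ ι (cntLe S y) * κ
      prob≡ S y = trans (sym (*-identityʳ _)) (trans (cong (prob S y *_) (sym kκ))
        (trans (sym (*-assoc (prob S y) (ι k) κ)) (cong (_* κ) (prob-ι S y))))

      module _ (v : Vec (Fin M) K) where

        instance
          neighbours-nonZero : NonZero (length (neighbours v))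
          neighbours-nonZero = subst NonZero (sym (length-neighbours v)) (ℕ.m*n≢0 K M′)

        -- Under every hypothesis both answers have probability at least t/k: the t elements at the
        -- left are always counted, the R ≥ t at the right never. Hence a change of the count by d
        -- costs a divergence of at most d² / t², and the squares d² sum to at most `M′` over the
        -- neighbours.
        interior : ∀ y → (∀ u → cntLe (blocks {K} u) y ℕ.≤ K) →
          Separation (neighbours v) B (prob (encode v) (suc y)) (λ u → prob (encode u) (suc y))
        interior y h = mean-separation (neighbours v) {w = w} {w′ = w′} (0<p v) (0<p′ v) (λ u → <⇒≤ (0<p u)) (λ u → <⇒≤ (0<p′ u))
          (λ u → proj₁ (proj₂ (inverse (0<p u)))) (λ u → proj₁ (proj₂ (inverse (0<p′ u))))
          (λ u → proj₂ (proj₂ (inverse (0<p u)))) (λ u → proj₂ (proj₂ (inverse (0<p′ u)))) sum≤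
          where
          P : Vec (Fin M) K → ℚ
          P u = prob (encode u) (suc y)
          c : Vec (Fin M) K → ℕ
          c u = t ℕ.+ cntLe (blocks u) y
          tκ≤p : ∀ u → ι t * κ ≤ P u
          tκ≤p u = subst (ι t * κ ≤_) (sym (prob≡ (encode u) (suc y))) (*-monoˡ (<⇒≤ 0<κ) (ι-mono (ℕ.m≤m+n t _)))
          tκ≤p′ : ∀ u → ι t * κ ≤ 1ℚ - P u
          tκ≤p′ u = subst (ι t * κ ≤_) eq′ (*-monoˡ {ι t} {ι k - ι (c u)} {κ} (<⇒≤ 0<κ) (≤-by (ι (k ℕ.∸ (t ℕ.+ c u))) (0≤ι _) eq))
            where
            t+c≤k : t ℕ.+ c u ℕ.≤ k
            t+c≤k = subst (t ℕ.+ c u ℕ.≤_) (trans (cong (t ℕ.+_) (ℕ.+-comm R K)) k≡)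
              (ℕ.+-monoʳ-≤ t (ℕ.+-mono-≤ t≤R (h u)))
            eq : ι k - ι (c u) ≡ ι t + ι (k ℕ.∸ (t ℕ.+ c u))
            eq = trans (cong (λ z → ι z - ι (c u)) (sym (ℕ.m+[n∸m]≡n t+c≤k)))
              (trans (cong (_- ι (c u)) (trans (ι-+ (t ℕ.+ c u) _) (cong (_+ ι (k ℕ.∸ (t ℕ.+ c u))) (ι-+ t (c u)))))
                (lem (ι t) (ι (c u)) _))
              where
              lem : ∀ a b d → a + b + d - b ≡ a + d
              lem = solve-∀ ℚ-ring
            eq′ : (ι k - ι (c u)) * κ ≡ 1ℚ - P u
            eq′ = trans (lem (ι k) (ι (c u)) κ) (cong₂ _-_ kκ (sym (prob≡ (encode u) (suc y))))
              where
              lem : ∀ a b c → (a - b) * c ≡ a * c - b * c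
              lem = solve-∀ ℚ-ring
          0<tκ : 0ℚ < ι t * κ
          0<tκ = 0<* (0<ι t) 0<κ
          0<p : ∀ u → 0ℚ < P u
          0<p u = <-≤-trans 0<tκ (tκ≤p u)
          0<p′ : ∀ u → 0ℚ < 1ℚ - P u
          0<p′ u = <-≤-trans 0<tκ (tκ≤p′ u)
          w w′ : Vec (Fin M) K → ℚ
          w u = proj₁ (inverse (0<p u))
          w′ u = proj₁ (inverse (0<p′ u))
          κw≤τ : ∀ {p} (0<p : 0ℚ < p) → ι t * κ ≤ p → κ * proj₁ (inverse 0<p) ≤ τ
          κw≤τ {p} 0<p tκ≤p = *-cancelˡ-≤ (0<ι t) (begin
            ι t * (κ * ω)  ≡⟨ *-assoc (ι t) κ ω ⟨
            ι t * κ * ω    ≤⟨ *-monoˡ (<⇒≤ (proj₁ (proj₂ (inverse 0<p)))) tκ≤p ⟩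
            p * ω          ≡⟨ trans (proj₂ (proj₂ (inverse 0<p))) (sym tτ) ⟩
            ι t * τ        ∎)
            where
            open ≤-Reasoning
            ω = proj₁ (inverse 0<p)
          -- With w = 1/q and w′ = 1/(1-q) this is the second moment of the likelihood ratio of two
          -- coins, written as 1 plus the χ²-divergence (p-q)² / (q (1-q)).
          χ² : ∀ {p q w w′} → q * w ≡ 1ℚ → (1ℚ - q) * w′ ≡ 1ℚ →
            p * p * w + (1ℚ - p) * (1ℚ - p) * w′ ≡ 1ℚ + (p - q) * (p - q) * (w * w′)
          χ² {p} {q} {w} {w′} qw qw′ = begin
            p * p * w + (1ℚ - p) * (1ℚ - p) * w′
              ≡⟨ eq₁ p q w w′ ⟩
            (q + ((p - q) + (p - q))) * (q * w) + ((1ℚ - q) - ((p - q) + (p - q))) * ((1ℚ - q) * w′) + (p - q) * (p - q) * (w + w′)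
              ≡⟨ cong₂ (λ a b → (q + ((p - q) + (p - q))) * a + ((1ℚ - q) - ((p - q) + (p - q))) * b + (p - q) * (p - q) * (w + w′)) qw qw′ ⟩
            (q + ((p - q) + (p - q))) * 1ℚ + ((1ℚ - q) - ((p - q) + (p - q))) * 1ℚ + (p - q) * (p - q) * (w + w′)
              ≡⟨ eq₂ p q w w′ ⟩
            1ℚ + (p - q) * (p - q) * (1ℚ * w′ + 1ℚ * w)
              ≡⟨ cong₂ (λ a b → 1ℚ + (p - q) * (p - q) * (a * w′ + b * w)) qw qw′ ⟨
            1ℚ + (p - q) * (p - q) * (q * w * w′ + (1ℚ - q) * w′ * w)
              ≡⟨ eq₃ p q w w′ ⟩
            1ℚ + (p - q) * (p - q) * (w * w′) ∎
            where
            open ≡-Reasoning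
            eq₁ : ∀ p q w w′ → p * p * w + (1ℚ - p) * (1ℚ - p) * w′ ≡
              (q + ((p - q) + (p - q))) * (q * w) + ((1ℚ - q) - ((p - q) + (p - q))) * ((1ℚ - q) * w′) + (p - q) * (p - q) * (w + w′)
            eq₁ = solve-∀ ℚ-ring
            eq₂ : ∀ p q w w′ → (q + ((p - q) + (p - q))) * 1ℚ + ((1ℚ - q) - ((p - q) + (p - q))) * 1ℚ + (p - q) * (p - q) * (w + w′) ≡
              1ℚ + (p - q) * (p - q) * (1ℚ * w′ + 1ℚ * w)
            eq₂ = solve-∀ ℚ-ring
            eq₃ : ∀ p q w w′ → 1ℚ + (p - q) * (p - q) * (q * w * w′ + (1ℚ - q) * w′ * w) ≡ 1ℚ + (p - q) * (p - q) * (w * w′)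
            eq₃ = solve-∀ ℚ-ring
          D : Vec (Fin M) K → ℚ
          D u = sqDist (cntLe (blocks v) y) (cntLe (blocks u) y)
          term≤ : ∀ u → P v * P v * w u + (1ℚ - P v) * (1ℚ - P v) * w′ u ≤ 1ℚ + τ * τ * D u
          term≤ u = begin
            P v * P v * w u + (1ℚ - P v) * (1ℚ - P v) * w′ u
              ≡⟨ χ² {P v} {P u} {w u} {w′ u} (proj₂ (proj₂ (inverse (0<p u)))) (proj₂ (proj₂ (inverse (0<p′ u)))) ⟩
            1ℚ + (P v - P u) * (P v - P u) * (w u * w′ u)
              ≡⟨ cong₂ (λ a b → 1ℚ + (a - b) * (a - b) * (w u * w′ u)) (prob≡ (encode v) (suc y)) (prob≡ (encode u) (suc y)) ⟩
            1ℚ + (ι (c v) * κ - ι (c u) * κ) * (ι (c v) * κ - ι (c u) * κ) * (w u * w′ u)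
              ≡⟨ eq (ι (c v)) (ι (c u)) κ (w u) (w′ u) ⟩
            1ℚ + κ * w u * (κ * w′ u) * sqDist (c v) (c u)
              ≤⟨ +-monoʳ-≤ 1ℚ (*-monoˡ (0≤sq (ι (c v) - ι (c u))) (*-mono (<⇒≤ 0<τ)
                   (<⇒≤ (0<* 0<κ (proj₁ (proj₂ (inverse (0<p′ u)))))) (κw≤τ (0<p u) (tκ≤p u)) (κw≤τ (0<p′ u) (tκ≤p′ u)))) ⟩
            1ℚ + τ * τ * sqDist (c v) (c u)
              ≡⟨ cong (λ z → 1ℚ + τ * τ * z) (sqDist-+ t _ _) ⟩
            1ℚ + τ * τ * D u ∎
            where
            open ≤-Reasoning
            eq : ∀ a b k w w′ → 1ℚ + (a * k - b * k) * (a * k - b * k) * (w * w′) ≡ 1ℚ + k * w * (k * w′) * ((a - b) * (a - b))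
            eq = solve-∀ ℚ-ring
          N = neighbours v
          sum≤ : Σ[ N ] (λ u → P v * P v * w u + (1ℚ - P v) * (1ℚ - P v) * w′ u) ≤ ι (length N) * B
          sum≤ = begin
            Σ[ N ] (λ u → P v * P v * w u + (1ℚ - P v) * (1ℚ - P v) * w′ u)
              ≤⟨ Σ-mono N term≤ ⟩
            Σ[ N ] (λ u → 1ℚ + τ * τ * D u)
              ≡⟨ trans (Σ-+ N _ _) (cong₂ _+_ (Σ-const N 1ℚ) (Σ-*ˡ N (τ * τ) D)) ⟩
            ι (length N) * 1ℚ + τ * τ * Σ[ N ] D
              ≤⟨ +-monoʳ-≤ (ι (length N) * 1ℚ) (*-monoʳ (0≤sq τ) (Σ-neighbours-sqDist≤ v y)) ⟩
            ι (length N) * 1ℚ + τ * τ * ι M′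
              ≡⟨ cong (λ z → ι (length N) * 1ℚ + τ * τ * z) (trans (sym (*-identityˡ (ι M′))) (cong (_* ι M′) (sym Kν))) ⟩
            ι (length N) * 1ℚ + τ * τ * (ι K * ν * ι M′)
              ≡⟨ eq (ι (length N)) τ (ι K) ν (ι M′) ⟩
            ι (length N) + x * (ι K * ι M′)
              ≡⟨ cong (λ z → ι (length N) + x * z) (trans (sym (ι-* K M′)) (cong ι (sym (length-neighbours v)))) ⟩
            ι (length N) + x * ι (length N)
              ≡⟨ eq₂ (ι (length N)) x ⟩
            ι (length N) * B ∎
            where
            open ≤-Reasoning
            eq : ∀ a t k n m → a * 1ℚ + t * t * (k * n * m) ≡ a + t * t * n * (k * m)
            eq = solve-∀ ℚ-ring
            eq₂ : ∀ a x → a + x * a ≡ a * (1ℚ + x)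
            eq₂ = solve-∀ ℚ-ring

        separation : ∀ y → Separation (neighbours v) B (prob (encode v) y) (λ u → prob (encode u) y)
        separation zero    = trivial-separation (neighbours v) 1≤B (λ u → prob-cong {S = encode u} {encode v} {zero} refl)
        separation (suc y) with block-or-tail K y
        ... | inj₁ h = interior y h
        ... | inj₂ h = trivial-separation (neighbours v) 1≤B
                         (λ u → prob-cong {S = encode u} {encode v} {suc y} (cong (t ℕ.+_) (h u v)))

        -- Replaces s² by its tangent s - 1/4 at 1/2, since only a bound linear in s can be averaged
        -- over the trees of a randomized algorithm.
        hit≤ : ∀ {q} (T : Tree (suc (size K)) q) → ι (K ℕ.* M′) * (hit (encode v) (encode v) T - ¼) ≤
               B ^ q * Σ[ neighbours v ] (λ u → hit (encode u) (encode v) T)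
        hit≤ {q} T = begin
          ι (K ℕ.* M′) * (s - ¼)                ≤⟨ *-monoʳ (0≤ι (K ℕ.* M′)) (≤-by _ (0≤sq (s - ½)) (eq s)) ⟩
          ι (K ℕ.* M′) * (s * s)                ≡⟨ trans (*-comm _ (s * s)) (cong (λ z → s * s * ι z) (sym (length-neighbours v))) ⟩
          s * s * ι (length (neighbours v))     ≤⟨ ChangeOfMeasure.hit²≤ (neighbours v) encode (encode v) (sum-encode v) sum-encode 1≤B separation T ⟩
          B ^ q * Σ[ neighbours v ] (λ u → hit (encode u) (encode v) T) ∎
          where
          open ≤-Reasoning
          s = hit (encode v) (encode v) T
          eq : ∀ s → s * s ≡ s - ½ * ½ + (s - ½) * (s - ½)
          eq = solve-∀ ℚ-ring

      -- Summed over all truths, the mistakes on the right of `hit≤` can be read as the truth v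
      -- producing a neighbouring output. Under v this has probability at most 1 - s, since outputs
      -- are disjoint events. With A = `K * M′`, b = `B ^ q`, N truths and total success X, this
      -- reads A (X - N/4) ≤ b (N - X).
      Σ-hit≤ : ∀ {q} (T : Tree (suc (size K)) q) →
        (ι (K ℕ.* M′) + B ^ q) * Σ[ all K ] (λ v → succProb k (encode v) T) ≤ (B ^ q + ι (K ℕ.* M′) * ¼) * ι (length (all K))
      Σ-hit≤ {q} T = begin
        (a + b) * Σ[ all K ] (λ v → succProb k (encode v) T)
          ≡⟨ cong ((a + b) *_) (Σ-succProb≡ T) ⟩
        (a + b) * X
          ≡⟨ eq a b X N ⟩
        a * (X + N * (- ¼)) + (a * ¼ * N + b * X)
          ≡⟨ cong (λ z → a * z + (a * ¼ * N + b * X)) (trans (cong (λ z → X + z) (sym (Σ-const (all K) (- ¼)))) (sym (Σ-+ (all K) s (λ _ → - ¼)))) ⟩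
        a * Σ[ all K ] (λ v → s v - ¼) + (a * ¼ * N + b * X)
          ≡⟨ cong (_+ (a * ¼ * N + b * X)) (sym (Σ-*ˡ (all K) a _)) ⟩
        Σ[ all K ] (λ v → a * (s v - ¼)) + (a * ¼ * N + b * X)
          ≤⟨ +-monoˡ-≤ _ (Σ-mono (all K) (λ v → hit≤ v T)) ⟩
        Σ[ all K ] (λ v → b * Σ[ neighbours v ] (λ u → hit (encode u) (encode v) T)) + (a * ¼ * N + b * X)
          ≡⟨ cong (_+ (a * ¼ * N + b * X)) (trans (Σ-*ˡ (all K) b _) (cong (b *_) (Σ-neighbours-swap K (λ v u → hit (encode u) (encode v) T)))) ⟩
        b * Σ[ all K ] (λ v → Σ[ neighbours v ] (λ u → hit (encode v) (encode u) T)) + (a * ¼ * N + b * X)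
          ≤⟨ +-monoˡ-≤ _ (*-monoʳ 0≤b (Σ-mono (all K) others)) ⟩
        b * Σ[ all K ] (λ v → 1ℚ + (- 1ℚ) * s v) + (a * ¼ * N + b * X)
          ≡⟨ cong (λ z → b * z + (a * ¼ * N + b * X)) (trans (Σ-+ (all K) _ _) (cong₂ _+_ (Σ-const (all K) 1ℚ) (Σ-*ˡ (all K) (- 1ℚ) s))) ⟩
        b * (N * 1ℚ + (- 1ℚ) * X) + (a * ¼ * N + b * X)
          ≡⟨ eq₃ a b X N ⟩
        (b + a * ¼) * N ∎
        where
        open ≤-Reasoning
        a = ι (K ℕ.* M′)
        b = B ^ q
        0≤b : 0ℚ ≤ b
        0≤b = ^-nonNeg q (≤-trans (nonNegative⁻¹ 1ℚ) 1≤B)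
        s : Vec (Fin M) K → ℚ
        s v = hit (encode v) (encode v) T
        X = Σ[ all K ] s
        N = ι (length (all K))
        eq₂ : ∀ y s → 1ℚ + (- 1ℚ) * s ≡ y + (1ℚ - (s + y))
        eq₂ = solve-∀ ℚ-ring
        others : ∀ v → Σ[ neighbours v ] (λ u → hit (encode v) (encode u) T) ≤ 1ℚ + (- 1ℚ) * s v
        others v = ≤-by (1ℚ - (s v + y))
          (0≤-diff (≤-trans (Σ-neighbours≤Σ-all v _ (λ u → 0≤hit (encode v) (sum-encode v) (encode u) T))
                            (Σ-hit≤1 (encode v) (sum-encode v) T)))
          (eq₂ y (s v))
          where y = Σ[ neighbours v ] (λ u → hit (encode v) (encode u) T)
        eq : ∀ a b X N → (a + b) * X ≡ a * (X + N * (- (½ * ½))) + (a * (½ * ½) * N + b * X)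
        eq = solve-∀ ℚ-ring
        eq₃ : ∀ a b X N → b * (N * 1ℚ + (- 1ℚ) * X) + (a * (½ * ½) * N + b * X) ≡ (b + a * (½ * ½)) * N
        eq₃ = solve-∀ ℚ-ring

      -- Average success at least 3/4 in `Σ-hit≤` leaves A/2 ≤ B^q / 4.
      2A≤B^q : ∀ {δ q} → δ ≤ ¼ → Solvable (suc (size K)) k δ q → ι (2 ℕ.* (K ℕ.* M′)) ≤ B ^ q
      2A≤B^q {δ} {q} δ≤¼ solvable = *-cancelˡ-≤ {c = N} 0<N (≤-by (ℕ→ℚ 4 * (rhs - lhs)) (0≤* (nonNegative⁻¹ (ℕ→ℚ 4)) (0≤-diff main))
        (trans (eq a (B ^ q) N) (cong (λ z → N * z + ℕ→ℚ 4 * (rhs - lhs)) (sym (trans (ι-* 2 _) (cong (_* a) (sym (ι≡ 2))))))))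
        where
        a = ι (K ℕ.* M′)
        N = ι (length (all K))
        lhs = (a + B ^ q) * (N * ¾)
        rhs = (B ^ q + a * ¼) * N
        0<N : 0ℚ < N
        0<N = 0<ι (length (all K)) {{subst NonZero (sym (length-all K)) (ℕ.m^n≢0 M K)}}
        main : lhs ≤ rhs
        main = solvable-average (all K) encode δ≤¼ sum-encode (0≤+ (0≤ι _) (^-nonNeg q (≤-trans (nonNegative⁻¹ 1ℚ) 1≤B))) Σ-hit≤ solvable
        eq : ∀ a b N → N * b ≡ N * (ℕ→ℚ 2 * a) + ℕ→ℚ 4 * ((b + a * (½ * ½)) * N - (a + b) * (N * (1ℚ - ½ * ½)))
        eq = solve-∀ ℚ-ring

      2A≤4^j : ∀ {δ q} → δ ≤ ¼ → Solvable (suc (size K)) k δ q → ∀ j → q ℕ.≤ K ℕ.* (t ℕ.* t) ℕ.* j →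
               2 ℕ.* (K ℕ.* M′) ℕ.≤ 4 ℕ.^ j
      2A≤4^j {δ} {q} δ≤¼ solvable j q≤ = ι-cancel (begin
        ι (2 ℕ.* (K ℕ.* M′))   ≤⟨ 2A≤B^q δ≤¼ solvable ⟩
        B ^ q                  ≤⟨ ^-monoʳ 1≤B q≤ ⟩
        B ^ (m ℕ.* j)          ≡⟨ ^-assocʳ B m j ⟨
        (B ^ m) ^ j            ≤⟨ ^-monoˡ j (^-nonNeg m (≤-trans (nonNegative⁻¹ 1ℚ) 1≤B)) ([1+x]^m≤4 m 0≤x x≤1 (≤-reflexive xm≡1)) ⟩
        ι 4 ^ j                ≡⟨ ι-^ 4 j ⟨
        ι (4 ℕ.^ j)            ∎)
        where
        open ≤-Reasoning
        m = K ℕ.* (t ℕ.* t)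
        xm≡1 : x * ι m ≡ 1ℚ
        xm≡1 = trans (cong (x *_) (trans (ι-* K _) (cong (ι K *_) (ι-* t t)))) (trans (eq τ ν (ι K) (ι t))
          (trans (cong₂ (λ a b → a * a * b) tτ Kν) refl))
          where
          eq : ∀ τ ν K t → τ * τ * ν * (K * (t * t)) ≡ t * τ * (t * τ) * (K * ν)
          eq = solve-∀ ℚ-ring
        x≤1 : x ≤ 1ℚ
        x≤1 = subst₂ _≤_ (*-identityʳ x) xm≡1 (*-monoʳ 0≤x (subst (_≤ ι m) ι1 (ι-mono (ℕ.>-nonZero⁻¹ m {{m≢0}}))))
          where
          m≢0 : NonZero m
          m≢0 = ℕ.m*n≢0 K (t ℕ.* t) {{it}} {{ℕ.m*n≢0 t t}}
            where
            it : NonZero K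
            it = ℕ.>-nonZero (ℕ.>-nonZero⁻¹ K)

  -- Multiplicative updates

  module Updates (k : ℕ) .{{_ : NonZero k}} where

    open Querying k

    opaque

      κ : ℚ
      κ = proj₁ (inverse (0<ι k))

      0<κ : 0ℚ < κ
      0<κ = proj₁ (proj₂ (inverse (0<ι k)))

      kκ : ι k * κ ≡ 1ℚ
      kκ = proj₂ (proj₂ (inverse (0<ι k)))

    0≤κ : 0ℚ ≤ κ
    0≤κ = <⇒≤ 0<κ

    κ≤1 : κ ≤ 1ℚ
    κ≤1 = subst₂ _≤_ (trans (cong (_* κ) ι1) (*-identityˡ κ)) kκ (*-monoˡ 0≤κ (ι-mono (ℕ.>-nonZero⁻¹ k)))

    prob≡ : ∀ {n} (S : Multiset n) y → prob S y ≡ ι (cntLe S y) * κ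
    prob≡ S y = trans (sym (*-identityʳ _)) (trans (cong (prob S y *_) (sym kκ))
      (trans (sym (*-assoc (prob S y) (ι k) κ)) (cong (_* κ) (prob-ι S y))))

    opaque

      -- γ bounds the expected change of a wrong weight, relative to the right one, when the queried
      -- boundary separates the two. ρ has half the gain, because a pair of queries around the
      -- median is only sure to separate half of the total weight from the truth.
      γ ρ : ℚ
      γ = 1ℚ - κ * κ * (¼ * ¼)
      ρ = 1ℚ - κ * κ * (¼ * ¼) * ½

      -- With the threshold θ = (i - 1/2) / k between the probabilities (i - 1) / k and i / k,
      -- a i = 1 - (1 - θ) κ / 2 and b i = 1 + θ κ / 2; first-order terms cancel at p = θ.
      e a b : ℕ → ℚ
      e i = (ι i + ι i - 1ℚ) * (κ * κ * ¼)
      a i = 1ℚ - ½ * κ + e i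
      b i = 1ℚ + e i

      0≤κκ : 0ℚ ≤ κ * κ
      0≤κκ = 0≤* 0≤κ 0≤κ

      κκ≤1 : κ * κ ≤ 1ℚ
      κκ≤1 = *-mono (nonNegative⁻¹ 1ℚ) 0≤κ κ≤1 κ≤1

      0≤γ : 0ℚ ≤ γ
      0≤γ = subst (0ℚ ≤_) (sym (eq (κ * κ))) (0≤+ (nonNegative⁻¹ (1ℚ - ¼ * ¼)) (0≤* (0≤-diff κκ≤1) (nonNegative⁻¹ (¼ * ¼))))
        where
        eq : ∀ c → 1ℚ - c * (½ * ½ * (½ * ½)) ≡ 1ℚ - ½ * ½ * (½ * ½) + (1ℚ - c) * (½ * ½ * (½ * ½))
        eq = solve-∀ ℚ-ring

      γ≤ρ : γ ≤ ρ
      γ≤ρ = ≤-by _ (0≤* (0≤* 0≤κκ (nonNegative⁻¹ (¼ * ¼))) (nonNegative⁻¹ ½)) (eq (κ * κ))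
        where
        eq : ∀ c → 1ℚ - c * (½ * ½ * (½ * ½)) * ½ ≡ 1ℚ - c * (½ * ½ * (½ * ½)) + c * (½ * ½ * (½ * ½)) * ½
        eq = solve-∀ ℚ-ring

      ρ≡ : ρ ≡ 1ℚ - (1ℚ - γ) * ½
      ρ≡ = eq (κ * κ * (¼ * ¼))
        where
        eq : ∀ c → 1ℚ - c * ½ ≡ 1ℚ - (1ℚ - (1ℚ - c)) * ½
        eq = solve-∀ ℚ-ring

      γ≤1 : γ ≤ 1ℚ
      γ≤1 = ≤-by _ (0≤* 0≤κκ (nonNegative⁻¹ (¼ * ¼))) (eq (κ * κ * (¼ * ¼)))
        where
        eq : ∀ c → 1ℚ ≡ 1ℚ - c + c
        eq = solve-∀ ℚ-ring

      ρ≤1 : ρ ≤ 1ℚ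
      ρ≤1 = ≤-by _ (0≤* (0≤* 0≤κκ (nonNegative⁻¹ (¼ * ¼))) (nonNegative⁻¹ ½)) (eq (κ * κ * (¼ * ¼) * ½))
        where
        eq : ∀ c → 1ℚ ≡ 1ℚ - c + c
        eq = solve-∀ ℚ-ring

      0≤ρ : 0ℚ ≤ ρ
      0≤ρ = ≤-trans 0≤γ γ≤ρ

      0<a : ∀ i → 0ℚ < a i
      0<a i = <-≤-trans (positive⁻¹ ¼) (≤-by _
        (0≤+ (0≤* (nonNegative⁻¹ ¼) (0≤* (0≤-diff κ≤1) (0≤+ (nonNegative⁻¹ (1ℚ + 1ℚ + 1ℚ)) 0≤κ))) (0≤* (0≤ι i) (0≤* 0≤κκ (nonNegative⁻¹ ½)))) (eq κ (ι i)))
        where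
        eq : ∀ κ i → 1ℚ - ½ * κ + (i + i - 1ℚ) * (κ * κ * (½ * ½)) ≡
          ½ * ½ + (½ * ½ * ((1ℚ - κ) * (1ℚ + 1ℚ + 1ℚ + κ)) + i * (κ * κ * ½))
        eq = solve-∀ ℚ-ring

      0<b : ∀ i → 0ℚ < b i
      0<b i = <-≤-trans (0<a i) (≤-by _ (0≤* (nonNegative⁻¹ ½) 0≤κ) (eq κ (e i)))
        where
        eq : ∀ κ e → 1ℚ + e ≡ 1ℚ - ½ * κ + e + ½ * κ
        eq = solve-∀ ℚ-ring

      α β : ℕ → ℚ
      α i = proj₁ (inverse (0<a i))
      β i = proj₁ (inverse (0<b i))

      0<α : ∀ i → 0ℚ < α i
      0<α i = proj₁ (proj₂ (inverse (0<a i)))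

      0<β : ∀ i → 0ℚ < β i
      0<β i = proj₁ (proj₂ (inverse (0<b i)))

      aα : ∀ i → a i * α i ≡ 1ℚ
      aα i = proj₂ (proj₂ (inverse (0<a i)))

      bβ : ∀ i → b i * β i ≡ 1ℚ
      bβ i = proj₂ (proj₂ (inverse (0<b i)))

      e-mono : ∀ {i j} → i ℕ.≤ j → e i ≤ e j
      e-mono {i} {j} i≤j = *-monoˡ (0≤* 0≤κκ (nonNegative⁻¹ ¼)) (+-monoˡ-≤ (- 1ℚ) (+-mono-≤ (ι-mono i≤j) (ι-mono i≤j)))

      a-mono : ∀ {i j} → i ℕ.≤ j → a i ≤ a j
      a-mono i≤j = +-monoʳ-≤ (1ℚ - ½ * κ) (e-mono i≤j)

      b-mono : ∀ {i j} → i ℕ.≤ j → b i ≤ b j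
      b-mono i≤j = +-monoʳ-≤ 1ℚ (e-mono i≤j)

      -- The expectation is 1 - pκ/2 + `e i`, which is 1 - κ²/4 at p = iκ and decreases in p.
      contract-above : ∀ {p} i → ι i * κ ≤ p → p * a i + (1ℚ - p) * b i ≤ γ
      contract-above {p} i iκ≤p = ≤-by _
        (0≤+ (0≤* (0≤* (nonNegative⁻¹ ½) 0≤κ) (0≤-diff iκ≤p)) (0≤* 0≤κκ (nonNegative⁻¹ (¼ - ¼ * ¼)))) (eq κ (ι i) p)
        where
        eq : ∀ κ i p → 1ℚ - κ * κ * (½ * ½ * (½ * ½)) ≡
          p * (1ℚ - ½ * κ + (i + i - 1ℚ) * (κ * κ * (½ * ½))) + (1ℚ - p) * (1ℚ + (i + i - 1ℚ) * (κ * κ * (½ * ½))) +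
          (½ * κ * (p - i * κ) + κ * κ * (½ * ½ - ½ * ½ * (½ * ½)))
        eq = solve-∀ ℚ-ring

      ab≤3 : ∀ {i} → i ℕ.≤ suc k → a i * b i ≤ 1ℚ + 1ℚ + 1ℚ
      ab≤3 {i} i≤k+1 = ≤-trans (*-mono {b = 1ℚ + ½} {d = 1ℚ + 1ℚ} (nonNegative⁻¹ (1ℚ + ½)) (<⇒≤ (0<b i))
          (≤-trans (a-mono i≤k+1) (≤-by _ (0≤+ (0≤* (0≤-diff κκ≤1) (nonNegative⁻¹ ¼)) (nonNegative⁻¹ ¼)) (trans (eq₁ κ) (cong (λ z → 1ℚ - ½ * κ + z + ((1ℚ - κ * κ) * ¼ + ¼)) e≡))))
          (≤-trans (b-mono i≤k+1) (≤-by _ (0≤+ (0≤+ (0≤* (nonNegative⁻¹ ½) (0≤-diff κ≤1)) (0≤* (0≤-diff κκ≤1) (nonNegative⁻¹ ¼))) (nonNegative⁻¹ ¼)) (trans (eq₂ κ) (cong (λ z → 1ℚ + z + (½ * (1ℚ - κ) + (1ℚ - κ * κ) * ¼ + ¼)) e≡)))))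
        (≤-reflexive refl)
        where
        e≡ : ½ * κ + κ * κ * ¼ ≡ e (suc k)
        e≡ = trans (cong (λ z → ½ * z + κ * κ * ¼) (trans (sym (*-identityˡ κ)) (cong (_* κ) (sym kκ))))
          (trans (eq (ι k) κ) (cong (λ z → (z + z - 1ℚ) * (κ * κ * ¼)) (sym (ι-suc k))))
          where
          eq : ∀ k κ → ½ * (k * κ * κ) + κ * κ * (½ * ½) ≡ (1ℚ + k + (1ℚ + k) - 1ℚ) * (κ * κ * (½ * ½))
          eq = solve-∀ ℚ-ring
        eq₁ : ∀ κ → 1ℚ + ½ ≡ 1ℚ - ½ * κ + (½ * κ + κ * κ * (½ * ½)) + ((1ℚ - κ * κ) * (½ * ½) + ½ * ½)
        eq₁ = solve-∀ ℚ-ring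
        eq₂ : ∀ κ → 1ℚ + 1ℚ ≡ 1ℚ + (½ * κ + κ * κ * (½ * ½)) + (½ * (1ℚ - κ) + (1ℚ - κ * κ) * (½ * ½) + ½ * ½)
        eq₂ = solve-∀ ℚ-ring

      -- After multiplication by a b, the half step between p and the threshold yields κ²/4.
      -- Completing the square (e - κ/4)² uses κ²/16 of it; the remaining 3κ²/16 covers the loss a b
      -- κ²/16 caused by γ, as a b ≤ 3. This balance determines the 1/16 in γ.
      contract-below : ∀ {p} i → i ℕ.≤ suc k → p + κ ≤ ι i * κ → p * α i + (1ℚ - p) * β i ≤ γ
      contract-below {p} i i≤k+1 p≤ = begin
        p * α i + (1ℚ - p) * β i
          ≡⟨ cong₂ _+_ (cong (p *_) (trans (sym (*-identityˡ (α i))) (cong (_* α i) (sym (bβ i)))))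
                       (cong ((1ℚ - p) *_) (trans (sym (*-identityˡ (β i))) (cong (_* β i) (sym (aα i))))) ⟩
        p * (b i * β i * α i) + (1ℚ - p) * (a i * α i * β i)
          ≡⟨ eq₁ p (a i) (b i) (α i) (β i) ⟩
        (p * b i + (1ℚ - p) * a i) * (α i * β i)
          ≤⟨ *-monoˡ {p * b i + (1ℚ - p) * a i} (<⇒≤ (0<* (0<α i) (0<β i))) (≤-by _
               (0≤+ (0≤+ (0≤sq (e i - ½ * ½ * κ)) (0≤* (0≤* 0≤κκ (nonNegative⁻¹ (¼ * ¼))) (0≤-diff (ab≤3 i≤k+1))))
                    (0≤* (0≤* (nonNegative⁻¹ ½) 0≤κ) (0≤-diff p≤)))
               (eq₂ p κ (ι i))) ⟩
        γ * (a i * b i) * (α i * β i)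
          ≡⟨ eq₃ γ (a i) (b i) (α i) (β i) ⟩
        γ * ((a i * α i) * (b i * β i))
          ≡⟨ cong₂ (λ x y → γ * (x * y)) (aα i) (bβ i) ⟩
        γ * (1ℚ * 1ℚ)
          ≡⟨ *-identityʳ γ ⟩
        γ ∎
        where
        open ≤-Reasoning
        eq₁ : ∀ p a b α β → p * (b * β * α) + (1ℚ - p) * (a * α * β) ≡ (p * b + (1ℚ - p) * a) * (α * β)
        eq₁ = solve-∀ ℚ-ring
        eq₃ : ∀ γ a b α β → γ * (a * b) * (α * β) ≡ γ * ((a * α) * (b * β))
        eq₃ = solve-∀ ℚ-ring
        eq₂ : ∀ p κ i → let e = (i + i - 1ℚ) * (κ * κ * (½ * ½)) ; a = 1ℚ - ½ * κ + e ; b = 1ℚ + e in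
          (1ℚ - κ * κ * (½ * ½ * (½ * ½))) * (a * b) ≡
          p * b + (1ℚ - p) * a +
            ((e - ½ * ½ * κ) * (e - ½ * ½ * κ) + κ * κ * (½ * ½ * (½ * ½)) * (1ℚ + 1ℚ + 1ℚ - a * b) + ½ * κ * (i * κ - (p + κ)))
        eq₂ = solve-∀ ℚ-ring

      -- Bernoulli's inequality for 1 + z = 2 - ρ ≤ 1 / ρ.
      ρ^≤½ : ρ ^ (32 ℕ.* (k ℕ.* k)) ≤ ½
      ρ^≤½ = *-cancelˡ-≤ {c = (1ℚ + z) ^ m} (^-pos m 0<1+z) (begin
        (1ℚ + z) ^ m * ρ ^ m     ≡⟨ ^-distrib-* (1ℚ + z) ρ m ⟨
        ((1ℚ + z) * ρ) ^ m       ≤⟨ ^-≤1 m (0≤* (<⇒≤ 0<1+z) 0≤ρ) (≤-by _ (0≤sq z) (eq₁ z)) ⟩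
        1ℚ                       ≡⟨ refl ⟩
        (1ℚ + 1ℚ) * ½            ≤⟨ *-monoˡ (nonNegative⁻¹ ½) (≤-trans (≤-reflexive (cong (1ℚ +_) (sym mz))) (bernoulli z m (<⇒≤ 0<1+z))) ⟩
        (1ℚ + z) ^ m * ½         ∎)
        where
        open ≤-Reasoning
        m : ℕ
        m = 32 ℕ.* (k ℕ.* k)
        z : ℚ
        z = κ * κ * (¼ * ¼) * ½
        0<1+z : 0ℚ < 1ℚ + z
        0<1+z = <-≤-trans (positive⁻¹ 1ℚ) (≤-by z (0≤* (0≤* 0≤κκ (nonNegative⁻¹ (¼ * ¼))) (nonNegative⁻¹ ½)) refl)
        eq₁ : ∀ z → 1ℚ ≡ (1ℚ + z) * (1ℚ - z) + z * z
        eq₁ = solve-∀ ℚ-ring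
        mz : ι m * z ≡ 1ℚ
        mz = trans (cong (_* z) (trans (ι-* 32 (k ℕ.* k)) (cong₂ _*_ (sym (ι≡ 32)) (ι-* k k))))
          (trans (eq (ι k) κ) (trans (cong₂ _*_ kκ kκ) refl))
          where
          eq : ∀ k κ → ℕ→ℚ 32 * (k * k) * (κ * κ * (½ * ½ * (½ * ½)) * ½) ≡ (k * κ) * (k * κ)
          eq = solve-∀ ℚ-ring

    prob-above : ∀ {n} (S : Multiset n) y {i} → i ℕ.≤ cntLe S y → ι i * κ ≤ prob S y
    prob-above S y i≤ = subst (_ ≤_) (sym (prob≡ S y)) (*-monoˡ 0≤κ (ι-mono i≤))

    prob-below : ∀ {n} (S : Multiset n) y {i} → cntLe S y ℕ.< i → prob S y + κ ≤ ι i * κ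
    prob-below S y {i} <i = subst (_≤ ι i * κ) (trans (cong (_* κ) (ι-suc (cntLe S y)))
      (trans (eq (ι (cntLe S y)) κ) (cong (_+ κ) (sym (prob≡ S y))))) (*-monoˡ 0≤κ (ι-mono <i))
      where
      eq : ∀ c κ → (1ℚ + c) * κ ≡ c * κ + κ
      eq = solve-∀ ℚ-ring

  -- Noisy binary search

  𝟙 : Bool → ℚ
  𝟙 b = if b then 1ℚ else 0ℚ

  lt le : ∀ {n} → Fin n → Fin n → ℚ
  lt Y y = 𝟙 (toℕ y ℕ.<ᵇ toℕ Y)
  le Y y = 𝟙 (toℕ y ℕ.<ᵇ suc (toℕ Y))

  -- W is the total weight and l the weight to the left of the remaining positions.
  median : ∀ {n} → ℚ → ℚ → (Fin (suc n) → ℚ) → Fin (suc n)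
  median {zero}  W l w = zero
  median {suc n} W l w with W ≤? (l + w zero) + (l + w zero)
  ... | yes _ = zero
  ... | no  _ = suc (median W (l + w zero) (λ y → w (suc y)))

  IsMedian : ∀ {n} → ℚ → ℚ → (Fin n → ℚ) → Fin n → Set
  IsMedian {n} W l w Y =
    (l + Σ[ fins n ] (λ y → lt Y y * w y)) + (l + Σ[ fins n ] (λ y → lt Y y * w y)) ≤ W ×
    W ≤ (l + Σ[ fins n ] (λ y → le Y y * w y)) + (l + Σ[ fins n ] (λ y → le Y y * w y))

  median-zero : ∀ {n} W l (w : Fin (suc n) → ℚ) → l + l ≤ W → W ≤ (l + w zero) + (l + w zero) → IsMedian W l w zero
  median-zero {n} W l w 2l≤W W≤ =
    subst (λ z → (l + z) + (l + z) ≤ W) (sym (trans (Σ-cong (fins (suc n)) (λ y → *-zeroˡ (w y))) (Σ0 (suc n)))) (subst (_≤ W) (eq₁ l) 2l≤W) ,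
    subst (λ z → W ≤ (l + z) + (l + z)) (sym (trans (Σ-punchIn zero _)
      (trans (cong₂ _+_ (*-identityˡ (w zero)) (trans (Σ-cong (fins n) (λ y → *-zeroˡ (w (suc y)))) (Σ0 n))) (+-identityʳ (w zero))))) W≤
    where
    Σ0 : ∀ n → Σ[ fins n ] (λ _ → 0ℚ) ≡ 0ℚ
    Σ0 n = trans (Σ-const (fins n) 0ℚ) (*-zeroʳ (ι (length (fins n))))
    eq₁ : ∀ l → l + l ≡ (l + 0ℚ) + (l + 0ℚ)
    eq₁ = solve-∀ ℚ-ring

  median-correct : ∀ {n} {W l} (w : Fin (suc n) → ℚ) → (∀ y → 0ℚ ≤ w y) → 0ℚ ≤ l →
    W ≡ l + Σ[ fins (suc n) ] w → l + l ≤ W → IsMedian W l w (median W l w)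
  median-correct {zero} {W} {l} w 0≤w 0≤l W≡ 2l≤W = median-zero W l w 2l≤W
    (subst (_≤ (l + w zero) + (l + w zero)) (sym (trans W≡ (cong (λ z → l + z) (trans (Σ-punchIn zero w)
      (trans (cong (λ z → w zero + z) (Σ-fins0 _)) (+-identityʳ (w zero)))))))
      (≤-by (l + w zero) (0≤+ 0≤l (0≤w zero)) refl))
  median-correct {suc n} {W} {l} w 0≤w 0≤l W≡ 2l≤W with W ≤? (l + w zero) + (l + w zero)
  ... | yes W≤ = median-zero W l w 2l≤W W≤
  ... | no  W≰ = subst (λ z → z + z ≤ W) (shift (lt (suc Y)) refl) (proj₁ ih) , subst (λ z → W ≤ z + z) (shift (le (suc Y)) refl) (proj₂ ih)
    where
    Y = median W (l + w zero) (λ y → w (suc y))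
    ih : IsMedian W (l + w zero) (λ y → w (suc y)) Y
    ih = median-correct (λ y → w (suc y)) (λ y → 0≤w (suc y)) (0≤+ 0≤l (0≤w zero))
      (trans W≡ (trans (cong (λ z → l + z) (Σ-punchIn zero w)) (sym (+-assoc l (w zero) _)))) (<⇒≤ (≰⇒> W≰))
    shift : ∀ (c : Fin (suc (suc n)) → ℚ) → c zero ≡ 1ℚ →
      (l + w zero) + Σ[ fins (suc n) ] (λ y → c (suc y) * w (suc y)) ≡ l + Σ[ fins (suc (suc n)) ] (λ y → c y * w y)
    shift c h = trans (+-assoc l (w zero) _) (cong (λ z → l + z) (sym (trans (Σ-punchIn zero _)
      (cong (_+ Σ[ fins (suc n) ] (λ y → c (suc y) * w (suc y))) (trans (cong (_* w zero) h) (*-identityˡ (w zero)))))))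

  module Search (k : ℕ) .{{_ : NonZero k}} where

    open Querying k
    open Updates k

    -- Only ratios of weights matter, so an answer is taken into account by rescaling the positions
    -- right of the boundary alone.
    reweigh : ∀ {n} → Fin n → ℚ → (Fin n → ℚ) → Fin n → ℚ
    reweigh Y c w y = if toℕ y ℕ.≤ᵇ toℕ Y then w y else c * w y

    reweigh-left : ∀ {n} (Y : Fin n) c w y → toℕ y ℕ.≤ toℕ Y → reweigh Y c w y ≡ w y
    reweigh-left Y c w y y≤Y rewrite dec-true (toℕ y ℕ.≤? toℕ Y) y≤Y = refl

    reweigh-right : ∀ {n} (Y : Fin n) c w y → toℕ Y ℕ.< toℕ y → reweigh Y c w y ≡ c * w y
    reweigh-right Y c w y Y<y rewrite dec-false (toℕ y ℕ.≤? toℕ Y) (ℕ.<⇒≱ Y<y) = refl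

    reweigh-nonNeg : ∀ {n} (Y : Fin n) {c} {w} → 0ℚ ≤ c → (∀ y → 0ℚ ≤ w y) → ∀ y → 0ℚ ≤ reweigh Y c w y
    reweigh-nonNeg Y 0≤c 0≤w y with toℕ y ℕ.≤ᵇ toℕ Y
    ... | true  = 0≤w y
    ... | false = 0≤* 0≤c (0≤w y)

    middle : ∀ {n} → (Fin (suc n) → ℚ) → Fin (suc n)
    middle {n} w = median (Σ[ fins (suc n) ] w) 0ℚ w

    -- Finds the position of the element of rank i + 1, by multiplicative weights.  The
    -- median may carry almost all the weight, so both of its boundaries are queried.
    search : ∀ {n r} → ℕ → (t : ℕ) → (Fin (suc n) → ℚ) → (Fin (suc n) → Tree (suc n) r) → Tree (suc n) (t ℕ.* 2 ℕ.+ r)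
    query-then-search : ∀ {n r} → ℕ → (t : ℕ) → Fin (suc n) → (Fin (suc n) → ℚ) → (Fin (suc n) → Tree (suc n) r) →
                        Tree (suc n) (suc (t ℕ.* 2 ℕ.+ r))

    search i zero    w cont = cont (middle w)
    search i (suc t) w cont = node Y⁻ (query-then-search i t Y (reweigh Y⁻ (a (suc i)) w) cont)
                                      (query-then-search i t Y (reweigh Y⁻ (b (suc i)) w) cont)
      where
      Y = middle w
      Y⁻ = Fin.pred Y

    query-then-search i t Y w cont = node Y (search i t (reweigh Y (a (suc i)) w) cont) (search i t (reweigh Y (b (suc i)) w) cont)

    module _ {n} (S : Multiset n) (ΣS : Vec.sum S ≡ k) where

      hit≤1 : ∀ {q} m (T : Tree n q) → hit S m T ≤ 1ℚ
      hit≤1 m (leaf m′) with Vec.≡-dec ℕ._≟_ m′ m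
      ... | yes _ = ≤-refl
      ... | no  _ = nonNegative⁻¹ 1ℚ
      hit≤1 m (node y l r) = ≤-trans
        (+-mono-≤ (*-monoʳ (0≤prob S ΣS y) (hit≤1 m l)) (*-monoʳ (0≤1-prob S ΣS y) (hit≤1 m r)))
        (≤-reflexive (eq (prob S y)))
        where
        eq : ∀ p → p * 1ℚ + (1ℚ - p) * 1ℚ ≡ 1ℚ
        eq = solve-∀ ℚ-ring

    record IsRank {n} (S : Multiset n) (i : ℕ) (x : Fin n) : Set where
      field
        below : ∀ y → toℕ y ℕ.< toℕ x → cntLe S y ℕ.≤ i
        above : ∀ y → toℕ x ℕ.≤ toℕ y → i ℕ.< cntLe S y

    module _ {n} (S : Multiset (suc n)) (ΣS : Vec.sum S ≡ k) {i} (i<k : i ℕ.< k) {x : Fin (suc n)} (rank : IsRank S i x) where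

      open IsRank rank

      private
        N = fins (suc n)
        A = a (suc i)
        B = b (suc i)
        succeed : ∀ {q} → Tree (suc n) q → ℚ
        succeed = hit S S

      -- Bounds the expected factor by which w y / w x changes in a query at Y. The `xor` says that
      -- the boundary lies between y and the true position x.
      factor : Fin (suc n) → Fin (suc n) → ℚ
      factor Y y = if (toℕ y ℕ.≤ᵇ toℕ Y) xor (toℕ x ℕ.≤ᵇ toℕ Y) then γ else 1ℚ

      factor≤1 : ∀ Y y → factor Y y ≤ 1ℚ
      factor≤1 Y y with (toℕ y ℕ.≤ᵇ toℕ Y) xor (toℕ x ℕ.≤ᵇ toℕ Y)
      ... | true  = γ≤1
      ... | false = ≤-refl

      0≤factor : ∀ Y y → 0ℚ ≤ factor Y y
      0≤factor Y y with (toℕ y ℕ.≤ᵇ toℕ Y) xor (toℕ x ℕ.≤ᵇ toℕ Y)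
      ... | true  = 0≤γ
      ... | false = nonNegative⁻¹ 1ℚ

      factor-right : ∀ {Y y} → toℕ x ℕ.≤ toℕ Y → toℕ Y ℕ.< toℕ y → factor Y y ≡ γ
      factor-right {Y} {y} x≤Y Y<y rewrite dec-true (toℕ x ℕ.≤? toℕ Y) x≤Y | dec-false (toℕ y ℕ.≤? toℕ Y) (ℕ.<⇒≱ Y<y) = refl

      factor-left : ∀ {Y y} → toℕ Y ℕ.< toℕ x → toℕ y ℕ.≤ toℕ Y → factor Y y ≡ γ
      factor-left {Y} {y} Y<x y≤Y rewrite dec-false (toℕ x ℕ.≤? toℕ Y) (ℕ.<⇒≱ Y<x) | dec-true (toℕ y ℕ.≤? toℕ Y) y≤Y = refl

      factor-same : ∀ {Y y} → toℕ x ℕ.≤ toℕ Y → toℕ y ℕ.≤ toℕ Y → factor Y y ≡ 1ℚ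
      factor-same {Y} {y} x≤Y y≤Y rewrite dec-true (toℕ x ℕ.≤? toℕ Y) x≤Y | dec-true (toℕ y ℕ.≤? toℕ Y) y≤Y = refl

      factor-same′ : ∀ {Y y} → toℕ Y ℕ.< toℕ x → toℕ Y ℕ.< toℕ y → factor Y y ≡ 1ℚ
      factor-same′ {Y} {y} Y<x Y<y rewrite dec-false (toℕ x ℕ.≤? toℕ Y) (ℕ.<⇒≱ Y<x) | dec-false (toℕ y ℕ.≤? toℕ Y) (ℕ.<⇒≱ Y<y) = refl

      -- The potential is measured relative to the weight of x, which an answer may rescale; f₁ and
      -- f₂ undo this rescaling. σ is the success probability when x is known, and c collects the
      -- factors still to come from later queries.
      combine : ∀ {q} Y (w : Fin (suc n) → ℚ) (l r : Tree (suc n) q) σ (c u₁ u₂ : Fin (suc n) → ℚ) {f₁ f₂} → 0ℚ ≤ f₁ → 0ℚ ≤ f₂ → (∀ y → 0ℚ ≤ c y) →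
        w x ≡ f₁ * u₁ x → w x ≡ f₂ * u₂ x →
        (∀ y → prob S Y * (f₁ * u₁ y) + (1ℚ - prob S Y) * (f₂ * u₂ y) ≤ factor Y y * w y) →
        u₁ x * (σ - succeed l) ≤ Σ[ N ] (λ y → c y * u₁ y) →
        u₂ x * (σ - succeed r) ≤ Σ[ N ] (λ y → c y * u₂ y) →
        w x * (σ - succeed (node Y l r)) ≤ Σ[ N ] (λ y → factor Y y * c y * w y)
      combine Y w l r σ c u₁ u₂ {f₁} {f₂} 0≤f₁ 0≤f₂ 0≤c w≡₁ w≡₂ pointwise hl hr = begin
        w x * (σ - (p * succeed l + (1ℚ - p) * succeed r))
          ≡⟨ eq₁ (w x) σ p (succeed l) (succeed r) ⟩
        p * (w x * (σ - succeed l)) + (1ℚ - p) * (w x * (σ - succeed r))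
          ≡⟨ cong₂ (λ v v′ → p * (v * (σ - succeed l)) + (1ℚ - p) * (v′ * (σ - succeed r))) w≡₁ w≡₂ ⟩
        p * (f₁ * u₁ x * (σ - succeed l)) + (1ℚ - p) * (f₂ * u₂ x * (σ - succeed r))
          ≡⟨ cong₂ (λ v v′ → p * v + (1ℚ - p) * v′) (*-assoc f₁ (u₁ x) _) (*-assoc f₂ (u₂ x) _) ⟩
        p * (f₁ * (u₁ x * (σ - succeed l))) + (1ℚ - p) * (f₂ * (u₂ x * (σ - succeed r)))
          ≤⟨ +-mono-≤ (*-monoʳ (0≤prob S ΣS Y) (*-monoʳ 0≤f₁ hl)) (*-monoʳ (0≤1-prob S ΣS Y) (*-monoʳ 0≤f₂ hr)) ⟩
        p * (f₁ * Σ[ N ] (λ y → c y * u₁ y)) + (1ℚ - p) * (f₂ * Σ[ N ] (λ y → c y * u₂ y))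
          ≡⟨ cong₂ _+_ (pull p f₁ u₁) (pull (1ℚ - p) f₂ u₂) ⟩
        Σ[ N ] (λ y → p * (f₁ * (c y * u₁ y))) + Σ[ N ] (λ y → (1ℚ - p) * (f₂ * (c y * u₂ y)))
          ≡⟨ Σ-+ N _ _ ⟨
        Σ[ N ] (λ y → p * (f₁ * (c y * u₁ y)) + (1ℚ - p) * (f₂ * (c y * u₂ y)))
          ≤⟨ Σ-mono N (λ y → ≤-trans (≤-reflexive (eq₂ (c y) p f₁ (u₁ y) f₂ (u₂ y)))
               (≤-trans (*-monoʳ (0≤c y) (pointwise y)) (≤-reflexive (eq₃ (c y) (factor Y y) (w y))))) ⟩
        Σ[ N ] (λ y → factor Y y * c y * w y) ∎
        where
        open ≤-Reasoning
        p = prob S Y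
        pull : ∀ p f (u : Fin (suc n) → ℚ) → p * (f * Σ[ N ] (λ y → c y * u y)) ≡ Σ[ N ] (λ y → p * (f * (c y * u y)))
        pull p f u = sym (trans (Σ-*ˡ N p _) (cong (p *_) (Σ-*ˡ N f _)))
        eq₁ : ∀ w σ p l r → w * (σ - (p * l + (1ℚ - p) * r)) ≡ p * (w * (σ - l)) + (1ℚ - p) * (w * (σ - r))
        eq₁ = solve-∀ ℚ-ring
        eq₂ : ∀ c p f u g v → p * (f * (c * u)) + (1ℚ - p) * (g * (c * v)) ≡ c * (p * (f * u) + (1ℚ - p) * (g * v))
        eq₂ = solve-∀ ℚ-ring
        eq₃ : ∀ c f w → c * (f * w) ≡ f * c * w
        eq₃ = solve-∀ ℚ-ring

      -- If x ≤ Y, the weight of x stays, and positions beyond Y are multiplied by a or b. If Y < x,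
      -- the weight of x is itself multiplied, so relative to it the positions up to Y gain the
      -- inverses α or β. The index `suc i` fits both cases: the count at Y is at least i + 1 in the
      -- first and at most i in the second, one on each side of the threshold.
      query : ∀ {q} Y (w : Fin (suc n) → ℚ) (l r : Tree (suc n) q) σ (c : Fin (suc n) → ℚ) → (∀ y → 0ℚ ≤ c y) → (∀ y → 0ℚ ≤ w y) →
        reweigh Y A w x * (σ - succeed l) ≤ Σ[ N ] (λ y → c y * reweigh Y A w y) →
        reweigh Y B w x * (σ - succeed r) ≤ Σ[ N ] (λ y → c y * reweigh Y B w y) →
        w x * (σ - succeed (node Y l r)) ≤ Σ[ N ] (λ y → factor Y y * c y * w y)
      query Y w l r σ c 0≤c 0≤w hl hr with ℕ.≤-<-connex (toℕ x) (toℕ Y)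
      ... | inj₁ x≤Y = combine Y w l r σ c (reweigh Y A w) (reweigh Y B w) (nonNegative⁻¹ 1ℚ) (nonNegative⁻¹ 1ℚ) 0≤c
        (sym (trans (*-identityˡ _) (reweigh-left Y A w x x≤Y))) (sym (trans (*-identityˡ _) (reweigh-left Y B w x x≤Y)))
        pointwise hl hr
        where
        p = prob S Y
        pointwise : ∀ y → p * (1ℚ * reweigh Y A w y) + (1ℚ - p) * (1ℚ * reweigh Y B w y) ≤ factor Y y * w y
        pointwise y with ℕ.≤-<-connex (toℕ y) (toℕ Y)
        ... | inj₁ y≤Y rewrite reweigh-left Y A w y y≤Y | reweigh-left Y B w y y≤Y | factor-same x≤Y y≤Y = ≤-reflexive (eq p (w y))
          where
          eq : ∀ p w → p * (1ℚ * w) + (1ℚ - p) * (1ℚ * w) ≡ 1ℚ * w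
          eq = solve-∀ ℚ-ring
        ... | inj₂ Y<y rewrite reweigh-right Y A w y Y<y | reweigh-right Y B w y Y<y | factor-right x≤Y Y<y = ≤-trans
          (≤-reflexive (eq p (w y) A B)) (*-monoˡ (0≤w y) (contract-above (suc i) (prob-above S Y (above Y x≤Y))))
          where
          eq : ∀ p w a b → p * (1ℚ * (a * w)) + (1ℚ - p) * (1ℚ * (b * w)) ≡ (p * a + (1ℚ - p) * b) * w
          eq = solve-∀ ℚ-ring
      ... | inj₂ Y<x = combine Y w l r σ c (reweigh Y A w) (reweigh Y B w) (<⇒≤ (0<α (suc i))) (<⇒≤ (0<β (suc i))) 0≤c
        (trans (cancel A (α (suc i)) (aα (suc i)) (w x)) (cong (α (suc i) *_) (sym (reweigh-right Y A w x Y<x))))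
        (trans (cancel B (β (suc i)) (bβ (suc i)) (w x)) (cong (β (suc i) *_) (sym (reweigh-right Y B w x Y<x))))
        pointwise hl hr
        where
        p = prob S Y
        cancel : ∀ a α → a * α ≡ 1ℚ → ∀ w → w ≡ α * (a * w)
        cancel a α aα w = trans (sym (*-identityˡ w)) (trans (cong (_* w) (sym aα)) (eq a α w))
          where
          eq : ∀ a α w → a * α * w ≡ α * (a * w)
          eq = solve-∀ ℚ-ring
        pointwise : ∀ y → p * (α (suc i) * reweigh Y A w y) + (1ℚ - p) * (β (suc i) * reweigh Y B w y) ≤ factor Y y * w y
        pointwise y with ℕ.≤-<-connex (toℕ y) (toℕ Y)
        ... | inj₁ y≤Y rewrite reweigh-left Y A w y y≤Y | reweigh-left Y B w y y≤Y | factor-left Y<x y≤Y = ≤-trans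
          (≤-reflexive (eq p (w y) (α (suc i)) (β (suc i))))
          (*-monoˡ (0≤w y) (contract-below {p} (suc i) (ℕ.s≤s (ℕ.<⇒≤ i<k)) (prob-below S Y (ℕ.s≤s (below Y Y<x)))))
          where
          eq : ∀ p w a b → p * (a * w) + (1ℚ - p) * (b * w) ≡ (p * a + (1ℚ - p) * b) * w
          eq = solve-∀ ℚ-ring
        ... | inj₂ Y<y rewrite reweigh-right Y A w y Y<y | reweigh-right Y B w y Y<y | factor-same′ Y<x Y<y = ≤-reflexive (trans
          (cong₂ (λ a b → p * a + (1ℚ - p) * b) (sym (cancel A (α (suc i)) (aα (suc i)) (w y))) (sym (cancel B (β (suc i)) (bβ (suc i)) (w y)))) (eq p (w y)))
          where
          eq : ∀ p w → p * w + (1ℚ - p) * w ≡ 1ℚ * w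
          eq = solve-∀ ℚ-ring

      other : Fin (suc n) → ℚ
      other y = if does (y Fin.≟ x) then 0ℚ else 1ℚ

      other-≢ : ∀ {y} → y ≢ x → other y ≡ 1ℚ
      other-≢ {y} y≢x rewrite dec-false (y Fin.≟ x) y≢x = refl

      other-x : other x ≡ 0ℚ
      other-x rewrite dec-true (x Fin.≟ x) refl = refl

      0≤other : ∀ y → 0ℚ ≤ other y
      0≤other y with does (y Fin.≟ x)
      ... | true  = ≤-refl
      ... | false = nonNegative⁻¹ 1ℚ

      total : ∀ w → Σ[ N ] w ≡ w x + Σ[ N ] (λ y → other y * w y)
      total w = trans (Σ-punchIn x w) (cong (λ z → w x + z) (sym (trans (Σ-punchIn x _) (trans
        (cong₂ _+_ (trans (cong (_* w x) other-x) (*-zeroˡ (w x)))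
                   (Σ-cong (fins n) (λ i → trans (cong (_* w (punchIn x i)) (other-≢ (λ e → Fin.punchInᵢ≢i x i e))) (*-identityˡ _))))
        (+-identityˡ _)))))

      lt-1 : ∀ {Y y : Fin (suc n)} → toℕ y ℕ.< toℕ Y → lt Y y ≡ 1ℚ
      lt-1 {Y} {y} h = cong 𝟙 (dec-true (toℕ y ℕ.<? toℕ Y) h)

      lt-0 : ∀ {Y y : Fin (suc n)} → toℕ Y ℕ.≤ toℕ y → lt Y y ≡ 0ℚ
      lt-0 {Y} {y} h = cong 𝟙 (dec-false (toℕ y ℕ.<? toℕ Y) (ℕ.≤⇒≯ h))

      le-1 : ∀ {Y y : Fin (suc n)} → toℕ y ℕ.≤ toℕ Y → le Y y ≡ 1ℚ
      le-1 {Y} {y} h = cong 𝟙 (dec-true (toℕ y ℕ.<? suc (toℕ Y)) (ℕ.s≤s h))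

      le-0 : ∀ {Y y : Fin (suc n)} → toℕ Y ℕ.< toℕ y → le Y y ≡ 0ℚ
      le-0 {Y} {y} h = cong 𝟙 (dec-false (toℕ y ℕ.<? suc (toℕ Y)) (ℕ.≤⇒≯ h))

      ≢x : ∀ {y : Fin (suc n)} → toℕ y ≢ toℕ x → y ≢ x
      ≢x h refl = h refl

      pred-≥ : ∀ {Y : Fin (suc n)} {m} → m ℕ.< toℕ Y → m ℕ.≤ toℕ (Fin.pred Y)
      pred-≥ {suc Y} (ℕ.s≤s h) = subst (_ ℕ.≤_) (sym (Fin.toℕ-inject₁ Y)) h

      pred-< : ∀ {Y : Fin (suc n)} {m} → m ℕ.< toℕ Y → toℕ (Fin.pred Y) ℕ.< toℕ Y
      pred-< {suc Y} _ = ℕ.s≤s (ℕ.≤-reflexive (Fin.toℕ-inject₁ Y))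

      module _ (w : Fin (suc n) → ℚ) (0≤w : ∀ y → 0ℚ ≤ w y) where

        private
          Y Y⁻ : Fin (suc n)
          Y = middle w
          Y⁻ = Fin.pred Y
          W Φ L E : ℚ
          W = Σ[ N ] w
          Φ = Σ[ N ] (λ y → other y * w y)
          L = Σ[ N ] (λ y → lt Y y * w y)
          E = Σ[ N ] (λ y → le Y y * w y)
          F : Fin (suc n) → ℚ
          F y = factor Y⁻ y * factor Y y

        isMedian : IsMedian W 0ℚ w Y
        isMedian = median-correct w 0≤w ≤-refl (sym (+-identityˡ W)) (subst (_≤ W) (sym (+-identityʳ 0ℚ)) (Σ-nonNeg N 0≤w))

        2L≤W : L + L ≤ W
        2L≤W = subst (λ z → z + z ≤ W) (+-identityˡ L) (proj₁ isMedian)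

        W≤2E : W ≤ E + E
        W≤2E = subst (λ z → W ≤ z + z) (+-identityˡ E) (proj₂ isMedian)

        single : ∀ (f : Fin (suc n) → ℚ) → (∀ y → 0ℚ ≤ f y) → f x ≤ Σ[ N ] f
        single f 0≤f = subst (f x ≤_) (sym (Σ-punchIn x f)) (≤-by _ (Σ-nonNeg (fins n) (λ i → 0≤f (punchIn x i))) refl)

        Σ-1- : ∀ (c : Fin (suc n) → ℚ) → Σ[ N ] (λ y → (1ℚ - c y) * w y) ≡ W - Σ[ N ] (λ y → c y * w y)
        Σ-1- c = trans (Σ-cong N (λ y → eq (c y) (w y))) (trans (Σ-+ N _ _) (cong (λ z → W + z) (trans (Σ-*ˡ N (- 1ℚ) _) (eq′ _))))
          where
          eq : ∀ c w → (1ℚ - c) * w ≡ w + (- 1ℚ) * (c * w)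
          eq = solve-∀ ℚ-ring
          eq′ : ∀ c → (- 1ℚ) * c ≡ - c
          eq′ = solve-∀ ℚ-ring

        0≤1-𝟙 : ∀ b → 0ℚ ≤ 1ℚ - 𝟙 b
        0≤1-𝟙 true  = ≤-refl
        0≤1-𝟙 false = nonNegative⁻¹ 1ℚ

        0≤𝟙 : ∀ b → 0ℚ ≤ 𝟙 b
        0≤𝟙 true  = nonNegative⁻¹ 1ℚ
        0≤𝟙 false = ≤-refl

        2wx≤W⇒wx≤Φ : w x + w x ≤ W → w x ≤ Φ
        2wx≤W⇒wx≤Φ h = ≤-by (W - (w x + w x)) (0≤-diff h) (trans (eq (w x) Φ) (cong (λ z → w x + (z - (w x + w x))) (sym (total w))))
          where
          eq : ∀ w Φ → Φ ≡ w + (w + Φ - (w + w))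
          eq = solve-∀ ℚ-ring

        -- Strictly left or strictly right of the median lies at most half of the total weight, and
        -- x is on one of these sides. This makes Φ / w x at least 1 whenever the search ends at a
        -- wrong position.
        wrong-median : Y ≢ x → w x ≤ Φ
        wrong-median Y≢x with ℕ.<-cmp (toℕ x) (toℕ Y)
        ... | tri< x<Y _ _ = 2wx≤W⇒wx≤Φ (≤-trans (+-mono-≤ wx≤L wx≤L) 2L≤W)
          where
          wx≤L : w x ≤ L
          wx≤L = ≤-trans (≤-reflexive (trans (sym (*-identityˡ (w x))) (cong (_* w x) (sym (lt-1 x<Y)))))
            (single (λ y → lt Y y * w y) (λ y → 0≤* (0≤𝟙 (toℕ y ℕ.<ᵇ toℕ Y)) (0≤w y)))
        ... | tri≈ _ x≡Y _ = contradiction (sym (Fin.toℕ-injective x≡Y)) Y≢x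
        ... | tri> _ _ Y<x = 2wx≤W⇒wx≤Φ (≤-trans (+-mono-≤ wx≤ wx≤) (≤-by (E + E - W) (0≤-diff W≤2E) (eq W E)))
          where
          wx≤ : w x ≤ W - E
          wx≤ = ≤-trans (≤-reflexive (trans (sym (*-identityˡ (w x))) (cong (λ z → (1ℚ - z) * w x) (sym (le-0 Y<x)))))
            (≤-trans (single (λ y → (1ℚ - le Y y) * w y) (λ y → 0≤* (0≤1-𝟙 (toℕ y ℕ.<ᵇ suc (toℕ Y))) (0≤w y))) (≤-reflexive (Σ-1- (le Y))))
          eq : ∀ W E → W ≡ W - E + (W - E) + (E + E - W)
          eq = solve-∀ ℚ-ring

        F≤γ₁ : ∀ y → factor Y⁻ y ≡ γ → F y ≤ γ
        F≤γ₁ y h = ≤-trans (*-mono 0≤γ (0≤factor Y y) (≤-reflexive h) (factor≤1 Y y)) (≤-reflexive (*-identityʳ γ))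

        F≤γ₂ : ∀ y → factor Y y ≡ γ → F y ≤ γ
        F≤γ₂ y h = ≤-trans (*-mono (nonNegative⁻¹ 1ℚ) (0≤factor Y y) (factor≤1 Y⁻ y) (≤-reflexive h)) (≤-reflexive (*-identityˡ γ))

        F≤1 : ∀ y → F y ≤ 1ℚ
        F≤1 y = ≤-trans (*-mono (nonNegative⁻¹ 1ℚ) (0≤factor Y y) (factor≤1 Y⁻ y) (factor≤1 Y y)) ≤-refl

        F*other≤ : ∀ {f} y → F y ≤ f → F y * other y ≤ f * other y
        F*other≤ y = *-monoˡ (0≤other y)

        -- A boundary with x on one side and mass m ≥ W / 2, given by the coefficients c, on the other.
        cut : ∀ (c : Fin (suc n) → ℚ) → (∀ y → c y ≡ 0ℚ ⊎ (c y ≡ 1ℚ × y ≢ x × F y ≤ γ)) →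
              W ≤ Σ[ N ] (λ y → c y * w y) + Σ[ N ] (λ y → c y * w y) → Σ[ N ] (λ y → F y * other y * w y) ≤ ρ * Φ
        cut c hc W≤2m = begin
          Σ[ N ] (λ y → F y * other y * w y)
            ≤⟨ Σ-mono N (λ y → *-monoˡ (0≤w y) (pointwise y (hc y))) ⟩
          Σ[ N ] (λ y → (other y + - (1ℚ - γ) * c y) * w y)
            ≡⟨ trans (Σ-cong N (λ y → eq (other y) (1ℚ - γ) (c y) (w y))) (trans (Σ-+ N _ _) (cong (λ z → Φ + z) (Σ-*ˡ N (- (1ℚ - γ)) _))) ⟩
          Φ + - (1ℚ - γ) * m
            ≤⟨ ≤-by ((1ℚ - γ) * ½ * ((m + m - W) + w x)) (0≤* (0≤* (0≤-diff γ≤1) (nonNegative⁻¹ ½)) (0≤+ (0≤-diff W≤2m) (0≤w x)))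
                 (trans (eq₂ Φ γ m (w x)) (cong (λ z → Φ + - (1ℚ - γ) * m + (1ℚ - γ) * ½ * ((m + m - z) + w x)) (sym (total w)))) ⟩
          (1ℚ - (1ℚ - γ) * ½) * Φ
            ≡⟨ cong (_* Φ) (sym ρ≡) ⟩
          ρ * Φ ∎
          where
          open ≤-Reasoning
          m = Σ[ N ] (λ y → c y * w y)
          pointwise : ∀ y → c y ≡ 0ℚ ⊎ (c y ≡ 1ℚ × y ≢ x × F y ≤ γ) → F y * other y ≤ other y + - (1ℚ - γ) * c y
          pointwise y (inj₁ c≡0) = ≤-trans (F*other≤ y (F≤1 y)) (≤-reflexive (trans (e₁ (other y) γ) (cong (λ z → other y + - (1ℚ - γ) * z) (sym c≡0))))
            where
            e₁ : ∀ o γ → 1ℚ * o ≡ o + - (1ℚ - γ) * 0ℚ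
            e₁ = solve-∀ ℚ-ring
          pointwise y (inj₂ (c≡1 , y≢x , F≤γ)) = ≤-trans (F*other≤ y F≤γ) (≤-reflexive (trans (cong (γ *_) (other-≢ y≢x))
            (trans (e₂ γ) (cong₂ (λ o z → o + - (1ℚ - γ) * z) (sym (other-≢ y≢x)) (sym c≡1)))))
            where
            e₂ : ∀ γ → γ * 1ℚ ≡ 1ℚ + - (1ℚ - γ) * 1ℚ
            e₂ = solve-∀ ℚ-ring
          eq : ∀ o g c w → (o + - g * c) * w ≡ o * w + - g * (c * w)
          eq = solve-∀ ℚ-ring
          eq₂ : ∀ Φ γ m w → (1ℚ - (1ℚ - γ) * ½) * Φ ≡ Φ + - (1ℚ - γ) * m + (1ℚ - γ) * ½ * ((m + m - (w + Φ)) + w)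
          eq₂ = solve-∀ ℚ-ring

        -- If x < Y, the boundary before the median separates x from Y and everything to its right;
        -- if Y < x, the boundary after it separates x from Y and everything to its left. Either
        -- part has at least half of the total weight.
        two-queries : Σ[ N ] (λ y → F y * other y * w y) ≤ ρ * Φ
        two-queries with ℕ.<-cmp (toℕ x) (toℕ Y)
        ... | tri< x<Y _ _ = cut (λ y → 1ℚ - lt Y y) side
          (subst (λ z → W ≤ z + z) (sym (Σ-1- (lt Y))) (≤-by (W - (L + L)) (0≤-diff 2L≤W) (eq W L)))
          where
          eq : ∀ W L → W - L + (W - L) ≡ W + (W - (L + L))
          eq = solve-∀ ℚ-ring
          side : ∀ y → 1ℚ - lt Y y ≡ 0ℚ ⊎ (1ℚ - lt Y y ≡ 1ℚ × y ≢ x × F y ≤ γ)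
          side y with ℕ.≤-<-connex (toℕ Y) (toℕ y)
          ... | inj₁ Y≤y = inj₂ (cong (λ z → 1ℚ - z) (lt-0 Y≤y) , ≢x (λ e → ℕ.<⇒≢ (ℕ.<-≤-trans x<Y Y≤y) (sym e)) ,
            F≤γ₁ y (factor-right (pred-≥ x<Y) (ℕ.<-≤-trans (pred-< x<Y) Y≤y)))
          ... | inj₂ y<Y = inj₁ (cong (λ z → 1ℚ - z) (lt-1 y<Y))
        ... | tri> _ _ Y<x = cut (le Y) side W≤2E
          where
          side : ∀ y → le Y y ≡ 0ℚ ⊎ (le Y y ≡ 1ℚ × y ≢ x × F y ≤ γ)
          side y with ℕ.≤-<-connex (toℕ y) (toℕ Y)
          ... | inj₁ y≤Y = inj₂ (le-1 y≤Y , ≢x (ℕ.<⇒≢ (ℕ.≤-<-trans y≤Y Y<x)) , F≤γ₂ y (factor-left Y<x y≤Y))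
          ... | inj₂ Y<y = inj₁ (le-0 Y<y)
        -- No half of the weight need lie on one side now, but every other position is cut off from
        -- x by one of the two boundaries. When Y is the first position, `Fin.pred` repeats it, and
        -- nothing lies to its left.
        ... | tri≈ _ x≡Y _ = begin
          Σ[ N ] (λ y → F y * other y * w y)   ≤⟨ Σ-mono N (λ y → *-monoˡ (0≤w y) (pointwise y)) ⟩
          Σ[ N ] (λ y → γ * other y * w y)     ≡⟨ trans (Σ-cong N (λ y → *-assoc γ (other y) (w y))) (Σ-*ˡ N γ _) ⟩
          γ * Φ                                ≤⟨ *-monoˡ (Σ-nonNeg N (λ y → 0≤* (0≤other y) (0≤w y))) γ≤ρ ⟩
          ρ * Φ                                ∎
          where
          open ≤-Reasoning
          pointwise : ∀ y → F y * other y ≤ γ * other y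
          pointwise y with ℕ.<-cmp (toℕ y) (toℕ Y)
          ... | tri< y<Y _ _ = F*other≤ y (F≤γ₁ y (factor-left (subst (toℕ (Fin.pred Y) ℕ.<_) (sym x≡Y) (pred-< y<Y)) (pred-≥ y<Y)))
          ... | tri> _ _ Y<y = F*other≤ y (F≤γ₂ y (factor-right (ℕ.≤-reflexive x≡Y) Y<y))
          ... | tri≈ _ y≡Y _ = ≤-reflexive (trans (cong (F y *_) o≡0) (trans (*-zeroʳ (F y)) (sym (trans (cong (γ *_) o≡0) (*-zeroʳ γ)))))
            where
            o≡0 : other y ≡ 0ℚ
            o≡0 = trans (cong other (Fin.toℕ-injective (trans y≡Y (sym x≡Y)))) other-x

      -- Markov's inequality for the potential Φ / w x, multiplied out: a wrong result costs at most
      -- 1, hence at most the final potential, whose expectation shrinks by ρ with every pair of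
      -- queries.
      search-correct : ∀ t w → (∀ y → 0ℚ ≤ w y) → ∀ {r} (cont : Fin (suc n) → Tree (suc n) r) →
        w x * (succeed (cont x) - succeed (search i t w cont)) ≤ Σ[ N ] (λ y → ρ ^ t * other y * w y)
      search-correct zero w 0≤w cont with middle w Fin.≟ x
      ... | yes e = ≤-trans (≤-reflexive (trans (cong (λ z → w x * (succeed (cont x) - succeed (cont z))) e) (eq (w x) (succeed (cont x)))))
          (Σ-nonNeg N (λ y → 0≤* (0≤* (nonNegative⁻¹ 1ℚ) (0≤other y)) (0≤w y)))
        where
        eq : ∀ w s → w * (s - s) ≡ 0ℚ
        eq = solve-∀ ℚ-ring
      ... | no  m≢x = begin
        w x * (succeed (cont x) - succeed (cont (middle w)))
          ≤⟨ *-monoʳ (0≤w x) (+-mono-≤ (hit≤1 S ΣS S (cont x)) (neg-antimono-≤ (0≤hit S ΣS S (cont (middle w))))) ⟩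
        w x * (1ℚ - 0ℚ)
          ≡⟨ *-identityʳ (w x) ⟩
        w x
          ≤⟨ wrong-median w 0≤w m≢x ⟩
        Σ[ N ] (λ y → other y * w y)
          ≡⟨ Σ-cong N (λ y → cong (_* w y) (sym (*-identityˡ (other y)))) ⟩
        Σ[ N ] (λ y → 1ℚ * other y * w y) ∎
        where open ≤-Reasoning
      search-correct (suc t) w 0≤w cont = begin
        w x * (succeed (cont x) - succeed (search i (suc t) w cont))
          ≤⟨ query Y⁻ w (query-then-search i t Y (reweigh Y⁻ A w) cont) (query-then-search i t Y (reweigh Y⁻ B w) cont) σ (λ y → factor Y y * c y) (λ y → 0≤* (0≤factor Y y) (0≤c y)) 0≤w
               (first (<⇒≤ (0<a (suc i)))) (first (<⇒≤ (0<b (suc i)))) ⟩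
        Σ[ N ] (λ y → factor Y⁻ y * (factor Y y * c y) * w y)
          ≡⟨ trans (Σ-cong N (λ y → eq (factor Y⁻ y) (factor Y y) (ρ ^ t) (other y) (w y))) (Σ-*ˡ N (ρ ^ t) _) ⟩
        ρ ^ t * Σ[ N ] (λ y → factor Y⁻ y * factor Y y * other y * w y)
          ≤⟨ *-monoʳ (^-nonNeg t 0≤ρ) (two-queries w 0≤w) ⟩
        ρ ^ t * (ρ * Σ[ N ] (λ y → other y * w y))
          ≡⟨ eq₂ (ρ ^ t) ρ _ ⟩
        ρ ^ suc t * Σ[ N ] (λ y → other y * w y)
          ≡⟨ trans (sym (Σ-*ˡ N (ρ ^ suc t) _)) (Σ-cong N (λ y → sym (*-assoc (ρ ^ suc t) (other y) (w y)))) ⟩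
        Σ[ N ] (λ y → ρ ^ suc t * other y * w y) ∎
        where
        open ≤-Reasoning
        Y Y⁻ : Fin (suc n)
        Y = middle w
        Y⁻ = Fin.pred Y
        σ = succeed (cont x)
        c : Fin (suc n) → ℚ
        c y = ρ ^ t * other y
        0≤c : ∀ y → 0ℚ ≤ c y
        0≤c y = 0≤* (^-nonNeg t 0≤ρ) (0≤other y)
        -- Both queries of a pair use the median of the weights before the pair, so their factors
        -- refer to the same Y and simply multiply, as `two-queries` requires.
        first : ∀ {d} → 0ℚ ≤ d → reweigh Y⁻ d w x *
          (σ - succeed (query-then-search i t Y (reweigh Y⁻ d w) cont)) ≤
          Σ[ N ] (λ y → factor Y y * c y * reweigh Y⁻ d w y)
        first {d} 0≤d = query Y w₁ (search i t (reweigh Y A w₁) cont) (search i t (reweigh Y B w₁) cont) σ c 0≤c 0≤w₁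
          (search-correct t _ (reweigh-nonNeg Y (<⇒≤ (0<a (suc i))) 0≤w₁) cont)
          (search-correct t _ (reweigh-nonNeg Y (<⇒≤ (0<b (suc i))) 0≤w₁) cont)
          where
          w₁ = reweigh Y⁻ d w
          0≤w₁ = reweigh-nonNeg Y⁻ 0≤d 0≤w
        eq : ∀ f g r o w → f * (g * (r * o)) * w ≡ r * (f * g * o * w)
        eq = solve-∀ ℚ-ring
        eq₂ : ∀ r ρ x → r * (ρ * x) ≡ ρ * r * x
        eq₂ = solve-∀ ℚ-ring

      search-error : ∀ t {r} (cont : Fin (suc n) → Tree (suc n) r) →
        succeed (cont x) - succeed (search i t (λ _ → 1ℚ) cont) ≤ ρ ^ t * ι (suc n)
      search-error t cont = begin
        succeed (cont x) - succeed (search i t (λ _ → 1ℚ) cont)       ≡⟨ *-identityˡ _ ⟨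
        1ℚ * (succeed (cont x) - succeed (search i t (λ _ → 1ℚ) cont)) ≤⟨ search-correct t (λ _ → 1ℚ) (λ _ → nonNegative⁻¹ 1ℚ) cont ⟩
        Σ[ N ] (λ y → ρ ^ t * other y * 1ℚ)                           ≤⟨ Σ-mono N (λ y → *-monoˡ (nonNegative⁻¹ 1ℚ)
                                                                         (*-monoʳ (^-nonNeg t 0≤ρ) (other≤1 y))) ⟩
        Σ[ N ] (λ _ → ρ ^ t * 1ℚ * 1ℚ)                                ≡⟨ trans (Σ-const N _) (trans (cong (λ m → ι m * (ρ ^ t * 1ℚ * 1ℚ)) (length-fins (suc n))) (eq (ι (suc n)) (ρ ^ t))) ⟩
        ρ ^ t * ι (suc n)                                             ∎
        where
        open ≤-Reasoning
        other≤1 : ∀ y → other y ≤ 1ℚ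
        other≤1 y with does (y Fin.≟ x)
        ... | true  = nonNegative⁻¹ 1ℚ
        ... | false = ≤-refl
        eq : ∀ n r → n * (r * 1ℚ * 1ℚ) ≡ r * n
        eq = solve-∀ ℚ-ring

  -- The upper bounds

  module Estimate (k : ℕ) .{{_ : NonZero k}} where

    open Querying k
    open Updates k
    open Search k using (hit≤1)

    likelihood : ℕ → ℕ → ℕ → ℚ
    likelihood i z z′ = a i ^ z * b i ^ z′

    likelihood⁻¹ : ℕ → ℕ → ℕ → ℚ
    likelihood⁻¹ i z z′ = α i ^ z * β i ^ z′

    -- A likelihood below 1 speaks for a count of at least i. The answer is the largest such i; at 0
    -- nothing remains to be tested.
    estimate : ℕ → ℕ → ℕ → ℕ
    estimate zero    z z′ = 0
    estimate (suc j) z z′ with 1ℚ ≤? likelihood (suc j) z z′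
    ... | yes _ = estimate j z z′
    ... | no  _ = suc j

    -- z and z′ count the answers X ≤ y and X > y.
    count : ∀ {n r} → Fin n → (m z z′ : ℕ) → (ℕ → Tree n r) → Tree n (m ℕ.+ r)
    count y zero    z z′ cont = cont (estimate k z z′)
    count y (suc m) z z′ cont = node y (count y m (suc z) z′ cont) (count y m z (suc z′) cont)

    0≤likelihood : ∀ i z z′ → 0ℚ ≤ likelihood i z z′
    0≤likelihood i z z′ = 0≤* (^-nonNeg z (<⇒≤ (0<a i))) (^-nonNeg z′ (<⇒≤ (0<b i)))

    0≤likelihood⁻¹ : ∀ i z z′ → 0ℚ ≤ likelihood⁻¹ i z z′
    0≤likelihood⁻¹ i z z′ = 0≤* (^-nonNeg z (<⇒≤ (0<α i))) (^-nonNeg z′ (<⇒≤ (0<β i)))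

    likelihood-inverse : ∀ i z z′ → likelihood i z z′ * likelihood⁻¹ i z z′ ≡ 1ℚ
    likelihood-inverse i z z′ = begin
      a i ^ z * b i ^ z′ * (α i ^ z * β i ^ z′)     ≡⟨ eq (a i ^ z) _ _ _ ⟩
      (a i ^ z * α i ^ z) * (b i ^ z′ * β i ^ z′)   ≡⟨ cong₂ _*_ (one z (aα i)) (one z′ (bβ i)) ⟩
      1ℚ * 1ℚ                                       ≡⟨⟩
      1ℚ                                            ∎
      where
      open ≡-Reasoning
      eq : ∀ a b c d → a * b * (c * d) ≡ (a * c) * (b * d)
      eq = solve-∀ ℚ-ring
      one : ∀ {x y} z → x * y ≡ 1ℚ → x ^ z * y ^ z ≡ 1ℚ
      one {x} {y} z h = trans (sym (^-distrib-* x y z)) (trans (cong (_^ z) h) (1^ z))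

    likelihood-mono : ∀ {i j} z z′ → i ℕ.≤ j → likelihood i z z′ ≤ likelihood j z z′
    likelihood-mono {i} {j} z z′ i≤j = *-mono (^-nonNeg z (<⇒≤ (0<a j))) (^-nonNeg z′ (<⇒≤ (0<b i)))
      (^-monoˡ z (<⇒≤ (0<a i)) (a-mono i≤j)) (^-monoˡ z′ (<⇒≤ (0<b i)) (b-mono i≤j))

    estimate-correct : ∀ {c z z′} j → c ℕ.≤ j → likelihood c z z′ < 1ℚ → 1ℚ ≤ likelihood (suc c) z z′ → estimate j z z′ ≡ c
    estimate-correct zero ℕ.z≤n _ _ = refl
    estimate-correct {c} {z} {z′} (suc j) c≤ <1 1≤ with 1ℚ ≤? likelihood (suc j) z z′ | ℕ.m≤n⇒m<n∨m≡n c≤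
    ... | yes _ | inj₁ (ℕ.s≤s c≤j) = estimate-correct j c≤j <1 1≤
    ... | yes l | inj₂ refl        = contradiction (<-≤-trans <1 l) (<-irrefl refl)
    ... | no  l | inj₁ c<j         = contradiction (≤-trans 1≤ (likelihood-mono z z′ c<j)) l
    ... | no  _ | inj₂ refl        = refl

    module _ {n} (S : Multiset n) (ΣS : Vec.sum S ≡ k) (y : Fin n) where

      private
        c = cntLe S y
        Φ : ℕ → ℕ → ℚ
        Φ z z′ = likelihood c z z′ + likelihood⁻¹ (suc c) z z′

        c≤k : c ℕ.≤ k
        c≤k = subst (c ℕ.≤_) ΣS (cntLe≤sum S y)

      -- As the likelihood increases with i, the estimate is right once the tests at c and at c + 1
      -- are. A failure of the first makes the first summand of Φ at least 1, a failure of the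
      -- second makes the inverse likelihood at least 1.
      1≤Φ : ∀ z z′ → estimate k z z′ ≢ c → 1ℚ ≤ Φ z z′
      1≤Φ z z′ wrong with 1ℚ ≤? likelihood c z z′ | 1ℚ ≤? likelihood (suc c) z z′
      ... | yes 1≤ | _      = ≤-trans 1≤ (≤-by _ (0≤likelihood⁻¹ (suc c) z z′) refl)
      ... | no 1≰  | yes 1≤ = contradiction (estimate-correct k c≤k (≰⇒> 1≰) 1≤) wrong
      ... | no _   | no 1≰  = begin
        1ℚ                                                         ≡⟨ likelihood-inverse (suc c) z z′ ⟨
        likelihood (suc c) z z′ * likelihood⁻¹ (suc c) z z′        ≤⟨ *-monoˡ (0≤likelihood⁻¹ (suc c) z z′) (<⇒≤ (≰⇒> 1≰)) ⟩
        1ℚ * likelihood⁻¹ (suc c) z z′                             ≤⟨ ≤-by _ (0≤likelihood c z z′) (eq (likelihood c z z′) (likelihood⁻¹ (suc c) z z′)) ⟩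
        Φ z z′                                                     ∎
        where
        open ≤-Reasoning
        eq : ∀ x y → x + y ≡ 1ℚ * y + x
        eq = solve-∀ ℚ-ring

      -- Markov's inequality again: Φ dominates the indicator of a wrong estimate, and both of its
      -- summands contract by γ in expectation, since the true probability c/k lies half a step from
      -- either threshold.
      count-correct : ∀ m z z′ {r} (cont : ℕ → Tree n r) →
        hit S S (cont c) - hit S S (count y m z z′ cont) ≤ γ ^ m * Φ z z′
      count-correct zero z z′ cont with estimate k z z′ ℕ.≟ c
      ... | yes e = ≤-trans (≤-reflexive (trans (cong (λ j → hit S S (cont c) - hit S S (cont j)) e) (+-inverseʳ (hit S S (cont c)))))
                      (0≤* (nonNegative⁻¹ 1ℚ) (0≤+ (0≤likelihood c z z′) (0≤likelihood⁻¹ (suc c) z z′)))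
      ... | no ne = ≤-trans (+-mono-≤ (hit≤1 S ΣS S (cont c)) (neg-antimono-≤ (0≤hit S ΣS S (cont (estimate k z z′)))))
                      (≤-trans (1≤Φ z z′ ne) (≤-reflexive (sym (*-identityˡ _))))
      count-correct (suc m) z z′ cont = begin
        σ - (p * l + (1ℚ - p) * r)
          ≡⟨ eq₁ σ p l r ⟩
        p * (σ - l) + (1ℚ - p) * (σ - r)
          ≤⟨ +-mono-≤ (*-monoʳ (0≤prob S ΣS y) (count-correct m (suc z) z′ cont)) (*-monoʳ (0≤1-prob S ΣS y) (count-correct m z (suc z′) cont)) ⟩
        p * (γ ^ m * Φ (suc z) z′) + (1ℚ - p) * (γ ^ m * Φ z (suc z′))
          ≡⟨ eq₂ p (γ ^ m) (a c) (b c) (α (suc c)) (β (suc c)) (a c ^ z) (b c ^ z′) (α (suc c) ^ z) (β (suc c) ^ z′) ⟩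
        γ ^ m * ((p * a c + (1ℚ - p) * b c) * likelihood c z z′ + (p * α (suc c) + (1ℚ - p) * β (suc c)) * likelihood⁻¹ (suc c) z z′)
          ≤⟨ *-monoʳ (^-nonNeg m 0≤γ) (+-mono-≤
               (*-monoˡ (0≤likelihood c z z′) (contract-above c (prob-above S y ℕ.≤-refl)))
               (*-monoˡ (0≤likelihood⁻¹ (suc c) z z′) (contract-below {p} (suc c) (ℕ.s≤s c≤k) (prob-below S y ℕ.≤-refl)))) ⟩
        γ ^ m * (γ * likelihood c z z′ + γ * likelihood⁻¹ (suc c) z z′)
          ≡⟨ eq₃ (γ ^ m) γ (likelihood c z z′) (likelihood⁻¹ (suc c) z z′) ⟩
        γ ^ suc m * Φ z z′ ∎
        where
        open ≤-Reasoning
        p = prob S y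
        σ = hit S S (cont c)
        l = hit S S (count y m (suc z) z′ cont)
        r = hit S S (count y m z (suc z′) cont)
        eq₁ : ∀ σ p l r → σ - (p * l + (1ℚ - p) * r) ≡ p * (σ - l) + (1ℚ - p) * (σ - r)
        eq₁ = solve-∀ ℚ-ring
        eq₂ : ∀ p g a b α β x y u v → p * (g * (a * x * y + α * u * v)) + (1ℚ - p) * (g * (x * (b * y) + u * (β * v))) ≡
          g * ((p * a + (1ℚ - p) * b) * (x * y) + (p * α + (1ℚ - p) * β) * (u * v))
        eq₂ = solve-∀ ℚ-ring
        eq₃ : ∀ g γ x y → g * (γ * x + γ * y) ≡ γ * g * (x + y)
        eq₃ = solve-∀ ℚ-ring

      count-error : ∀ m {r} (cont : ℕ → Tree n r) → hit S S (cont c) - hit S S (count y m 0 0 cont) ≤ γ ^ m * (1ℚ + 1ℚ)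
      count-error m cont = count-correct m 0 0 cont

  -- Composition of stages and reconstruction of the multiset

  module Stages (k : ℕ) .{{_ : NonZero k}} where

    open Querying k
    open Updates k
    open Search k
    open Estimate k

    -- A procedure in continuation-passing form: after m queries it hands its result to the rest of
    -- the tree.
    Stage : ℕ → ℕ → Set → Set
    Stage n m R = ∀ {r} → (R → Tree n r) → Tree n (m ℕ.+ r)

    -- The loss is measured against a continuation that is told the right result x for free.
    -- Quantifying over all continuations makes such losses additive.
    ErrorBound : ∀ {n m} {R : Set} → Multiset n → Stage n m R → ℚ → R → Set
    ErrorBound {n} {m} {R} S stage ε x = ∀ {r} (cont : R → Tree n r) → hit S S (cont x) - hit S S (stage cont) ≤ ε

    sequence : ∀ {n m} {I R : Set} → (I → Stage n m R) → (is : List I) → (List R → Multiset n) → Tree n (length is ℕ.* m)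
    sequence stage []       out = leaf (out [])
    sequence {m = m} stage (i ∷ is) out = stage i (λ x → sequence stage is (λ xs → out (x ∷ xs)))

    -- A union bound by telescoping: replace the results of the stages by the correct ones, one
    -- after the other, each at a cost of at most ε.
    sequence-correct : ∀ {n m} {I R : Set} (S : Multiset n) (stage : I → Stage n m R) ε {is xs} out →
      Pointwise (λ i → ErrorBound S (stage i) ε) is xs → out xs ≡ S →
      1ℚ - hit S S (sequence stage is out) ≤ ι (length is) * ε
    sequence-correct S stage ε out [] refl with Vec.≡-dec ℕ._≟_ S S
    ... | yes _  = ≤-reflexive (sym (trans (cong (_* ε) ι0) (*-zeroˡ ε)))
    ... | no S≢S = contradiction refl S≢S
    sequence-correct S stage ε {i ∷ is} {x ∷ xs} out (e ∷ es) h = begin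
      1ℚ - hit S S (stage i cont)                                       ≡⟨ eq (hit S S (stage i cont)) (hit S S (cont x)) ⟩
      (hit S S (cont x) - hit S S (stage i cont)) + (1ℚ - hit S S (cont x)) ≤⟨ +-mono-≤ (e cont) (sequence-correct S stage ε (λ xs → out (x ∷ xs)) es h) ⟩
      ε + ι (length is) * ε                                             ≡⟨ eq′ ε (ι (length is)) ⟩
      (1ℚ + ι (length is)) * ε                                          ≡⟨ cong (_* ε) (ι-suc (length is)) ⟨
      ι (suc (length is)) * ε                                           ∎
      where
      open ≤-Reasoning
      cont = λ x → sequence stage is (λ xs → out (x ∷ xs))
      eq : ∀ s c → 1ℚ - s ≡ (c - s) + (1ℚ - c)
      eq = solve-∀ ℚ-ring
      eq′ : ∀ ε n → ε + n * ε ≡ (1ℚ + n) * ε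
      eq′ = solve-∀ ℚ-ring

    solvable : ∀ {n q δ} (T : Tree n q) → (∀ S → Vec.sum S ≡ k → 1ℚ - hit S S T ≤ δ) → Solvable n k δ q
    solvable {δ = δ} T h = ((1ℚ , T) ∷ []) , (nonNegative⁻¹ 1ℚ ∷ [] , refl) , λ S ΣS →
      ≤-by (δ - (1ℚ - hit S S T)) (0≤-diff (h S ΣS))
        (trans (cong (λ s → 1ℚ * s + 0ℚ) (succProb≡hit S T)) (eq (hit S S T) δ))
      where
      eq : ∀ s δ → 1ℚ * s + 0ℚ ≡ 1ℚ - δ + (δ - (1ℚ - s))
      eq = solve-∀ ℚ-ring

    elements : ∀ {n} → Multiset n → List (Fin n)
    elements []      = []
    elements (x ∷ S) = List.replicate x zero List.++ List.map suc (elements S)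

    insert : ∀ {n} → Fin n → Multiset n → Multiset n
    insert zero    (x ∷ S) = suc x ∷ S
    insert (suc i) (x ∷ S) = x ∷ insert i S

    collect : ∀ {n} → List (Fin n) → Multiset n
    collect = List.foldr insert (Vec.replicate _ 0)

    collect-elements : ∀ {n} (S : Multiset n) → collect (elements S) ≡ S
    collect-elements []      = refl
    collect-elements (x ∷ S) = trans (zeros x (List.map suc (elements S)))
      (trans (cong (prepend x) (sucs (elements S))) (cong₂ _∷_ (ℕ.+-identityʳ x) (collect-elements S)))
      where
      prepend : ∀ {n} → ℕ → Multiset (suc n) → Multiset (suc n)
      prepend x (z ∷ S) = (x ℕ.+ z) ∷ S
      zeros : ∀ {n} x (ys : List (Fin (suc n))) → collect (List.replicate x zero List.++ ys) ≡ prepend x (collect ys)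
      zeros zero    ys with collect ys
      ... | _ ∷ _ = refl
      zeros (suc x) ys rewrite zeros x ys with collect ys
      ... | _ ∷ _ = refl
      sucs : ∀ {n} (ys : List (Fin n)) → collect (List.map suc ys) ≡ 0 ∷ collect ys
      sucs []       = refl
      sucs (y ∷ ys) rewrite sucs ys = refl

    range : ℕ → ℕ → List ℕ
    range i zero    = []
    range i (suc m) = i ∷ range (suc i) m

    length-range : ∀ i m → length (range i m) ≡ m
    length-range i zero    = refl
    length-range i (suc m) = cong suc (length-range (suc i) m)

    -- In increasing order with repetitions, the element with index i has rank i + 1. Equal elements
    -- occupy several ranks, and each rank is searched for on its own.
    ranks : ∀ {n} (S : Multiset n) → Pointwise (IsRank S) (range 0 (Vec.sum S)) (elements S)
    ranks []      = []
    ranks (x ∷ S) = zeros x 0 (ℕ.+-identityʳ x) (sucs 0 (Vec.sum S) (ranks S))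
      where
      sucs : ∀ j m {ys} → Pointwise (IsRank S) (range j m) ys → Pointwise (IsRank (x ∷ S)) (range (x ℕ.+ j) m) (List.map suc ys)
      sucs j zero    []       = []
      sucs j (suc m) {y ∷ ys} (r ∷ rs) = record { below = below′ ; above = above′ } ∷
        subst (λ i → Pointwise (IsRank (x ∷ S)) (range i m) (List.map suc ys)) (ℕ.+-suc x j) (sucs (suc j) m rs)
        where
        open IsRank r
        below′ : ∀ z → toℕ z ℕ.< suc (toℕ y) → cntLe (x ∷ S) z ℕ.≤ x ℕ.+ j
        below′ zero    _         = ℕ.m≤m+n x j
        below′ (suc z) (ℕ.s≤s h) = ℕ.+-monoʳ-≤ x (below z h)
        above′ : ∀ z → suc (toℕ y) ℕ.≤ toℕ z → x ℕ.+ j ℕ.< cntLe (x ∷ S) z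
        above′ (suc z) (ℕ.s≤s h) = ℕ.+-monoʳ-< x (above z h)
      -- Of the x copies of the first position, i have received their ranks and d are left.
      zeros : ∀ d i {m ys} → d ℕ.+ i ≡ x → Pointwise (IsRank (x ∷ S)) (range (x ℕ.+ 0) m) ys →
              Pointwise (IsRank (x ∷ S)) (range i (d ℕ.+ m)) (List.replicate d zero List.++ ys)
      zeros zero    i {m} {ys} refl rs = subst (λ j → Pointwise (IsRank (x ∷ S)) (range j m) ys) (ℕ.+-identityʳ i) rs
      zeros (suc d) i refl rs = record { below = λ _ () ; above = λ z _ → ℕ.<-≤-trans (ℕ.s≤s (ℕ.m≤n+m i d)) (x≤ z) } ∷
        zeros d (suc i) (ℕ.+-suc d i) rs
        where
        x≤ : ∀ z → x ℕ.≤ cntLe (x ∷ S) z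
        x≤ zero    = ℕ.≤-refl
        x≤ (suc z) = ℕ.m≤m+n x _

    range-< : ∀ {R : Set} {P Q : ℕ → R → Set} {N} i m {xs} → i ℕ.+ m ℕ.≤ N → (∀ {j x} → j ℕ.< N → P j x → Q j x) →
              Pointwise P (range i m) xs → Pointwise Q (range i m) xs
    range-< i zero    h f []       = []
    range-< {N = N} i (suc m) h f (p ∷ ps) = f (ℕ.≤-trans (ℕ.m≤m+n (suc i) m) h′) p ∷ range-< (suc i) m h′ f ps
      where
      h′ : suc i ℕ.+ m ℕ.≤ N
      h′ = subst (ℕ._≤ N) (ℕ.+-suc i m) h

    solvable-by-search : ∀ {n δ} t → ι k * (ρ ^ t * ι (suc n)) ≤ δ → Solvable (suc n) k δ (k ℕ.* (t ℕ.* 2))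
    solvable-by-search {n} {δ} t small = subst (λ l → Solvable (suc n) k δ (l ℕ.* (t ℕ.* 2))) (length-range 0 k)
      (solvable (sequence stage (range 0 k) collect) λ S ΣS → ≤-trans
        (sequence-correct S stage ε {range 0 k} {elements S} collect (bounds S ΣS) (collect-elements S))
        (subst (λ l → ι l * ε ≤ δ) (sym (length-range 0 k)) small))
      where
      ε = ρ ^ t * ι (suc n)
      stage : ℕ → Stage (suc n) (t ℕ.* 2) (Fin (suc n))
      stage i cont = search i t (λ _ → 1ℚ) cont
      bounds : ∀ S → Vec.sum S ≡ k → Pointwise (λ i → ErrorBound S (stage i) ε) (range 0 k) (elements S)
      bounds S ΣS = range-< 0 k ℕ.≤-refl (λ i<k rank cont → search-error S ΣS i<k rank t cont)
        (subst (λ m → Pointwise (IsRank S) (range 0 m) (elements S)) ΣS (ranks S))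

    -- Recovers multiplicities from cumulative counts, p being the previous one. Truncated
    -- subtraction and the zero default matter only for lists that do not come from a multiset.
    differences : ∀ {n} → ℕ → List ℕ → Multiset n
    differences {zero}  p _        = []
    differences {suc n} p []       = Vec.replicate _ 0
    differences {suc n} p (c ∷ cs) = c ℕ.∸ p ∷ differences c cs

    differences-cntLe : ∀ {n} p (S : Multiset n) → differences p (List.tabulate (λ y → p ℕ.+ cntLe S y)) ≡ S
    differences-cntLe p []      = refl
    differences-cntLe p (x ∷ S) = cong₂ _∷_ (ℕ.m+n∸m≡n p x)
      (trans (cong (differences (p ℕ.+ x)) (List.tabulate-cong (λ y → sym (ℕ.+-assoc p x (cntLe S y))))) (differences-cntLe (p ℕ.+ x) S))

    solvable-by-estimation : ∀ {n δ} m → ι n * (γ ^ m * (1ℚ + 1ℚ)) ≤ δ → Solvable n k δ (n ℕ.* m)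
    solvable-by-estimation {n} {δ} m small = subst (λ l → Solvable n k δ (l ℕ.* m)) length-allFin
      (solvable (sequence stage (List.allFin n) (differences 0)) λ S ΣS → ≤-trans
        (sequence-correct S stage ε (differences 0) (Pointwise.tabulate⁺ (λ y → count-error S ΣS y m)) (differences-cntLe 0 S))
        (subst (λ l → ι l * ε ≤ δ) (sym length-allFin) small))
      where
      ε = γ ^ m * (1ℚ + 1ℚ)
      stage : Fin n → Stage n m ℕ
      stage y cont = count y m 0 0 cont
      length-allFin : length (List.allFin n) ≡ n
      length-allFin = List.length-tabulate {n = n} (λ y → y)

  -- Numbers of queries in the upper bounds

  n≤2^⌈log₂n⌉ : ∀ n → n ℕ.≤ 2 ℕ.^ ⌈log₂ n ⌉
  n≤2^⌈log₂n⌉ = <-rec _ step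
    where
    step : ∀ n → (∀ {m} → m ℕ.< n → m ℕ.≤ 2 ℕ.^ ⌈log₂ m ⌉) → n ℕ.≤ 2 ℕ.^ ⌈log₂ n ⌉
    step 0 _ = ℕ.z≤n
    step 1 _ = ℕ.≤-refl
    step n@(suc (suc n-2)) rec = begin
      n                                      ≡⟨ ℕ.⌊n/2⌋+⌈n/2⌉≡n n ⟨
      ℕ.⌊ n /2⌋ ℕ.+ ℕ.⌈ n /2⌉                ≤⟨ ℕ.+-monoˡ-≤ ℕ.⌈ n /2⌉ (ℕ.⌊n/2⌋≤⌈n/2⌉ n) ⟩
      ℕ.⌈ n /2⌉ ℕ.+ ℕ.⌈ n /2⌉                ≡⟨ cong (ℕ.⌈ n /2⌉ ℕ.+_) (sym (ℕ.+-identityʳ _)) ⟩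
      2 ℕ.* ℕ.⌈ n /2⌉                        ≤⟨ ℕ.*-monoʳ-≤ 2 (rec (ℕ.⌈n/2⌉<n n-2)) ⟩
      2 ℕ.^ suc ⌈log₂ ℕ.⌈ n /2⌉ ⌉            ≡⟨ cong (λ l → 2 ℕ.^ suc l) (⌈log₂⌈n/2⌉⌉≡⌈log₂n⌉∸1 n) ⟩
      2 ℕ.^ suc (⌈log₂ n ⌉ ℕ.∸ 1)            ≡⟨ cong (2 ℕ.^_) (ℕ.m+[n∸m]≡n (⌈log₂⌉-mono-≤ {2} {n} (ℕ.s≤s (ℕ.s≤s ℕ.z≤n)))) ⟩
      2 ℕ.^ ⌈log₂ n ⌉                        ∎
      where open ℕ.≤-Reasoning

  module _ (β n k : ℕ) .{{_ : NonZero k}} (2≤n : 2 ℕ.≤ n) (δ : ℚ) (1≤δn^β : 1ℚ ≤ δ * ℕ→ℚ (n ℕ.^ β)) where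

    open Updates k using (ρ; γ; 0≤ρ; 0≤γ; γ≤ρ; ρ^≤½)
    open Stages k

    private
      L = ⌈log₂ n ⌉
      -- By `ρ^≤½`, 32 k² steps halve the potential, and (β + 2) L halvings bring it below n^(-β-2):
      -- the exponent β is for δ, and the other two pay the factor n² in `n*n*X≤δ`.
      steps = 32 ℕ.* (k ℕ.* k) ℕ.* ((β ℕ.+ 2) ℕ.* L)
      X = ρ ^ steps

    0≤X : 0ℚ ≤ X
    0≤X = ^-nonNeg steps 0≤ρ

    X*n^[β+2]≤1 : X * ι (n ℕ.^ (β ℕ.+ 2)) ≤ 1ℚ
    X*n^[β+2]≤1 = begin
      X * ι (n ℕ.^ (β ℕ.+ 2))         ≡⟨ cong (_* ι (n ℕ.^ (β ℕ.+ 2))) (sym (^-assocʳ ρ (32 ℕ.* (k ℕ.* k)) j)) ⟩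
      (ρ ^ (32 ℕ.* (k ℕ.* k))) ^ j * ι (n ℕ.^ (β ℕ.+ 2))
        ≤⟨ *-mono (^-nonNeg j (nonNegative⁻¹ ½)) (0≤ι _) (^-monoˡ j (^-nonNeg (32 ℕ.* (k ℕ.* k)) 0≤ρ) ρ^≤½) (ι-mono n^≤) ⟩
      ½ ^ j * ι (2 ℕ.^ j)             ≡⟨ cong (½ ^ j *_) (trans (ι-^ 2 j) (cong (_^ j) (sym (ι≡ 2)))) ⟩
      ½ ^ j * ℕ→ℚ 2 ^ j               ≡⟨ trans (sym (^-distrib-* ½ (ℕ→ℚ 2) j)) (1^ j) ⟩
      1ℚ                              ∎
      where
      open ≤-Reasoning
      j = (β ℕ.+ 2) ℕ.* L
      n^≤ : n ℕ.^ (β ℕ.+ 2) ℕ.≤ 2 ℕ.^ j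
      n^≤ = ℕ.≤-trans (ℕ.^-monoˡ-≤ (β ℕ.+ 2) (n≤2^⌈log₂n⌉ n))
        (ℕ.≤-reflexive (trans (ℕ.^-*-assoc 2 L (β ℕ.+ 2)) (cong (2 ℕ.^_) (ℕ.*-comm L (β ℕ.+ 2)))))

    n*n*X≤δ : ι n * ι n * X ≤ δ
    n*n*X≤δ = *-cancelˡ-≤ {c = ι (n ℕ.^ β)} (0<ι (n ℕ.^ β) {{ℕ.m^n≢0 n β {{n≢0}}}}) (begin
      ι (n ℕ.^ β) * (ι n * ι n * X)             ≡⟨ eq (ι (n ℕ.^ β)) (ι n) X ⟩
      X * (ι (n ℕ.^ β) * (ι n * (ι n * 1ℚ)))    ≡⟨ cong (λ z → X * (ι (n ℕ.^ β) * z)) (sym (ι-^ n 2)) ⟩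
      X * (ι (n ℕ.^ β) * ι (n ℕ.^ 2))           ≡⟨ cong (X *_) (trans (sym (ι-* (n ℕ.^ β) (n ℕ.^ 2))) (cong ι (sym (ℕ.^-distribˡ-+-* n β 2)))) ⟩
      X * ι (n ℕ.^ (β ℕ.+ 2))                   ≤⟨ X*n^[β+2]≤1 ⟩
      1ℚ                                        ≤⟨ 1≤δn^β ⟩
      δ * ℕ→ℚ (n ℕ.^ β)                         ≡⟨ trans (cong (δ *_) (ι≡ (n ℕ.^ β))) (*-comm δ _) ⟩
      ι (n ℕ.^ β) * δ                           ∎)
      where
      open ≤-Reasoning
      n≢0 : NonZero n
      n≢0 = ℕ.>-nonZero (ℕ.<⇒≤ 2≤n)
      eq : ∀ b n x → b * (n * n * x) ≡ x * (b * (n * (n * 1ℚ)))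
      eq = solve-∀ ℚ-ring

    upper-k≤n : k ℕ.≤ n → Solvable n k δ (64 ℕ.* (β ℕ.+ 2) ℕ.* (k ℕ.* k ℕ.* k ℕ.* L))
    upper-k≤n k≤n = subst (Solvable n k δ) (eq k β L) (go n refl)
      where
      eq : ∀ k β L → k ℕ.* (32 ℕ.* (k ℕ.* k) ℕ.* ((β ℕ.+ 2) ℕ.* L) ℕ.* 2) ≡ 64 ℕ.* (β ℕ.+ 2) ℕ.* (k ℕ.* k ℕ.* k ℕ.* L)
      eq = ℕ-Solver.solve-∀
      eq′ : ∀ n X → n * (X * n) ≡ n * n * X
      eq′ = solve-∀ ℚ-ring
      small : ι k * (X * ι n) ≤ δ
      small = ≤-trans (*-monoˡ (0≤* 0≤X (0≤ι n)) (ι-mono k≤n)) (≤-trans (≤-reflexive (eq′ (ι n) X)) n*n*X≤δ)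
      go : ∀ m → m ≡ n → Solvable m k δ (k ℕ.* (steps ℕ.* 2))
      go zero    m≡n = contradiction (subst (2 ℕ.≤_) (sym m≡n) 2≤n) λ ()
      go (suc m) m≡n = solvable-by-search steps (subst (λ n → ι k * (X * ι n) ≤ δ) (sym m≡n) small)

    -- Here the factor n² is used for the union bound over n counts and for the initial potential 2
    -- ≤ n.
    upper-n≤k : Solvable n k δ (64 ℕ.* (β ℕ.+ 2) ℕ.* (k ℕ.* k ℕ.* n ℕ.* L))
    upper-n≤k = subst (Solvable n k δ) (eq n k β L) (solvable-by-estimation (steps ℕ.* 2) (begin
      ι n * (γ ^ (steps ℕ.* 2) * (1ℚ + 1ℚ))  ≤⟨ *-monoʳ (0≤ι n) (*-mono 0≤X (nonNegative⁻¹ (1ℚ + 1ℚ)) γ^≤X (subst (_≤ ι n) (sym (ι≡ 2)) (ι-mono 2≤n))) ⟩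
      ι n * (X * ι n)                        ≡⟨ eq′ (ι n) X ⟩
      ι n * ι n * X                          ≤⟨ n*n*X≤δ ⟩
      δ                                      ∎))
      where
      open ≤-Reasoning
      eq : ∀ n k β L → n ℕ.* (32 ℕ.* (k ℕ.* k) ℕ.* ((β ℕ.+ 2) ℕ.* L) ℕ.* 2) ≡ 64 ℕ.* (β ℕ.+ 2) ℕ.* (k ℕ.* k ℕ.* n ℕ.* L)
      eq = ℕ-Solver.solve-∀
      eq′ : ∀ n X → n * (X * n) ≡ n * n * X
      eq′ = solve-∀ ℚ-ring
      γ^≤X : γ ^ (steps ℕ.* 2) ≤ X
      γ^≤X = begin
        γ ^ (steps ℕ.* 2)     ≡⟨ ^-assocʳ γ steps 2 ⟨
        (γ ^ steps) ^ 2       ≤⟨ ^-monoˡ 2 (^-nonNeg steps 0≤γ) (^-monoˡ steps 0≤γ γ≤ρ) ⟩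
        X * (X * 1ℚ)          ≤⟨ *-monoʳ 0≤X (≤-trans (≤-reflexive (*-identityʳ X)) (^-≤1 steps 0≤ρ ρ≤1)) ⟩
        X * 1ℚ                ≡⟨ *-identityʳ X ⟩
        X                     ∎
        where
        ρ≤1 : ρ ≤ 1ℚ
        ρ≤1 = Updates.ρ≤1 k

-- Parameters of the lower bound

module Choices where

  open import Data.Nat
  open import Data.Nat.Properties
  open import Data.Nat.DivMod
  open import Data.Nat.Tactic.RingSolver using (solve-∀)
  open Queries using (¼; module LowerBound; module Hypotheses)

  8≤⌈log₂⌉ : ∀ {n} → 256 ≤ n → 8 ≤ ⌈log₂ n ⌉
  8≤⌈log₂⌉ {n} h = subst (_≤ ⌈log₂ n ⌉) (⌈log₂2^n⌉≡n 8) (⌈log₂⌉-mono-≤ {2 ^ 8} h)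

  ⌈log₂⌉≤ : ∀ {n j} → n ≤ 2 ^ j → ⌈log₂ n ⌉ ≤ j
  ⌈log₂⌉≤ {n} {j} h = subst (⌈log₂ n ⌉ ≤_) (⌈log₂2^n⌉≡n j) (⌈log₂⌉-mono-≤ h)

  -- The worst case of rounding down is a = 5.
  ≤5*/3 : ∀ a → 3 ≤ a → a ≤ 5 * (a / 3)
  ≤5*/3 a 3≤a = begin
    a                        ≡⟨ m≡m%n+[m/n]*n a 3 ⟩
    a % 3 + a / 3 * 3        ≤⟨ +-monoˡ-≤ (a / 3 * 3) (≤-pred (m%n<n a 3)) ⟩
    2 + a / 3 * 3            ≤⟨ +-monoˡ-≤ (a / 3 * 3) (*-monoʳ-≤ 2 (/-monoˡ-≤ 3 3≤a)) ⟩
    2 * (a / 3) + a / 3 * 3  ≡⟨ eq (a / 3) ⟩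
    5 * (a / 3)              ∎
    where
    open ≤-Reasoning
    eq : ∀ x → 2 * x + x * 3 ≡ 5 * x
    eq = solve-∀

  m≤n*[1+m/n] : ∀ m n .{{_ : NonZero n}} → m ≤ n * suc (m / n)
  m≤n*[1+m/n] m n = begin
    m                   ≡⟨ m≡m%n+[m/n]*n m n ⟩
    m % n + m / n * n   ≤⟨ +-monoˡ-≤ (m / n * n) (<⇒≤ (m%n<n m n)) ⟩
    n + m / n * n       ≡⟨ *-comm (suc (m / n)) n ⟩
    n * suc (m / n)     ∎
    where open ≤-Reasoning

  module _ {n k q : ℕ} .{{k≢0 : NonZero k}} {δ : ℚ} (256≤n : 256 ≤ n) (δ≤¼ : δ ℚ.≤ ¼) (solvable : Solvable n k δ q) where

    private L = ⌈log₂ n ⌉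

    -- κ stands for min(k, n), which treats both ranges of the theorem at once.
    lower-large : ∀ κ → 3 ≤ κ → κ ≤ k → κ ≤ n → k * k * κ * L ≤ 500 * q
    lower-large κ 3≤κ κ≤k κ≤n = begin
      k * k * κ * L                           ≤⟨ *-monoˡ-≤ L (*-mono-≤ (*-mono-≤ k≤5t k≤5t) (≤5*/3 κ 3≤κ)) ⟩
      5 * t * (5 * t) * (5 * K) * L           ≡⟨ eq₁ t K L ⟩
      125 * (m * L)                           ≤⟨ *-monoʳ-≤ 125 (*-monoʳ-≤ m L≤4d) ⟩
      125 * (m * (4 * (q / m)))               ≡⟨ eq₂ m (q / m) ⟩
      500 * (q / m * m)                       ≤⟨ *-monoʳ-≤ 500 (m/n*n≤m q m) ⟩
      500 * q                                 ∎
      where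
      open ≤-Reasoning
      t = k / 3
      K = κ / 3
      k≤5t : k ≤ 5 * t
      k≤5t = ≤5*/3 k (≤-trans 3≤κ κ≤k)
      K≤t : K ≤ t
      K≤t = /-monoˡ-≤ 3 κ≤k
      1≤K : 1 ≤ K
      1≤K = /-monoˡ-≤ 3 3≤κ
      instance
        K≢0 : NonZero K
        K≢0 = >-nonZero 1≤K
        t≢0 : NonZero t
        t≢0 = >-nonZero (≤-trans 1≤K K≤t)
        tt≢0 : NonZero (t * t)
        tt≢0 = m*n≢0 t t
        m≢0 : NonZero (K * (t * t))
        m≢0 = m*n≢0 K (t * t)
      m = K * (t * t)
      -- All that is left goes to the right end; this is at least t because K ≤ t ≤ k/3.
      R = k ∸ (t + K)
      3t≤k : t + K + t ≤ k
      3t≤k = begin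
        t + K + t  ≤⟨ +-monoˡ-≤ t (+-monoʳ-≤ t K≤t) ⟩
        t + t + t  ≡⟨ eq t ⟩
        t * 3      ≤⟨ m/n*n≤m k 3 ⟩
        k          ∎
        where
        eq : ∀ t → t + t + t ≡ t * 3
        eq = solve-∀
      k≡ : t + (K + R) ≡ k
      k≡ = trans (sym (+-assoc t K R)) (m+[n∸m]≡n (≤-trans (m≤m+n (t + K) t) 3t≤k))
      t≤R : t ≤ R
      t≤R = subst (_≤ R) (m+n∸m≡n (t + K) t) (∸-monoˡ-≤ (t + K) 3t≤k)
      3K≤n : 3 * K ≤ n
      3K≤n = ≤-trans (subst (_≤ κ) (*-comm K 3) (m/n*n≤m κ 3)) κ≤n
      -- Set aside one position for each of the two fixed groups and one for each block. Of the
      -- rest, every block receives `M′` further positions, and the remainder r is padding.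
      n′ = n ∸ (2 + K)
      2+2K≤n : 2 + K + K ≤ n
      2+2K≤n = *-cancelˡ-≤ 3 (+-cancelˡ-≤ (2 * n) _ _ (begin
        2 * n + 3 * (2 + K + K)      ≡⟨ eq n K ⟩
        6 + 2 * n + 2 * (3 * K)      ≤⟨ +-mono-≤ (+-monoˡ-≤ (2 * n) (≤-trans (m≤m+n 6 250) 256≤n)) (*-monoʳ-≤ 2 3K≤n) ⟩
        n + 2 * n + 2 * n            ≡⟨ eq′ n ⟩
        2 * n + 3 * n                ∎))
        where
        eq : ∀ n K → 2 * n + 3 * (2 + K + K) ≡ 6 + 2 * n + 2 * (3 * K)
        eq = solve-∀
        eq′ : ∀ n → n + 2 * n + 2 * n ≡ 2 * n + 3 * n
        eq′ = solve-∀
      n≡ : 2 + K + n′ ≡ n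
      n≡ = m+[n∸m]≡n (≤-trans (m≤m+n (2 + K) K) 2+2K≤n)
      K≤n′ : K ≤ n′
      K≤n′ = subst (_≤ n′) (m+n∸m≡n (2 + K) K) (∸-monoˡ-≤ (2 + K) 2+2K≤n)
      M′ = n′ / K
      r = n′ % K
      instance
        M′≢0 : NonZero M′
        M′≢0 = >-nonZero (m≥n⇒m/n>0 K≤n′)
      module LB = LowerBound k M′ t K R r k≡
      open Hypotheses M′ (R ∷ Vec.replicate r 0) using (size; size≡)
      n≡size : n ≡ suc (size K)
      n≡size = sym (begin-equality
        suc (size K)                    ≡⟨ cong suc (size≡ K) ⟩
        suc (K * suc M′ + suc r)        ≡⟨ eq K M′ r ⟩
        2 + K + (r + M′ * K)            ≡⟨ cong (2 + K +_) (sym (m≡m%n+[m/n]*n n′ K)) ⟩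
        2 + K + n′                      ≡⟨ n≡ ⟩
        n                               ∎)
        where
        eq : ∀ K M′ r → suc (K * suc M′ + suc r) ≡ 2 + K + (r + M′ * K)
        eq = solve-∀
      -- The smallest convenient j with q ≤ m j. The added 1 from rounding up is paid for below by
      -- the size of n.
      j = suc (q / m)
      2A≤4^j : 2 * (K * M′) ≤ 4 ^ j
      2A≤4^j = LB.2A≤4^j K≤t t≤R δ≤¼ (subst (λ n → Solvable n k δ q) n≡size solvable) j (m≤n*[1+m/n] q m)
      n≤6A : n ≤ 3 * (2 * (K * M′))
      n≤6A = +-cancelˡ-≤ (2 * n) _ _ (begin
        2 * n + n                            ≡⟨ cong (λ z → 2 * n + z) (trans (sym n≡) (cong (2 + K +_) (m≡m%n+[m/n]*n n′ K))) ⟩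
        2 * n + (2 + K + (r + M′ * K))       ≡⟨ cong (λ z → 2 * z + (2 + K + (r + M′ * K))) (trans (sym n≡) (cong (2 + K +_) (m≡m%n+[m/n]*n n′ K))) ⟩
        2 * (2 + K + (r + M′ * K)) + (2 + K + (r + M′ * K)) ≡⟨ eq K r (M′ * K) ⟩
        3 + 3 * K + 3 * suc r + 3 * (M′ * K) ≤⟨ +-monoˡ-≤ (3 * (M′ * K)) (+-mono-≤ (+-monoʳ-≤ 3 3K≤n) (≤-trans (*-monoʳ-≤ 3 (m%n<n n′ K)) 3K≤n)) ⟩
        3 + n + n + 3 * (M′ * K)             ≤⟨ +-monoˡ-≤ (3 * (M′ * K)) (+-monoˡ-≤ n (+-monoˡ-≤ n (*-monoʳ-≤ 3 (>-nonZero⁻¹ (M′ * K) {{m*n≢0 M′ K}})))) ⟩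
        3 * (M′ * K) + n + n + 3 * (M′ * K)  ≡⟨ eq′ K M′ n ⟩
        2 * n + 3 * (2 * (K * M′))           ∎)
        where
        eq : ∀ K r a → 2 * (2 + K + (r + a)) + (2 + K + (r + a)) ≡ 3 + 3 * K + 3 * suc r + 3 * a
        eq = solve-∀
        eq′ : ∀ K M′ n → 3 * (M′ * K) + n + n + 3 * (M′ * K) ≡ 2 * n + 3 * (2 * (K * M′))
        eq′ = solve-∀
      L≤ : L ≤ 2 * suc j
      L≤ = ⌈log₂⌉≤ {n} {2 * suc j} (begin
        n                   ≤⟨ n≤6A ⟩
        3 * (2 * (K * M′))  ≤⟨ *-mono-≤ {3} {4} (n≤1+n 3) 2A≤4^j ⟩
        4 ^ suc j           ≡⟨ ^-*-assoc 2 2 (suc j) ⟩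
        2 ^ (2 * suc j)     ∎)
      -- L is at most 4 + 2 (q / m). Doubling this and giving up one L ≥ 8 removes the additive
      -- constant.
      L≤4d : L ≤ 4 * (q / m)
      L≤4d = +-cancelˡ-≤ 8 _ _ (begin
        8 + L                     ≤⟨ +-monoˡ-≤ L (8≤⌈log₂⌉ 256≤n) ⟩
        L + L                     ≤⟨ +-mono-≤ L≤ L≤ ⟩
        2 * suc j + 2 * suc j     ≡⟨ eq (q / m) ⟩
        8 + 4 * (q / m)           ∎)
        where
        eq : ∀ d → 2 * suc (suc d) + 2 * suc (suc d) ≡ 8 + 4 * d
        eq = solve-∀
      eq₁ : ∀ t K L → 5 * t * (5 * t) * (5 * K) * L ≡ 125 * (K * (t * t) * L)
      eq₁ = solve-∀
      eq₂ : ∀ m d → 125 * (m * (4 * d)) ≡ 500 * (d * m)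
      eq₂ = solve-∀

    -- Information-theoretic bound: one element moves through n - 2 positions while the other k - 1
    -- stay at the left. Success at least 3/4 on all of these inputs needs 3 (n - 2) ≤ 4 · 2^q.
    L≤2q : L ≤ 2 * q
    L≤2q = +-cancelˡ-≤ 8 _ _ (begin
      8 + L                     ≤⟨ +-monoˡ-≤ L (8≤⌈log₂⌉ 256≤n) ⟩
      L + L                     ≤⟨ +-mono-≤ L≤ L≤ ⟩
      2 + q + (2 + q)           ≤⟨ m≤n+m _ 4 ⟩
      4 + (2 + q + (2 + q))     ≡⟨ eq q ⟩
      8 + 2 * q                 ∎)
      where
      open ≤-Reasoning
      eq : ∀ d → 4 + (2 + d + (2 + d)) ≡ 8 + 2 * d
      eq = solve-∀
      M′ = n ∸ 3
      n≡ : 3 + M′ ≡ n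
      n≡ = m+[n∸m]≡n (≤-trans (m≤m+n 3 253) 256≤n)
      module LB = LowerBound k M′ (k ∸ 1) 1 0 0 (trans (+-comm (k ∸ 1) 1) (suc-pred k))
      open Hypotheses M′ (0 ∷ Vec.replicate 0 0) using (size; length-all)
      n≡size : n ≡ suc (size 1)
      n≡size = trans (sym n≡) (cong suc (eq₁ M′))
        where
        eq₁ : ∀ M′ → 2 + M′ ≡ suc M′ + 1
        eq₁ = solve-∀
      L≤ : L ≤ 2 + q
      L≤ = ⌈log₂⌉≤ {n} {2 + q} (*-cancelˡ-≤ 3 (begin
        3 * n                          ≡⟨ cong (3 *_) (sym n≡) ⟩
        3 * (3 + M′)                   ≤⟨ *-monoʳ-≤ 3 (m≤m+n (3 + M′) (2 * M′)) ⟩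
        3 * (3 + M′ + 2 * M′)          ≡⟨ eq₂ M′ ⟩
        3 * (3 * suc M′)               ≤⟨ *-monoʳ-≤ 3 (subst (λ z → 3 * z ≤ 4 * 2 ^ q) (trans (length-all 1) (*-identityʳ (suc M′))) (LB.counting δ≤¼ (subst (λ n → Solvable n k δ q) n≡size solvable))) ⟩
        3 * (4 * 2 ^ q)                ≡⟨ cong (3 *_) (*-assoc 2 2 (2 ^ q)) ⟩
        3 * 2 ^ (2 + q)                ∎))
        where
        eq₂ : ∀ M′ → 3 * (3 + M′ + 2 * M′) ≡ 3 * (3 * suc M′)
        eq₂ = solve-∀

    lower-small : k ≤ 2 → k * k * k * L ≤ 500 * q
    lower-small k≤2 = begin
      k * k * k * L    ≤⟨ *-mono-≤ (*-mono-≤ (*-mono-≤ k≤2 k≤2) k≤2) L≤2q ⟩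
      8 * (2 * q)      ≡⟨ *-assoc 8 2 q ⟨
      16 * q           ≤⟨ *-monoˡ-≤ q (m≤m+n 16 484) ⟩
      500 * q          ∎
      where open ≤-Reasoning

    lower-k≤n : k ≤ n → k * k * k * L ≤ 500 * q
    lower-k≤n k≤n with 3 ≤? k
    ... | yes 3≤k = lower-large k 3≤k ≤-refl k≤n
    ... | no  3≰k = lower-small (≤-pred (≰⇒> 3≰k))

    lower-n≤k : n ≤ k → k * k * n * L ≤ 500 * q
    lower-n≤k n≤k = lower-large n (≤-trans (m≤m+n 3 253) 256≤n) n≤k ≤-refl

open import Data.Integer using (+_)
open import Data.Nat using (_*_; _^_; _≤_)
open import Data.Rational using (_/_; 1ℚ) renaming (_≤_ to _≤ℚ_; _<_ to _<ℚ_; _*_ to _*ℚ_)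
import Data.Rational.Properties as ℚ

theorem1 : (β : ℕ) → 1 ≤ β →
    ∃ λ (N₀ : ℕ) → ∃ λ (c₁ : ℕ) → ∃ λ (c₂ : ℕ) →
    (n k : ℕ) → .{{_ : NonZero k}} → N₀ ≤ n → 2 ≤ n →
    (δ : ℚ) → 1ℚ ≤ℚ δ *ℚ ℕ→ℚ (n ^ β) → δ <ℚ (+ 1 / 4) →
    (k ≤ n →
    Solvable n k δ (c₂ * (k * k * k * ⌈log₂ n ⌉))
    × ((q : ℕ) → Solvable n k δ q → k * k * k * ⌈log₂ n ⌉ ≤ c₁ * q))
    × (n ≤ k →
    Solvable n k δ (c₂ * (k * k * n * ⌈log₂ n ⌉))
    × ((q : ℕ) → Solvable n k δ q → k * k * n * ⌈log₂ n ⌉ ≤ c₁ * q))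
-- 256 = 2^8 gives the L ≥ 8 that absorbs the additive constants of the lower bounds. In 500 = 5³ ·
-- 4, each 5 undoes a rounding to a third and the 4 comes from `L≤4d`. The factor 64 is twice the 32
-- in `steps`.
theorem1 β 1≤β = 256 , 500 , 64 * (β ℕ.+ 2) , λ n k N₀≤n 2≤n δ 1≤δn^β δ<¼ →
  (λ k≤n → Queries.upper-k≤n β n k 2≤n δ 1≤δn^β k≤n ,
           λ q solvable → Choices.lower-k≤n N₀≤n (ℚ.<⇒≤ δ<¼) solvable k≤n) ,
  (λ n≤k → Queries.upper-n≤k β n k 2≤n δ 1≤δn^β ,
           λ q solvable → Choices.lower-n≤k N₀≤n (ℚ.<⇒≤ δ<¼) solvable n≤k)
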